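{- There is an absolute constant $C>0$ such that the following holds for all positive integers $n,r,k$ with $r\mid n$. Let $F$ be an $r$-vertex graph with maximum degree $\Delta$, and let $H$ be an $n$-vertex $F$-factor. Let $h\colon E(K_n)\to\mathbb{R}^k$ be such that $\|h(e)\|_1\le 1$ for all $e\in E(K_n)$. Then there is a copy $H'$ of $H$ in $K_n$ (a spanning subgraph of $K_n$ isomorphic to $H$) satisfying $f_h(H')\le C\,\Delta r k^2$.
   Context: For an $r$-vertex graph $F$, the $n$-vertex $F$-factor (where $r\mid n$) is the vertex-disjoint union of $n/r$ copies of $F$. For a graph $G$ with at least one edge, a function $h\colon E(G)\to\mathbb{R}^k$ and a subgraph $G'$ of $G$, write $e(G)=|E(G)|$, $h(G')=\sum_{e\in E(G')}h(e)$, and $f_h(G')=\left\|h(G')-\frac{e(G')}{e(G)}h(G)\right\|_1$, where $\|\cdot\|_1$ is the $\ell_1$ norm on $\mathbb{R}^k$. Here $G=K_n$, the complete graph on $n$ vertices. -}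

module Defs where

open import Data.Bool.Base using (Bool; true; false; T; not; _∧_)
open import Data.Fin.Base using (Fin; _<_)
open import Data.Fin.Properties using (_≟_; _<?_)
open import Data.Integer.Base using (+_)
open import Data.List.Base
  using (List; allFin; cartesianProduct; filterᵇ; foldr; length; map; mapMaybe)
open import Data.List.Extrema.Nat using (max)
open import Data.Maybe.Base using (Maybe; just; nothing)
open import Data.Nat.Base as ℕ using (ℕ; zero; suc)
open import Data.Nat.Properties as ℕ using ()
open import Data.Product.Base using (_×_; _,_; ∃-syntax)
open import Data.Rational.Base as ℚ using (ℚ; 0ℚ; 1ℚ; ½)
open import Data.Rational.Properties as ℚ using ()
open import Data.Rational.Solver using (module +-*-Solver)
open import Data.Sum.Base using (inj₁; inj₂)
open import Data.Vec.Functional as Vector using (Vector)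
open import Function.Base using (_∘_)
open import Function.Bundles using (_↔_; module Inverse)
open import Relation.Binary.PropositionalEquality
  using (_≡_; refl; sym; trans; cong; cong₂; subst)
open import Relation.Nullary.Decidable using (⌊_⌋; yes; no; T?)
open import Relation.Nullary.Negation using (contradiction)

private
  ∣p-q∣-comm : ∀ p q → ℚ.∣ p ℚ.- q ∣ ≡ ℚ.∣ q ℚ.- p ∣
  ∣p-q∣-comm p q = trans (sym (ℚ.∣-p∣≡∣p∣ (p ℚ.- q))) (cong ℚ.∣_∣ eq)
    where
    open +-*-Solver
    eq : ℚ.- (p ℚ.- q) ≡ q ℚ.- p
    eq = solve 2 (λ a b → :- (a :- b) := b :- a) refl p q

  ∣p∣-∣q∣≤∣p-q∣ : ∀ p q → ℚ.∣ p ∣ ℚ.- ℚ.∣ q ∣ ℚ.≤ ℚ.∣ p ℚ.- q ∣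
  ∣p∣-∣q∣≤∣p-q∣ p q = begin
    ℚ.∣ p ∣ ℚ.- ℚ.∣ q ∣                         ≡⟨ cong (λ t → ℚ.∣ t ∣ ℚ.- ℚ.∣ q ∣) p≡ ⟩
    ℚ.∣ (p ℚ.- q) ℚ.+ q ∣ ℚ.- ℚ.∣ q ∣           ≤⟨ ℚ.+-monoˡ-≤ (ℚ.- ℚ.∣ q ∣) (ℚ.∣p+q∣≤∣p∣+∣q∣ (p ℚ.- q) q) ⟩
    (ℚ.∣ p ℚ.- q ∣ ℚ.+ ℚ.∣ q ∣) ℚ.- ℚ.∣ q ∣     ≡⟨ cancel ℚ.∣ p ℚ.- q ∣ ℚ.∣ q ∣ ⟩
    ℚ.∣ p ℚ.- q ∣                               ∎
    where
    open ℚ.≤-Reasoning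
    open +-*-Solver
    p≡ : p ≡ (p ℚ.- q) ℚ.+ q
    p≡ = solve 2 (λ a b → a := (a :- b) :+ b) refl p q
    cancel : ∀ a b → (a ℚ.+ b) ℚ.- b ≡ a
    cancel = solve 2 (λ a b → (a :+ b) :- b := a) refl

  ∣∣p∣-∣q∣∣≤∣p-q∣ : ∀ p q → ℚ.∣ ℚ.∣ p ∣ ℚ.- ℚ.∣ q ∣ ∣ ℚ.≤ ℚ.∣ p ℚ.- q ∣
  ∣∣p∣-∣q∣∣≤∣p-q∣ p q with ℚ.∣p∣≡p∨∣p∣≡-p (ℚ.∣ p ∣ ℚ.- ℚ.∣ q ∣)
  ... | inj₁ eq = subst (ℚ._≤ ℚ.∣ p ℚ.- q ∣) (sym eq) (∣p∣-∣q∣≤∣p-q∣ p q)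
  ... | inj₂ eq = begin
    ℚ.∣ ℚ.∣ p ∣ ℚ.- ℚ.∣ q ∣ ∣    ≡⟨ eq ⟩
    ℚ.- (ℚ.∣ p ∣ ℚ.- ℚ.∣ q ∣)    ≡⟨ flip ℚ.∣ p ∣ ℚ.∣ q ∣ ⟩
    ℚ.∣ q ∣ ℚ.- ℚ.∣ p ∣          ≤⟨ ∣p∣-∣q∣≤∣p-q∣ q p ⟩
    ℚ.∣ q ℚ.- p ∣                ≡⟨ ∣p-q∣-comm q p ⟩
    ℚ.∣ p ℚ.- q ∣                ∎
    where
    open ℚ.≤-Reasoning
    open +-*-Solver
    flip : ∀ a b → ℚ.- (a ℚ.- b) ≡ b ℚ.- a
    flip = solve 2 (λ a b → :- (a :- b) := b :- a) refl

  halves : ∀ ε → ½ ℚ.* ε ℚ.+ ½ ℚ.* ε ≡ ε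
  halves ε = trans (sym (ℚ.*-distribʳ-+ ε ½ ½)) (ℚ.*-identityˡ ε)

  half-pos : ∀ {ε} → 0ℚ ℚ.< ε → 0ℚ ℚ.< ½ ℚ.* ε
  half-pos {ε} 0<ε =
    let instance _ = ℚ.positive 0<ε in ℚ.positive⁻¹ _ {{ℚ.pos*pos⇒pos ½ ε}}

  shrink : ∀ q ε → 0ℚ ℚ.< ε → ∃[ δ ] 0ℚ ℚ.< δ × ℚ.∣ q ∣ ℚ.* δ ℚ.≤ ε
  shrink q ε 0<ε = δ , ℚ.positive⁻¹ δ , (begin
    ℚ.∣ q ∣ ℚ.* δ               ≤⟨ ℚ.*-monoʳ-≤-nonNeg δ {{ℚ.pos⇒nonNeg δ}} ∣q∣≤b ⟩
    b ℚ.* (ℚ.1/ b ℚ.* ε)        ≡⟨ sym (ℚ.*-assoc b (ℚ.1/ b) ε) ⟩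
    (b ℚ.* ℚ.1/ b) ℚ.* ε        ≡⟨ cong (ℚ._* ε) (ℚ.*-inverseʳ b) ⟩
    1ℚ ℚ.* ε                    ≡⟨ ℚ.*-identityˡ ε ⟩
    ε                           ∎)
    where
    open ℚ.≤-Reasoning
    b = ℚ.∣ q ∣ ℚ.+ 1ℚ
    instance
      bPos : ℚ.Positive b
      bPos = ℚ.nonNeg+pos⇒pos ℚ.∣ q ∣ {{ℚ.nonNegative (ℚ.0≤∣p∣ q)}} 1ℚ
      bNonZero : ℚ.NonZero b
      bNonZero = ℚ.pos⇒nonZero b
    δ = ℚ.1/ b ℚ.* ε
    instance
      δPos : ℚ.Positive δ
      δPos = ℚ.pos*pos⇒pos (ℚ.1/ b) {{ℚ.1/pos⇒pos b}} ε {{ℚ.positive 0<ε}}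
    ∣q∣≤b : ℚ.∣ q ∣ ℚ.≤ b
    ∣q∣≤b = subst (ℚ._≤ b) (ℚ.+-identityʳ ℚ.∣ q ∣) (ℚ.+-monoʳ-≤ ℚ.∣ q ∣ (ℚ.<⇒≤ (ℚ.positive⁻¹ 1ℚ)))

Cauchy : (ℕ → ℚ) → Set
Cauchy x = ∀ ε → 0ℚ ℚ.< ε →
  ∃[ N ] (∀ m n → N ℕ.≤ m → N ℕ.≤ n → ℚ.∣ x m ℚ.- x n ∣ ℚ.≤ ε)

-- Real numbers are Cauchy sequences of rationals.  No quotient is taken: two
-- sequences denote the same real number when each is ≤ℝ the other.
record ℝ : Set where
  constructor mkℝ
  field
    approx : ℕ → ℚ
    cauchy : Cauchy approx

open ℝ public

infix  4 _≤ℝ_ _<ℝ_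
infixl 6 _+ℝ_ _-ℝ_
infixl 7 _·_

_≤ℝ_ : ℝ → ℝ → Set
x ≤ℝ y = ∀ ε → 0ℚ ℚ.< ε →
  ∃[ N ] (∀ n → N ℕ.≤ n → approx x n ℚ.≤ approx y n ℚ.+ ε)

_<ℝ_ : ℝ → ℝ → Set
x <ℝ y = ∃[ ε ] 0ℚ ℚ.< ε ×
  ∃[ N ] (∀ n → N ℕ.≤ n → approx x n ℚ.+ ε ℚ.≤ approx y n)

fromℚ : ℚ → ℝ
fromℚ q = mkℝ (λ _ → q) λ ε 0<ε → 0 , λ _ _ _ _ →
  subst (ℚ._≤ ε) (sym (cong ℚ.∣_∣ (ℚ.+-inverseʳ q))) (ℚ.<⇒≤ 0<ε)

0ℝ 1ℝ : ℝ
0ℝ = fromℚ 0ℚ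
1ℝ = fromℚ 1ℚ

_+ℝ_ : ℝ → ℝ → ℝ
x +ℝ y = mkℝ (λ n → approx x n ℚ.+ approx y n) c
  where
  open ℚ.≤-Reasoning
  swap : ∀ a b c d → (a ℚ.+ b) ℚ.- (c ℚ.+ d) ≡ (a ℚ.- c) ℚ.+ (b ℚ.- d)
  swap = solve 4 (λ a b c d → (a :+ b) :- (c :+ d) := (a :- c) :+ (b :- d)) refl
    where open +-*-Solver
  c : Cauchy (λ n → approx x n ℚ.+ approx y n)
  c ε 0<ε with cauchy x (½ ℚ.* ε) (half-pos 0<ε) | cauchy y (½ ℚ.* ε) (half-pos 0<ε)
  ... | M , p | N , q = M ℕ.⊔ N , λ m n m≥ n≥ → begin
    ℚ.∣ (approx x m ℚ.+ approx y m) ℚ.- (approx x n ℚ.+ approx y n) ∣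
      ≡⟨ cong ℚ.∣_∣ (swap (approx x m) (approx y m) (approx x n) (approx y n)) ⟩
    ℚ.∣ (approx x m ℚ.- approx x n) ℚ.+ (approx y m ℚ.- approx y n) ∣
      ≤⟨ ℚ.∣p+q∣≤∣p∣+∣q∣ (approx x m ℚ.- approx x n) (approx y m ℚ.- approx y n) ⟩
    ℚ.∣ approx x m ℚ.- approx x n ∣ ℚ.+ ℚ.∣ approx y m ℚ.- approx y n ∣
      ≤⟨ ℚ.+-mono-≤ (p m n (ℕ.m⊔n≤o⇒m≤o M N m≥) (ℕ.m⊔n≤o⇒m≤o M N n≥))
                    (q m n (ℕ.m⊔n≤o⇒n≤o M N m≥) (ℕ.m⊔n≤o⇒n≤o M N n≥)) ⟩
    ½ ℚ.* ε ℚ.+ ½ ℚ.* ε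
      ≡⟨ halves ε ⟩
    ε ∎

-- Multiplication by a rational, the only products that are needed.
_·_ : ℚ → ℝ → ℝ
q · x = mkℝ (λ n → q ℚ.* approx x n) c
  where
  open ℚ.≤-Reasoning
  factor : ∀ a b c → a ℚ.* b ℚ.- a ℚ.* c ≡ a ℚ.* (b ℚ.- c)
  factor = solve 3 (λ a b c → a :* b :- a :* c := a :* (b :- c)) refl
    where open +-*-Solver
  c : Cauchy (λ n → q ℚ.* approx x n)
  c ε 0<ε with shrink q ε 0<ε
  ... | δ , 0<δ , qδ≤ε with cauchy x δ 0<δ
  ... | N , p = N , λ m n m≥ n≥ → begin
    ℚ.∣ q ℚ.* approx x m ℚ.- q ℚ.* approx x n ∣
      ≡⟨ cong ℚ.∣_∣ (factor q (approx x m) (approx x n)) ⟩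
    ℚ.∣ q ℚ.* (approx x m ℚ.- approx x n) ∣
      ≡⟨ ℚ.∣p*q∣≡∣p∣*∣q∣ q (approx x m ℚ.- approx x n) ⟩
    ℚ.∣ q ∣ ℚ.* ℚ.∣ approx x m ℚ.- approx x n ∣
      ≤⟨ ℚ.*-monoˡ-≤-nonNeg ℚ.∣ q ∣ {{ℚ.nonNegative (ℚ.0≤∣p∣ q)}} (p m n m≥ n≥) ⟩
    ℚ.∣ q ∣ ℚ.* δ
      ≤⟨ qδ≤ε ⟩
    ε ∎

_-ℝ_ : ℝ → ℝ → ℝ
x -ℝ y = x +ℝ (ℚ.- 1ℚ) · y

∣_∣ℝ : ℝ → ℝ
∣ x ∣ℝ = mkℝ (λ n → ℚ.∣ approx x n ∣) λ ε 0<ε →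
  let N , p = cauchy x ε 0<ε in
  N , λ m n m≥ n≥ → ℚ.≤-trans (∣∣p∣-∣q∣∣≤∣p-q∣ (approx x m) (approx x n)) (p m n m≥ n≥)

‖_‖₁ : ∀ {k} → Vector ℝ k → ℝ
‖ v ‖₁ = Vector.foldr (λ a s → ∣ a ∣ℝ +ℝ s) 0ℝ v

record Graph (V : Set) : Set where
  field
    adj        : V → V → Bool
    symmetric  : ∀ u v → adj u v ≡ adj v u
    loopless   : ∀ v → adj v v ≡ false

open Graph public

record _≅_ {V W : Set} (G : Graph V) (H : Graph W) : Set where
  field
    bijection : V ↔ W
    preserves : ∀ u v →
      adj G u v ≡ adj H (Inverse.to bijection u) (Inverse.to bijection v)

_⊆_ : ∀ {V} → Graph V → Graph V → Set
G′ ⊆ G = ∀ u v → T (adj G′ u v) → T (adj G u v)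

private
  ⌊≟⌋-comm : ∀ {n} (u v : Fin n) → ⌊ u ≟ v ⌋ ≡ ⌊ v ≟ u ⌋
  ⌊≟⌋-comm u v with u ≟ v | v ≟ u
  ... | yes _   | yes _   = refl
  ... | no  _   | no  _   = refl
  ... | yes u≡v | no  v≢u = contradiction (sym u≡v) v≢u
  ... | no  u≢v | yes v≡u = contradiction (sym v≡u) u≢v

K : ∀ n → Graph (Fin n)
K n = record
  { adj       = λ u v → not ⌊ u ≟ v ⌋
  ; symmetric = λ u v → cong not (⌊≟⌋-comm u v)
  ; loopless  = irr
  }
  where
  irr : ∀ v → not ⌊ v ≟ v ⌋ ≡ false
  irr v with v ≟ v
  ... | yes _   = refl
  ... | no  v≢v = contradiction refl v≢v

copies : ∀ {V} m → Graph V → Graph (Fin m × V)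
copies m F = record
  { adj       = λ { (i , x) (j , y) → ⌊ i ≟ j ⌋ ∧ adj F x y }
  ; symmetric = λ { (i , x) (j , y) → cong₂ _∧_ (⌊≟⌋-comm i j) (symmetric F x y) }
  ; loopless  = λ { (i , x) → irr i x }
  }
  where
  irr : ∀ i x → ⌊ i ≟ i ⌋ ∧ adj F x x ≡ false
  irr i x with i ≟ i
  ... | yes _ = loopless F x
  ... | no  _ = refl

IsFactor : ∀ {r n} .{{_ : ℕ.NonZero r}} → Graph (Fin r) → Graph (Fin n) → Set
IsFactor {r} {n} F H = H ≅ copies (n ℕ./ r) F

degree : ∀ {n} → Graph (Fin n) → Fin n → ℕ
degree {n} G v = length (filterᵇ (adj G v) (allFin n))

maxDegree : ∀ {n} → Graph (Fin n) → ℕ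
maxDegree {n} G = max 0 (map (degree G) (allFin n))

-- An undirected edge is listed once, by its endpoints in increasing order.
-- The proofs are irrelevant, so a function on edges sees only the endpoints.
record Edge {n} (G : Graph (Fin n)) : Set where
  constructor edge
  field
    source target : Fin n
    .ordered      : source < target
    .adjacent     : T (adj G source target)

edge? : ∀ {n} (G : Graph (Fin n)) → Fin n × Fin n → Maybe (Edge G)
edge? G (u , v) with u <? v | T? (adj G u v)
... | yes u<v | yes uv = just (edge u v u<v uv)
... | _       | _      = nothing

edges : ∀ {n} (G : Graph (Fin n)) → List (Edge G)
edges {n} G = mapMaybe (edge? G) (cartesianProduct (allFin n) (allFin n))

e : ∀ {n} → Graph (Fin n) → ℕ
e G = length (edges G)

include : ∀ {n} (G′ G : Graph (Fin n)) → G′ ⊆ G → Edge G′ → Edge G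
include _ _ G′⊆G (edge u v u<v uv) = edge u v u<v (G′⊆G u v uv)

-- h(G′)
total : ∀ {n k} (G G′ : Graph (Fin n)) →
        (Edge G → Vector ℝ k) → G′ ⊆ G → Vector ℝ k
total G G′ h G′⊆G i =
  foldr _+ℝ_ 0ℝ (map (λ a → h (include G′ G G′⊆G a) i) (edges G′))

-- a ÷ 0 is set to 0.  This only matters for the discrepancy in a graph G with
-- no edges, in particular in K 1, where all terms then vanish.
_÷_ : ℕ → ℕ → ℚ
a ÷ zero  = 0ℚ
a ÷ suc b = + a ℚ./ suc b

-- f_h(G′) = ‖ h(G′) - (e(G′)/e(G)) h(G) ‖₁
discrepancy : ∀ {n k} (G G′ : Graph (Fin n)) →
              (Edge G → Vector ℝ k) → G′ ⊆ G → ℝ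
discrepancy G G′ h G′⊆G =
  ‖ (λ i → total G G′ h G′⊆G i -ℝ (e G′ ÷ e G) · total G G h (λ _ _ uv → uv) i) ‖₁

{-# OPTIONS --safe #-}

-- A random placement has mean discrepancy zero; the point is to derandomise it with
-- an error that does not depend on n.  The tool is a form of the Shapley–Folkman
-- theorem: independent choices can be made so that the chosen vectors sum up to
-- their mean, up to k times the diameter of a single choice.
--
-- Subtract from h its mean.  First the vertices are partitioned into blobs of size r
-- such that the total weight W of the pairs inside the blobs is O(k² r²).  When two
-- blobs exchange a random pair of points, the mean change of W is a negative multiple
-- of their weight plus a multiple of the weight across.  Let the blobs form two sides
-- such that the weight between the sides is nearly zero; the second moment of a
-- random choice of sides shows that this is possible.  By Carathéodory's theorem,
-- k + 1 weighted perfect matchings between the sides replace the average over all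
-- pairs.  Each blob on one side chooses one of these matchings according to the
-- weights, each blob on the other side chooses one uniformly, and the pairs whose
-- choices agree exchange points.  As these pairs are disjoint, the choices are
-- independent; derandomised, they multiply W by at most 1 - 2/((k + 1) r) up to an
-- error of O(k r), and so W is O(k² r²) after sufficiently many rounds.
--
-- Then F is placed into each blob by one of the r! bijections.  The mean over the
-- bijections depends only on W, and derandomising costs O(k e(F)).  Real values are
-- replaced by rational approximations taken at a single index of the Cauchy sequences.

module Submission where

open import Defs
open import Algebra.Bundles using (CommutativeRing)
open import Data.Bool.Base using (Bool; T; _∧_; false; if_then_else_; not; true)
open import Data.Fin.Base using (Fin; _↑ʳ_; _↑ˡ_; combine; punchIn; splitAt; suc; zero)
import Data.Fin.Properties as Fin
open import Data.Nat.Base as ℕ using (suc; zero; ℕ)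
open import Data.Product.Base using (_,_; _×_; proj₁; proj₂; uncurry; Σ-syntax; ∃-syntax)
open import Data.Product.Function.NonDependent.Propositional using (_×-↔_)
open import Data.Rational.Base hiding (_÷_)
open import Data.Rational.Properties
open import Data.Sum.Base using ([_,_]′; _⊎_; inj₁; inj₂)
open import Data.Sum.Function.Propositional using (_⊎-↔_)
open import Function.Base using (_∘_; id)
open import Function.Bundles using (Inverse; _↔_; mk↔ₛ′)
open import Function.Construct.Composition using (_↔-∘_)
open import Function.Construct.Identity using (↔-id)
open import Function.Construct.Symmetry using (↔-sym)
open import Relation.Binary.PropositionalEquality
open import Relation.Nullary.Decidable using (Dec; T?; _×-dec_; decidable-stable; dec⇒maybe; does; no; yes; ¬?)
open import Relation.Nullary.Negation using (contradiction; ¬_)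
open import Tactic.RingSolver using (solve-∀)
import Tactic.RingSolver.Core.AlmostCommutativeRing as ACR
import Data.Nat.Properties as ℕ
open import Data.Vec.Functional using (insertAt) renaming (_∷_ to _∷ᵛ_)
open import Data.Vec.Functional.Properties using (insertAt-lookup; insertAt-punchIn)
open import Relation.Binary.Definitions using (tri<; tri>; tri≈)
open import Data.Fin.Permutation as Permutation using (Permutation′; _⟨$⟩ʳ_; _⟨$⟩ˡ_; cast-id; insert; insert-punchIn)
open import Data.Bool.Properties using (not-involutive)
open import Data.Nat.DivMod using (m%n<n; m/n*n≡m; m≡m%n+[m/n]*n)
open import Data.Product.Algebra using (×-comm)
open import Data.Sum.Algebra using (⊎-comm)
open import Data.Empty using (⊥-elim-irr)
import Data.Fin.Base as Fin using (_<_)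
import Data.Integer.Base as ℤ
import Data.Integer.Properties as ℤ
open import Data.Integer.Tactic.RingSolver using () renaming (solve-∀ to ℤ-solve-∀)
open import Data.List.Base using (List; []; _++_; _∷_; allFin; cartesianProduct; filterᵇ; foldr; length; map; mapMaybe; tabulate)
open import Data.List.Extrema.Nat using (xs≤max)
open import Data.List.Membership.Propositional.Properties using (∈-allFin; ∈-map⁺)
import Data.List.Relation.Unary.All as All
open import Data.Maybe.Base using (Maybe; just; maybe′; nothing)
open import Data.Rational.Unnormalised.Base as ℚᵘ using (*≡*; mkℚᵘ)
import Data.Rational.Unnormalised.Properties as ℚᵘ
open import Data.Vec.Functional as Vector using (Vector)
open import Data.Nat.Divisibility using (_∣_; ∣⇒≤)
open import Algebra.Properties.Semiring.Sum (CommutativeRing.semiring +-*-commutativeRing)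
  using (*-distribˡ-sum; sum; sum-cong-≗; sum-permute; sum-remove; sum-replicate-zero; ∑-distrib-+)
  renaming (∑-comm to sum-comm)
open ≤-Reasoning

-- Derandomising has a fixed price, about `k` times the diameter of a single choice, however many
-- choices are made. Exchanges are therefore made in rounds that involve all blobs at once, so that
-- the price is paid once per round. Their effects on `W` add up only if no blob takes part in two
-- exchanges, as the effect of an exchange depends on the other points of the blob.
--
-- An exchange depends on the choices of two blobs, whereas the selection theorem handles sums of
-- terms that depend on one choice each. Hence a round has two stages: the choices of one side are
-- fixed, and then every remaining term depends on one blob of the other side only.
--
-- The orders of magnitude follow. A round costs `O(k r)`; the weight between the sides adds no
-- more, because an imbalance of `O(k p r²)` is divided by the `p` partners and by about `r` from
-- the choice of points. Against the contraction rate of order `1 / (k r)`, this stops the descent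
-- at `W = O(k² r²)`. The mean over the placements of `F` multiplies `W` by `2 e(F) / (r (r - 1))`,
-- which leaves `O(k² e(F))`, and `2 e(F)` is at most `r` times the maximum degree.

-- Rational arithmetic and natural numbers as rationals

ℚ-ring : ACR.AlmostCommutativeRing _ _
ℚ-ring = ACR.fromCommutativeRing +-*-commutativeRing (λ p → dec⇒maybe (0ℚ ≟ p))

-- By recursion instead of `+ n / 1`, so that `ι (suc n)` unfolds to `1ℚ + ι n` and the ring solver
-- can treat numerals as polynomials in `ι n`. The two forms are identified in `ι≡/1`.
ι : ℕ → ℚ
ι zero    = 0ℚ
ι (suc n) = 1ℚ + ι n

≤-by : ∀ {p q} d → 0ℚ ≤ d → q ≡ p + d → p ≤ q
≤-by {p} d 0≤d refl = subst (_≤ p + d) (+-identityʳ p) (+-monoʳ-≤ p 0≤d)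

0≤p+q : ∀ {p q} → 0ℚ ≤ p → 0ℚ ≤ q → 0ℚ ≤ p + q
0≤p+q = +-mono-≤

*-monoˡ : ∀ {p q} r → 0ℚ ≤ r → p ≤ q → r * p ≤ r * q
*-monoˡ r 0≤r = *-monoˡ-≤-nonNeg r {{nonNegative 0≤r}}

*-monoʳ : ∀ {p q} r → 0ℚ ≤ r → p ≤ q → p * r ≤ q * r
*-monoʳ r 0≤r = *-monoʳ-≤-nonNeg r {{nonNegative 0≤r}}

0≤p*q : ∀ {p q} → 0ℚ ≤ p → 0ℚ ≤ q → 0ℚ ≤ p * q
0≤p*q {p} {q} 0≤p 0≤q = subst (_≤ p * q) (*-zeroʳ p) (*-monoˡ p 0≤p 0≤q)

*-mono : ∀ {p q r s} → 0ℚ ≤ q → 0ℚ ≤ r → p ≤ q → r ≤ s → p * r ≤ q * s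
*-mono {p} {q} {r} {s} 0≤q 0≤r p≤q r≤s = ≤-trans (*-monoʳ r 0≤r p≤q) (*-monoˡ q 0≤q r≤s)

0≤q-p : ∀ {p q} → p ≤ q → 0ℚ ≤ q - p
0≤q-p {p} {q} p≤q = subst (_≤ q - p) (+-inverseʳ p) (+-monoˡ-≤ (- p) p≤q)

0≤1 : 0ℚ ≤ 1ℚ
0≤1 = nonNegative⁻¹ 1ℚ

0≤ι : ∀ n → 0ℚ ≤ ι n
0≤ι zero    = ≤-refl
0≤ι (suc n) = 0≤p+q 0≤1 (0≤ι n)

ι-+ : ∀ m n → ι (m ℕ.+ n) ≡ ι m + ι n
ι-+ zero    n = sym (+-identityˡ (ι n))
ι-+ (suc m) n = trans (cong (1ℚ +_) (ι-+ m n)) (sym (+-assoc 1ℚ (ι m) (ι n)))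

ι-* : ∀ m n → ι (m ℕ.* n) ≡ ι m * ι n
ι-* zero    n = sym (*-zeroˡ (ι n))
ι-* (suc m) n = trans (ι-+ n (m ℕ.* n)) (trans (cong (ι n +_) (ι-* m n)) (lemma (ι m) (ι n)))
  where
  lemma : ∀ p q → q + p * q ≡ (1ℚ + p) * q
  lemma = solve-∀ ℚ-ring

ι-mono : ∀ {m n} → m ℕ.≤ n → ι m ≤ ι n
ι-mono {n = n} ℕ.z≤n = 0≤ι n
ι-mono (ℕ.s≤s m≤n)   = +-monoʳ-≤ 1ℚ (ι-mono m≤n)

1≤ι : ∀ n → 1ℚ ≤ ι (suc n)
1≤ι n = ≤-by (ι n) (0≤ι n) refl

ι-positive : ∀ n → Positive (ι (suc n))
ι-positive n = positive (<-≤-trans (positive⁻¹ 1ℚ) (1≤ι n))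

opaque
  -- The index is shifted by one, so that no hypothesis of being nonzero has to be carried along:
  -- for a size `suc n`, the reciprocal is `ρ n`.
  ρ : ℕ → ℚ
  ρ n = (1/ ι (suc n)) {{pos⇒nonZero (ι (suc n)) {{ι-positive n}}}}

  ι*ρ : ∀ n → ι (suc n) * ρ n ≡ 1ℚ
  ι*ρ n = *-inverseʳ (ι (suc n)) {{pos⇒nonZero (ι (suc n)) {{ι-positive n}}}}

  ρ*ι : ∀ n → ρ n * ι (suc n) ≡ 1ℚ
  ρ*ι n = *-inverseˡ (ι (suc n)) {{pos⇒nonZero (ι (suc n)) {{ι-positive n}}}}

  0≤ρ : ∀ n → 0ℚ ≤ ρ n
  0≤ρ n = nonNegative⁻¹ (ρ n) {{pos⇒nonNeg (ρ n) {{1/pos⇒pos (ι (suc n)) {{ι-positive n}}}}}}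

  ρ-positive : ∀ n → Positive (ρ n)
  ρ-positive n = 1/pos⇒pos (ι (suc n)) {{ι-positive n}}

-- Finite types

record Finite (A : Set) : Set where
  no-eta-equality
  field
    size  : ℕ
    index : A ↔ Fin size

open Finite {{...}} public

enum : ∀ {A} {{_ : Finite A}} → Fin (size {A}) → A
enum = Inverse.from index

opaque
  instance
    finite-Fin : ∀ {n} → Finite (Fin n)
    finite-Fin {n} = record { size = n ; index = ↔-id (Fin n) }

    finite-Bool : Finite Bool
    finite-Bool = record { size = 2 ; index = ↔-sym Fin.2↔Bool }

    finite-× : ∀ {A B} {{_ : Finite A}} {{_ : Finite B}} → Finite (A × B)
    finite-× {A} {B} = record
      { size = size {A} ℕ.* size {B} ; index = ↔-sym Fin.*↔× ↔-∘ (index ×-↔ index) }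

    finite-⊎ : ∀ {A B} {{_ : Finite A}} {{_ : Finite B}} → Finite (A ⊎ B)
    finite-⊎ {A} {B} = record
      { size = size {A} ℕ.+ size {B} ; index = ↔-sym Fin.+↔⊎ ↔-∘ (index ⊎-↔ index) }

opaque
  ∑ : ∀ {A} {{_ : Finite A}} → (A → ℚ) → ℚ
  ∑ f = sum (f ∘ enum)

infixl 10 ∑-syntax
∑-syntax : ∀ A {{_ : Finite A}} → (A → ℚ) → ℚ
∑-syntax _ = ∑
syntax ∑-syntax A (λ x → t) = ∑[ x ∈ A ] t

sum-mono : ∀ {n} {f g : Fin n → ℚ} → (∀ i → f i ≤ g i) → sum f ≤ sum g
sum-mono {zero}  f≤g = ≤-refl
sum-mono {suc n} f≤g = +-mono-≤ (f≤g zero) (sum-mono (f≤g ∘ suc))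

sum-↑ : ∀ m {n} (f : Fin (m ℕ.+ n) → ℚ) → sum f ≡ sum (λ i → f (i ↑ˡ n)) + sum (λ j → f (m ↑ʳ j))
sum-↑ zero    f = sym (+-identityˡ (sum f))
sum-↑ (suc m) f = trans (cong (f zero +_) (sum-↑ m (f ∘ suc))) (sym (+-assoc (f zero) _ _))

sum-combine : ∀ m {n} (f : Fin (m ℕ.* n) → ℚ) → sum f ≡ sum (λ i → sum (λ j → f (combine {m} i j)))
sum-combine zero    f = refl
sum-combine (suc m) {n} f =
  trans (sum-↑ n f) (cong (sum (λ j → f (j ↑ˡ (m ℕ.* n))) +_) (sum-combine m (λ i → f (n ↑ʳ i))))

sum-zero : ∀ {n} {f : Fin n → ℚ} → (∀ i → f i ≡ 0ℚ) → sum f ≡ 0ℚ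
sum-zero {n} f≡0 = trans (sum-cong-≗ f≡0) (sum-replicate-zero n)

sum-single : ∀ {n} (i : Fin n) {f : Fin n → ℚ} → (∀ j → j ≢ i → f j ≡ 0ℚ) → sum f ≡ f i
sum-single {suc n} i {f} f≡0 = trans (sum-remove {i = i} f)
  (trans (cong (f i +_) (sum-zero (λ j → f≡0 (punchIn i j) (Fin.punchInᵢ≢i i j)))) (+-identityʳ (f i)))

module _ {A : Set} {{_ : Finite A}} where

  opaque
    unfolding ∑ finite-Fin finite-Bool finite-× finite-⊎

    ∑-cong : {f g : A → ℚ} → (∀ x → f x ≡ g x) → ∑ f ≡ ∑ g
    ∑-cong f≡g = sum-cong-≗ (f≡g ∘ enum)

    ∑-+ : (f g : A → ℚ) → ∑[ x ∈ A ] (f x + g x) ≡ ∑ f + ∑ g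
    ∑-+ f g = ∑-distrib-+ (f ∘ enum) (g ∘ enum)

    ∑-* : ∀ q (f : A → ℚ) → ∑[ x ∈ A ] (q * f x) ≡ q * ∑ f
    ∑-* q f = sym (*-distribˡ-sum q (f ∘ enum))

    ∑-*ʳ : ∀ q (f : A → ℚ) → ∑[ x ∈ A ] (f x * q) ≡ ∑ f * q
    ∑-*ʳ q f = trans (∑-cong (λ x → *-comm (f x) q)) (trans (∑-* q f) (*-comm q (∑ f)))

    ∑-zero : {f : A → ℚ} → (∀ x → f x ≡ 0ℚ) → ∑ f ≡ 0ℚ
    ∑-zero f≡0 = sum-zero (f≡0 ∘ enum)

    ∑-neg : (f : A → ℚ) → ∑[ x ∈ A ] (- f x) ≡ - ∑ f
    ∑-neg f = trans (∑-cong (λ x → flip (f x))) (trans (∑-* (- 1ℚ) f) (sym (flip (∑ f))))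
      where
      flip : ∀ p → - p ≡ (- 1ℚ) * p
      flip = solve-∀ ℚ-ring

    ∑-- : (f g : A → ℚ) → ∑[ x ∈ A ] (f x - g x) ≡ ∑ f - ∑ g
    ∑-- f g = trans (∑-+ f (λ x → - g x)) (cong (∑ f +_) (∑-neg g))

    ∑-mono : {f g : A → ℚ} → (∀ x → f x ≤ g x) → ∑ f ≤ ∑ g
    ∑-mono f≤g = sum-mono (f≤g ∘ enum)

    ∑-nonneg : {f : A → ℚ} → (∀ x → 0ℚ ≤ f x) → 0ℚ ≤ ∑ f
    ∑-nonneg {f} 0≤f = subst (_≤ ∑ f) (∑-zero {λ _ → 0ℚ} (λ _ → refl)) (∑-mono 0≤f)

    ∑-const : ∀ q → ∑[ x ∈ A ] q ≡ ι (size {A}) * q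
    ∑-const q = go (size {A})
      where
      lemma : ∀ p q → q + p * q ≡ (1ℚ + p) * q
      lemma = solve-∀ ℚ-ring
      go : ∀ n → sum {n} (λ _ → q) ≡ ι n * q
      go zero    = sym (*-zeroˡ q)
      go (suc n) = trans (cong (q +_) (go n)) (lemma (ι n) q)

    ∑-single : ∀ x {f : A → ℚ} → (∀ y → y ≢ x → f y ≡ 0ℚ) → ∑ f ≡ f x
    ∑-single x {f} f≡0 = trans (sum-single (Inverse.to index x) λ j j≢ → f≡0 (enum j) λ eq →
        j≢ (trans (sym (Inverse.strictlyInverseˡ (index {A}) j)) (cong (Inverse.to (index {A})) eq)))
      (cong f (Inverse.strictlyInverseʳ index x))

    term≤∑ : {f : A → ℚ} → (∀ x → 0ℚ ≤ f x) → ∀ x → f x ≤ ∑ f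
    term≤∑ {f} 0≤f x = subst (λ y → f y ≤ ∑ f) (Inverse.strictlyInverseʳ index x)
      (go (f ∘ enum) (0≤f ∘ enum) (Inverse.to index x))
      where
      go : ∀ {n} (g : Fin n → ℚ) → (∀ i → 0ℚ ≤ g i) → ∀ i → g i ≤ sum g
      go {suc n} g 0≤g i = subst (g i ≤_) (sym (sum-remove {i = i} g))
        (≤-by _ (∑-nonneg′ (λ j → 0≤g (punchIn i j))) refl)
        where
        ∑-nonneg′ : ∀ {m} {h : Fin m → ℚ} → (∀ j → 0ℚ ≤ h j) → 0ℚ ≤ sum h
        ∑-nonneg′ {zero}  0≤h = ≤-refl
        ∑-nonneg′ {suc m} 0≤h = 0≤p+q (0≤h zero) (∑-nonneg′ (0≤h ∘ suc))

module _ {A B : Set} {{_ : Finite A}} {{_ : Finite B}} where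

  opaque
    unfolding ∑ finite-Fin finite-Bool finite-× finite-⊎

    ∑-comm : (f : A → B → ℚ) → ∑[ x ∈ A ] ∑[ y ∈ B ] f x y ≡ ∑[ y ∈ B ] ∑[ x ∈ A ] f x y
    ∑-comm f = sum-comm (λ i j → f (enum i) (enum j))

    ∑-↔ : (π : A ↔ B) (f : B → ℚ) → ∑ f ≡ ∑[ x ∈ A ] f (Inverse.to π x)
    ∑-↔ π f = trans (sum-permute (f ∘ enum) (index ↔-∘ (π ↔-∘ ↔-sym index)))
      (sum-cong-≗ λ i → cong f (Inverse.strictlyInverseʳ (index {B}) (Inverse.to π (enum i))))

    ∑-× : (f : A × B → ℚ) → ∑ f ≡ ∑[ x ∈ A ] ∑[ y ∈ B ] f (x , y)
    ∑-× f = trans (sum-combine (size {A}) (f ∘ enum))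
      (sum-cong-≗ λ i → sum-cong-≗ λ j → cong (λ p → f (enum (proj₁ p) , enum (proj₂ p))) (Fin.remQuot-combine i j))

    ∑-⊎ : (f : A ⊎ B → ℚ) → ∑ f ≡ ∑[ x ∈ A ] f (inj₁ x) + ∑[ y ∈ B ] f (inj₂ y)
    ∑-⊎ f = trans (sum-↑ (size {A}) (f ∘ enum)) (cong₂ _+_
      (sum-cong-≗ λ i → cong (f ∘ Inverse.from (index ⊎-↔ index)) (Fin.splitAt-↑ˡ _ i _))
      (sum-cong-≗ λ j → cong (f ∘ Inverse.from (index ⊎-↔ index)) (Fin.splitAt-↑ʳ (size {A}) _ j)))

opaque
  unfolding ∑ finite-Fin finite-Bool finite-× finite-⊎

  ∑-Bool : (f : Bool → ℚ) → ∑ f ≡ f false + f true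
  ∑-Bool f = cong (f false +_) (+-identityʳ (f true))

-- Vectors and the ℓ₁ norm

opaque
  ‖_‖ : ∀ {k} → (Fin k → ℚ) → ℚ
  ‖ v ‖ = ∑[ c ∈ _ ] ∣ v c ∣

module _ {k : ℕ} where

  opaque
    unfolding ∑ ‖_‖

    ‖‖-cong : {v w : Fin k → ℚ} → (∀ c → v c ≡ w c) → ‖ v ‖ ≡ ‖ w ‖
    ‖‖-cong v≡w = ∑-cong λ c → cong ∣_∣ (v≡w c)

    0≤‖‖ : (v : Fin k → ℚ) → 0ℚ ≤ ‖ v ‖
    0≤‖‖ v = ∑-nonneg λ c → 0≤∣p∣ (v c)

    ‖‖-+ : (v w : Fin k → ℚ) → ‖ (λ c → v c + w c) ‖ ≤ ‖ v ‖ + ‖ w ‖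
    ‖‖-+ v w = ≤-trans (∑-mono λ c → ∣p+q∣≤∣p∣+∣q∣ (v c) (w c)) (≤-reflexive (∑-+ (∣_∣ ∘ v) (∣_∣ ∘ w)))

    ‖‖-neg : (v : Fin k → ℚ) → ‖ (λ c → - v c) ‖ ≡ ‖ v ‖
    ‖‖-neg v = ∑-cong λ c → ∣-p∣≡∣p∣ (v c)

    ‖‖-- : (v w : Fin k → ℚ) → ‖ (λ c → v c - w c) ‖ ≤ ‖ v ‖ + ‖ w ‖
    ‖‖-- v w = ≤-trans (‖‖-+ v (λ c → - w c)) (≤-reflexive (cong (‖ v ‖ +_) (‖‖-neg w)))

    ‖‖-* : ∀ {q} → 0ℚ ≤ q → (v : Fin k → ℚ) → ‖ (λ c → q * v c) ‖ ≡ q * ‖ v ‖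
    ‖‖-* {q} 0≤q v = trans (∑-cong λ c → trans (∣p*q∣≡∣p∣*∣q∣ q (v c)) (cong (_* ∣ v c ∣) (0≤p⇒∣p∣≡p 0≤q)))
      (∑-* q (∣_∣ ∘ v))

    ‖‖-zero : {v : Fin k → ℚ} → (∀ c → v c ≡ 0ℚ) → ‖ v ‖ ≡ 0ℚ
    ‖‖-zero v≡0 = ∑-zero λ c → cong ∣_∣ (v≡0 c)

    ‖‖-∑ : ∀ {A} {{_ : Finite A}} (v : A → Fin k → ℚ) → ‖ (λ c → ∑[ x ∈ A ] v x c) ‖ ≤ ∑[ x ∈ A ] ‖ v x ‖
    ‖‖-∑ {A} v = go (v ∘ enum)
      where
      go : ∀ {n} (w : Fin n → Fin k → ℚ) → ‖ (λ c → sum (λ i → w i c)) ‖ ≤ sum (λ i → ‖ w i ‖)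
      go {zero}  w = ≤-reflexive (‖‖-zero {λ _ → 0ℚ} λ _ → refl)
      go {suc n} w = ≤-trans (‖‖-+ (w zero) (λ c → sum (λ i → w (suc i) c))) (+-monoʳ-≤ ‖ w zero ‖ (go (w ∘ suc)))

-- Linear dependence and Carathéodory's theorem

opaque
  unfolding ∑ finite-Fin

  ∑-Fin-zero : (f : Fin 0 → ℚ) → ∑ f ≡ 0ℚ
  ∑-Fin-zero f = refl

  ∑-punchIn : ∀ {n} (i : Fin (suc n)) (f : Fin (suc n) → ℚ) → ∑ f ≡ f i + ∑[ j ∈ Fin n ] f (punchIn i j)
  ∑-punchIn i f = sum-remove {i = i} f

  ∑-enum : ∀ {A} {{_ : Finite A}} (f : A → ℚ) → ∑ f ≡ ∑[ i ∈ Fin (size {A}) ] f (enum i)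
  ∑-enum f = refl

δ : ∀ {n} → Fin n → Fin n → ℚ
δ i j = if does (i Fin.≟ j) then 1ℚ else 0ℚ

δ-refl : ∀ {n} (i : Fin n) → δ i i ≡ 1ℚ
δ-refl i with i Fin.≟ i
... | yes _   = refl
... | no  i≢i = contradiction refl i≢i

δ-≢ : ∀ {n} {i j : Fin n} → i ≢ j → δ i j ≡ 0ℚ
δ-≢ {i = i} {j} i≢j with i Fin.≟ j
... | yes i≡j = contradiction i≡j i≢j
... | no  _   = refl

-- Gaussian elimination on the first coordinate. If it vanishes everywhere, it is dropped. Otherwise
-- a pivot `p` clears it from the other vectors, and a dependence of the cleared vectors lifts to
-- the original ones by giving `p` the coefficient `- s`, which collects the subtracted multiples.
dependence : ∀ d {n} → d ℕ.< n → (a : Fin n → Fin d → ℚ) →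
  Σ[ c ∈ (Fin n → ℚ) ] (∃[ i ] c i ≢ 0ℚ) × (∀ x → ∑[ i ∈ Fin n ] (c i * a i x) ≡ 0ℚ)
dependence zero {suc n} _ a = (λ _ → 1ℚ) , (zero , 1≢0) , λ ()
dependence (suc d) {suc n} (ℕ.s≤s d<n) a with Fin.any? (λ i → ¬? (a i zero ≟ 0ℚ))
... | no none =
  let c , c≢0 , eq = dependence d (ℕ.m≤n⇒m≤1+n d<n) (λ i x → a i (suc x))
      a≡0 : ∀ i → a i zero ≡ 0ℚ
      a≡0 i = decidable-stable (a i zero ≟ 0ℚ) (λ a≢0 → none (i , a≢0))
  in c , c≢0 , λ
    { zero    → ∑-zero λ i → trans (cong (c i *_) (a≡0 i)) (*-zeroʳ (c i))
    ; (suc x) → eq x }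
... | yes (p , ap≢0) = c , (punchIn p i₀ , c≢0) , λ { zero → eq₀ ; (suc x) → eq x }
  where
  instance
    _ : NonZero (a p zero)
    _ = ≢-nonZero ap≢0
  q : Fin n → ℚ
  q j = a (punchIn p j) zero * 1/ a p zero
  ih = dependence d d<n (λ j x → a (punchIn p j) (suc x) - q j * a p (suc x))
  c′ = proj₁ ih
  i₀ = proj₁ (proj₁ (proj₂ ih))
  s = ∑[ j ∈ Fin n ] (c′ j * q j)
  c : Fin (suc n) → ℚ
  c = insertAt c′ p (- s)
  c≢0 : c (punchIn p i₀) ≢ 0ℚ
  c≢0 = subst (_≢ 0ℚ) (sym (insertAt-punchIn c′ p (- s) i₀)) (proj₂ (proj₁ (proj₂ ih)))
  expand : ∀ x → ∑[ i ∈ Fin (suc n) ] (c i * a i x) ≡ - s * a p x + ∑[ j ∈ Fin n ] (c′ j * a (punchIn p j) x)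
  expand x = trans (∑-punchIn p (λ i → c i * a i x)) (cong₂ _+_
    (cong (_* a p x) (insertAt-lookup c′ p (- s)))
    (∑-cong λ j → cong (_* a (punchIn p j) x) (insertAt-punchIn c′ p (- s) j)))
  neg-*ˡ : ∀ x y → - x * y ≡ - (x * y)
  neg-*ˡ = solve-∀ ℚ-ring
  eq₀ : ∑[ i ∈ Fin (suc n) ] (c i * a i zero) ≡ 0ℚ
  eq₀ = begin-equality
    ∑[ i ∈ Fin (suc n) ] (c i * a i zero) ≡⟨ expand zero ⟩
    - s * a p zero + S ≡⟨ cong (_+ S) (neg-*ˡ s (a p zero)) ⟩
    - (s * a p zero) + S ≡⟨ cong (λ t → - t + S) (∑-*ʳ (a p zero) (λ j → c′ j * q j)) ⟨
    - ∑[ j ∈ Fin n ] (c′ j * q j * a p zero) + S ≡⟨ cong (λ t → - t + S) (∑-cong {f = λ j → c′ j * q j * a p zero} λ j → cancel (c′ j) (a (punchIn p j) zero)) ⟩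
    - S + S ≡⟨ +-inverseˡ S ⟩
    0ℚ ∎
    where
    S = ∑[ j ∈ Fin n ] (c′ j * a (punchIn p j) zero)
    assoc : ∀ x y z t → x * (y * z) * t ≡ x * y * (z * t)
    assoc = solve-∀ ℚ-ring
    cancel : ∀ x y → x * (y * 1/ a p zero) * a p zero ≡ x * y
    cancel x y = trans (assoc x y (1/ a p zero) (a p zero))
      (trans (cong (x * y *_) (*-inverseˡ (a p zero))) (*-identityʳ (x * y)))
  eq : ∀ x → ∑[ i ∈ Fin (suc n) ] (c i * a i (suc x)) ≡ 0ℚ
  eq x = begin-equality
    ∑[ i ∈ Fin (suc n) ] (c i * a i (suc x)) ≡⟨ expand (suc x) ⟩
    - s * a p (suc x) + S ≡⟨ cong (_+ S) (neg-*ˡ s (a p (suc x))) ⟩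
    - (s * a p (suc x)) + S ≡⟨ cong (λ t → - t + S) (∑-*ʳ (a p (suc x)) (λ j → c′ j * q j)) ⟨
    - U + S ≡⟨ +-comm (- U) S ⟩
    S - U ≡⟨ ∑-- (λ j → c′ j * a (punchIn p j) (suc x)) (λ j → c′ j * q j * a p (suc x)) ⟨
    ∑[ j ∈ Fin n ] (c′ j * a (punchIn p j) (suc x) - c′ j * q j * a p (suc x))
      ≡⟨ ∑-cong (λ j → dist (c′ j) (a (punchIn p j) (suc x)) (q j) (a p (suc x))) ⟩
    ∑[ j ∈ Fin n ] (c′ j * (a (punchIn p j) (suc x) - q j * a p (suc x))) ≡⟨ proj₂ (proj₂ ih) x ⟩
    0ℚ ∎
    where
    S = ∑[ j ∈ Fin n ] (c′ j * a (punchIn p j) (suc x))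
    U = ∑[ j ∈ Fin n ] (c′ j * q j * a p (suc x))
    dist : ∀ x y z t → x * y - x * z * t ≡ x * (y - z * t)
    dist = solve-∀ ℚ-ring

argmin : ∀ {n} {P : Fin n → Set} → (∀ i → Dec (P i)) → (f : Fin n → ℚ) → (∃[ i ] P i) →
  ∃[ i ] P i × (∀ j → P j → f i ≤ f j)
argmin {suc n} {P} P? f (i , Pi) with Fin.any? (P? ∘ suc)
... | no none = zero , P0 i Pi , λ
  { zero _ → ≤-refl ; (suc j) Pj → contradiction (j , Pj) none }
  where
  P0 : ∀ i → P i → P zero
  P0 zero    p = p
  P0 (suc i) p = contradiction (i , p) none
... | yes some with argmin (P? ∘ suc) (f ∘ suc) some | P? zero
... | i′ , Pi′ , min | no ¬P0 = suc i′ , Pi′ , λ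
  { zero P0 → contradiction P0 ¬P0 ; (suc j) Pj → min j Pj }
... | i′ , Pi′ , min | yes P0 with ≤-total (f zero) (f (suc i′))
... | inj₁ f0≤ = zero , P0 , λ { zero _ → ≤-refl ; (suc j) Pj → ≤-trans f0≤ (min j Pj) }
... | inj₂ ≤f0 = suc i′ , Pi′ , λ { zero _ → ≤f0 ; (suc j) Pj → min j Pj }

-- One step of Carathéodory's theorem: walk along a linear dependence until the
-- first weight vanishes.
dropOne : ∀ {n d} → d ℕ.< suc n → (w : Fin (suc n) → ℚ) → (∀ i → 0ℚ ≤ w i) → (a : Fin (suc n) → Fin d → ℚ) →
  ∃[ p ] Σ[ w′ ∈ (Fin n → ℚ) ] (∀ j → 0ℚ ≤ w′ j) ×
    (∀ x → ∑[ j ∈ Fin n ] (w′ j * a (punchIn p j) x) ≡ ∑[ i ∈ Fin (suc n) ] (w i * a i x))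
dropOne {n} {d} d<n w 0≤w a = main
  where
  -- Only positive coefficients limit the walk, so the dependence is negated if necessary to have
  -- one.
  oriented : Σ[ c ∈ (Fin (suc n) → ℚ) ] (∃[ i ] 0ℚ < c i) × (∀ x → ∑[ i ∈ Fin (suc n) ] (c i * a i x) ≡ 0ℚ)
  oriented with dependence d d<n a
  ... | c , (i , ci≢0) , eq with <-cmp 0ℚ (c i)
  ... | tri< 0<ci _ _ = c , (i , 0<ci) , eq
  ... | tri≈ _ 0≡ci _ = contradiction (sym 0≡ci) ci≢0
  ... | tri> _ _ ci<0 = (λ j → - c j) , (i , neg-antimono-< ci<0) , λ x →
    trans (∑-cong λ j → sym (neg-distribˡ-* (c j) (a j x)))
      (trans (∑-neg (λ j → c j * a j x)) (cong (-_) (eq x)))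
  c = proj₁ oriented
  -- `key` must make sense at every index, also where `c` vanishes; the default value is harmless,
  -- as `argmin` compares only the indices with positive `c`.
  inv : ℚ → ℚ
  inv q with q ≟ 0ℚ
  ... | yes _  = 0ℚ
  ... | no q≢0 = (1/ q) {{≢-nonZero q≢0}}
  inv-* : ∀ {q} → 0ℚ < q → inv q * q ≡ 1ℚ
  inv-* {q} 0<q with q ≟ 0ℚ
  ... | yes q≡0 = contradiction (sym q≡0) (<⇒≢ 0<q)
  ... | no q≢0  = *-inverseˡ q {{≢-nonZero q≢0}}
  0≤inv : ∀ {q} → 0ℚ < q → 0ℚ ≤ inv q
  0≤inv {q} 0<q with q ≟ 0ℚ
  ... | yes _  = ≤-refl
  ... | no q≢0 = let instance _ = positive 0<q in
    nonNegative⁻¹ _ {{pos⇒nonNeg ((1/ q) {{≢-nonZero q≢0}}) {{1/pos⇒pos q}}}}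
  key : Fin (suc n) → ℚ
  key i = w i * inv (c i)
  key-* : ∀ {i} → 0ℚ < c i → key i * c i ≡ w i
  key-* {i} 0<ci = trans (*-assoc (w i) _ _) (trans (cong (w i *_) (inv-* 0<ci)) (*-identityʳ (w i)))
  -- The smallest ratio `w i / c i` is the longest step that keeps all weights nonnegative, and it
  -- brings the weight of the minimiser to zero.
  min = argmin (λ i → 0ℚ <? c i) key (proj₁ (proj₂ oriented))
  p = proj₁ min
  t = key p
  w″ : Fin (suc n) → ℚ
  w″ i = w i - t * c i
  0≤t : 0ℚ ≤ t
  0≤t = 0≤p*q (0≤w p) (0≤inv (proj₁ (proj₂ min)))
  0≤w″ : ∀ i → 0ℚ ≤ w″ i
  0≤w″ i with 0ℚ <? c i
  ... | yes 0<ci = 0≤q-p (subst (t * c i ≤_) (key-* 0<ci) (*-monoʳ (c i) (<⇒≤ 0<ci) (proj₂ (proj₂ min) i 0<ci)))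
  ... | no  ci≤0 = subst (0ℚ ≤_) (lemma (w i) t (c i)) (0≤p+q (0≤w i) (0≤p*q 0≤t (neg-antimono-≤ (≮⇒≥ ci≤0))))
    where
    lemma : ∀ x y z → x + y * (- z) ≡ x - y * z
    lemma = solve-∀ ℚ-ring
  eq : ∀ x → ∑[ i ∈ Fin (suc n) ] (w″ i * a i x) ≡ ∑[ i ∈ Fin (suc n) ] (w i * a i x)
  eq x = begin-equality
    ∑[ i ∈ Fin (suc n) ] (w″ i * a i x) ≡⟨ ∑-cong (λ i → dist (w i) t (c i) (a i x)) ⟩
    ∑[ i ∈ Fin (suc n) ] (w i * a i x - t * (c i * a i x)) ≡⟨ ∑-- (λ i → w i * a i x) (λ i → t * (c i * a i x)) ⟩
    W - ∑[ i ∈ Fin (suc n) ] (t * (c i * a i x)) ≡⟨ cong (_-_ W) (∑-* t (λ i → c i * a i x)) ⟩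
    W - t * ∑[ i ∈ Fin (suc n) ] (c i * a i x) ≡⟨ cong (λ z → W - t * z) (proj₂ (proj₂ oriented) x) ⟩
    W - t * 0ℚ ≡⟨ minus-zero W t ⟩
    W ∎
    where
    W = ∑[ i ∈ Fin (suc n) ] (w i * a i x)
    dist : ∀ x y z u → (x - y * z) * u ≡ x * u - y * (z * u)
    dist = solve-∀ ℚ-ring
    minus-zero : ∀ x y → x - y * 0ℚ ≡ x
    minus-zero = solve-∀ ℚ-ring
  w″p : w″ p ≡ 0ℚ
  w″p = trans (cong (_-_ (w p)) (key-* (proj₁ (proj₂ min)))) (+-inverseʳ (w p))
  main : _
  main = p , w″ ∘ punchIn p , 0≤w″ ∘ punchIn p , λ x →
    let S = ∑[ j ∈ Fin n ] (w″ (punchIn p j) * a (punchIn p j) x) in begin-equality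
    S ≡⟨ +-identityˡ S ⟨
    0ℚ + S ≡⟨ cong (_+ S) (*-zeroˡ (a p x)) ⟨
    0ℚ * a p x + S ≡⟨ cong (λ z → z * a p x + S) w″p ⟨
    w″ p * a p x + S ≡⟨ ∑-punchIn p (λ i → w″ i * a i x) ⟨
    ∑[ i ∈ Fin (suc n) ] (w″ i * a i x) ≡⟨ eq x ⟩
    ∑[ i ∈ Fin (suc n) ] (w i * a i x) ∎

-- The conic form of Carathéodory's theorem, with `d` points instead of `d + 1`. The total weight is
-- preserved only if a coordinate of `a` records it: `matchings` adds a constant coordinate,
-- `select` one indicator for each group.
record Sparse {A} {{_ : Finite A}} {d} (w : A → ℚ) (a : A → Fin d → ℚ) : Set where
  field
    count    : ℕ
    count≤d  : count ℕ.≤ d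
    point    : Fin count → A
    weight   : Fin count → ℚ
    0≤weight : ∀ j → 0ℚ ≤ weight j
    mean     : ∀ c → ∑[ j ∈ Fin count ] (weight j * a (point j) c) ≡ ∑[ x ∈ A ] (w x * a x c)

caratheodory-Fin : ∀ {d} n (w : Fin n → ℚ) → (∀ i → 0ℚ ≤ w i) → (a : Fin n → Fin d → ℚ) → Sparse w a
caratheodory-Fin {d} n w 0≤w a with n ℕ.≤? d
... | yes n≤d = record
  { count = n ; count≤d = n≤d ; point = id ; weight = w ; 0≤weight = 0≤w ; mean = λ _ → refl }
caratheodory-Fin {d} zero w 0≤w a | no n≰d = contradiction ℕ.z≤n n≰d
caratheodory-Fin {d} (suc n) w 0≤w a | no n≰d =
  let p , w₁ , 0≤w₁ , eq₁ = dropOne (ℕ.≰⇒> n≰d) w 0≤w a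
      module S = Sparse (caratheodory-Fin n w₁ 0≤w₁ (a ∘ punchIn p))
  in record
    { count = S.count ; count≤d = S.count≤d ; point = punchIn p ∘ S.point ; weight = S.weight
    ; 0≤weight = S.0≤weight ; mean = λ c → trans (S.mean c) (eq₁ c) }

opaque
  caratheodory : ∀ {A} {{_ : Finite A}} {d} (w : A → ℚ) → (∀ x → 0ℚ ≤ w x) → (a : A → Fin d → ℚ) → Sparse w a
  caratheodory {A} w 0≤w a = record
    { count = S.count ; count≤d = S.count≤d ; point = enum ∘ S.point ; weight = S.weight
    ; 0≤weight = S.0≤weight ; mean = λ c → trans (S.mean c) (sym (∑-enum (λ x → w x * a x c))) }
    where
    module S = Sparse (caratheodory-Fin (size {A}) (w ∘ enum) (0≤w ∘ enum) (a ∘ enum))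

opaque
  unfolding finite-Fin

  ∑-Fin-const : ∀ n q → ∑[ i ∈ Fin n ] q ≡ ι n * q
  ∑-Fin-const n q = ∑-const {Fin n} q

∑-δˡ : ∀ {n} (i : Fin n) (f : Fin n → ℚ) → ∑[ j ∈ Fin n ] (δ i j * f j) ≡ f i
∑-δˡ i f = begin-equality
  ∑[ j ∈ _ ] (δ i j * f j) ≡⟨ ∑-single i (λ j j≢i → trans (cong (_* f j) (δ-≢ (j≢i ∘ sym))) (*-zeroˡ (f j))) ⟩
  δ i i * f i ≡⟨ cong (_* f i) (δ-refl i) ⟩
  1ℚ * f i ≡⟨ *-identityˡ (f i) ⟩
  f i ∎

0≤δ : ∀ {n} (i j : Fin n) → 0ℚ ≤ δ i j
0≤δ i j with i Fin.≟ j
... | yes _ = 0≤1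
... | no  _ = ≤-refl


-- A form of the Shapley–Folkman theorem.  The constraints "the weights in each
-- group sum to 1" and the k linear constraints leave, by Carathéodory, at most
-- M + k positive weights, so all but k of them are the only one of their group.
opaque
  select : ∀ {M k O} {{_ : Finite O}} (ω : Fin M → O → ℚ) → (∀ i o → 0ℚ ≤ ω i o) →
    (∀ i → ∑[ o ∈ O ] ω i o ≡ 1ℚ) → (v : Fin M → O → Fin k → ℚ) → ∀ {B} → 0ℚ ≤ B →
    (∀ i o o′ → ‖ (λ c → v i o c - v i o′ c) ‖ ≤ B) →
    Σ[ s ∈ (Fin M → O) ]
      ‖ (λ c → ∑[ i ∈ Fin M ] v i (s i) c - ∑[ i ∈ Fin M ] ∑[ o ∈ O ] (ω i o * v i o c)) ‖ ≤ ι k * B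
  select {M} {k} {O} ω 0≤ω ∑ω≡1 v {B} 0≤B diam = s , bound
    where
    a : Fin M × O → Fin (M ℕ.+ k) → ℚ
    a (i , o) = [ δ i , v i o ]′ ∘ splitAt M
    open Sparse (caratheodory (uncurry ω) (uncurry 0≤ω) a)
      renaming (count to m; count≤d to m≤; point to pt; weight to w; 0≤weight to 0≤w; mean to total≡)
    g : Fin m → Fin M
    g j = proj₁ (pt j)
    val : Fin m → Fin k → ℚ
    val j = v (g j) (proj₂ (pt j))
    group : ∀ i → ∑[ j ∈ Fin m ] (w j * δ (g j) i) ≡ 1ℚ
    group i = begin-equality
      ∑[ j ∈ Fin m ] (w j * δ (g j) i) ≡⟨ ∑-cong (λ j → cong (λ z → w j * [ δ (g j) , val j ]′ z) (Fin.splitAt-↑ˡ M i k)) ⟨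
      ∑[ j ∈ Fin m ] (w j * a (pt j) (i ↑ˡ k)) ≡⟨ total≡ (i ↑ˡ k) ⟩
      ∑[ x ∈ Fin M × O ] (uncurry ω x * a x (i ↑ˡ k)) ≡⟨ ∑-× (λ x → uncurry ω x * a x (i ↑ˡ k)) ⟩
      ∑[ i′ ∈ Fin M ] ∑[ o ∈ O ] (ω i′ o * a (i′ , o) (i ↑ˡ k))
        ≡⟨ ∑-cong (λ i′ → ∑-cong λ o → cong (λ z → ω i′ o * [ δ i′ , v i′ o ]′ z) (Fin.splitAt-↑ˡ M i k)) ⟩
      ∑[ i′ ∈ Fin M ] ∑[ o ∈ O ] (ω i′ o * δ i′ i)
        ≡⟨ ∑-single i (λ i′ i′≢i → ∑-zero λ o → trans (cong (ω i′ o *_) (δ-≢ i′≢i)) (*-zeroʳ (ω i′ o))) ⟩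
      ∑[ o ∈ O ] (ω i o * δ i i) ≡⟨ ∑-*ʳ (δ i i) (ω i) ⟩
      ∑ (ω i) * δ i i ≡⟨ cong₂ _*_ (∑ω≡1 i) (δ-refl i) ⟩
      1ℚ ∎
    mean : ∀ c → ∑[ j ∈ Fin m ] (w j * val j c) ≡ ∑[ i ∈ Fin M ] ∑[ o ∈ O ] (ω i o * v i o c)
    mean c = begin-equality
      ∑[ j ∈ Fin m ] (w j * val j c) ≡⟨ ∑-cong (λ j → cong (λ z → w j * [ δ (g j) , val j ]′ z) (Fin.splitAt-↑ʳ M k c)) ⟨
      ∑[ j ∈ Fin m ] (w j * a (pt j) (M ↑ʳ c)) ≡⟨ total≡ (M ↑ʳ c) ⟩
      ∑[ x ∈ Fin M × O ] (uncurry ω x * a x (M ↑ʳ c)) ≡⟨ ∑-× (λ x → uncurry ω x * a x (M ↑ʳ c)) ⟩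
      ∑[ i′ ∈ Fin M ] ∑[ o ∈ O ] (ω i′ o * a (i′ , o) (M ↑ʳ c))
        ≡⟨ ∑-cong (λ i′ → ∑-cong λ o → cong (λ z → ω i′ o * [ δ i′ , v i′ o ]′ z) (Fin.splitAt-↑ʳ M k c)) ⟩
      ∑[ i′ ∈ Fin M ] ∑[ o ∈ O ] (ω i′ o * v i′ o c) ∎
    -- A group without a point would have weight 0 instead of 1.
    pick : ∀ i → ∃[ j ] g j ≡ i
    pick i with Fin.any? (λ j → g j Fin.≟ i)
    ... | yes found = found
    ... | no none = contradiction (trans (sym (group i))
      (∑-zero λ j → trans (cong (w j *_) (δ-≢ λ eq → none (j , eq))) (*-zeroʳ (w j)))) 1≢0
    r : Fin M → Fin m
    r i = proj₁ (pick i)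
    s : Fin M → O
    s i = proj₂ (pt (r i))
    w≤1 : ∀ j → w j ≤ 1ℚ
    w≤1 j = begin
      w j ≡⟨ *-identityʳ (w j) ⟨
      w j * 1ℚ ≡⟨ cong (w j *_) (δ-refl (g j)) ⟨
      w j * δ (g j) (g j) ≤⟨ term≤∑ (λ j′ → 0≤p*q (0≤w j′) (0≤δ (g j′) (g j))) j ⟩
      ∑[ j′ ∈ Fin m ] (w j′ * δ (g j′) (g j)) ≡⟨ group (g j) ⟩
      1ℚ ∎
    -- As each group has weight 1, its chosen vector can be spread over the points of the group;
    -- chosen vectors and means are then compared point by point.
    chosen : ∀ c → ∑[ i ∈ Fin M ] v i (s i) c ≡ ∑[ j ∈ Fin m ] (w j * v (g j) (s (g j)) c)
    chosen c = begin-equality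
      ∑[ i ∈ Fin M ] u i ≡⟨ ∑-cong (λ i → trans (cong (_* u i) (group i)) (*-identityˡ (u i))) ⟨
      ∑[ i ∈ Fin M ] (∑[ j ∈ Fin m ] (w j * δ (g j) i) * u i) ≡⟨ ∑-cong (λ i → ∑-*ʳ (u i) (λ j → w j * δ (g j) i)) ⟨
      ∑[ i ∈ Fin M ] ∑[ j ∈ Fin m ] (w j * δ (g j) i * u i) ≡⟨ ∑-comm (λ i j → w j * δ (g j) i * u i) ⟩
      ∑[ j ∈ Fin m ] ∑[ i ∈ Fin M ] (w j * δ (g j) i * u i) ≡⟨ ∑-cong (λ j → ∑-cong λ i → *-assoc (w j) (δ (g j) i) (u i)) ⟩
      ∑[ j ∈ Fin m ] ∑[ i ∈ Fin M ] (w j * (δ (g j) i * u i)) ≡⟨ ∑-cong (λ j → ∑-* (w j) (λ i → δ (g j) i * u i)) ⟩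
      ∑[ j ∈ Fin m ] (w j * ∑[ i ∈ Fin M ] (δ (g j) i * u i)) ≡⟨ ∑-cong (λ j → cong (w j *_) (∑-δˡ (g j) u)) ⟩
      ∑[ j ∈ Fin m ] (w j * u (g j)) ∎
      where
      u : Fin M → ℚ
      u i = v i (s i) c
    err : Fin m → Fin k → ℚ
    err j c = w j * (v (g j) (s (g j)) c - val j c)
    split : ∀ c → ∑[ i ∈ Fin M ] v i (s i) c - ∑[ i ∈ Fin M ] ∑[ o ∈ O ] (ω i o * v i o c) ≡ ∑[ j ∈ Fin m ] err j c
    split c = begin-equality
      ∑[ i ∈ Fin M ] v i (s i) c - ∑[ i ∈ Fin M ] ∑[ o ∈ O ] (ω i o * v i o c)
        ≡⟨ cong₂ _-_ (chosen c) (sym (mean c)) ⟩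
      ∑[ j ∈ Fin m ] (w j * v (g j) (s (g j)) c) - ∑[ j ∈ Fin m ] (w j * val j c)
        ≡⟨ ∑-- (λ j → w j * v (g j) (s (g j)) c) (λ j → w j * val j c) ⟨
      ∑[ j ∈ Fin m ] (w j * v (g j) (s (g j)) c - w j * val j c)
        ≡⟨ ∑-cong (λ j → factor (w j) (v (g j) (s (g j)) c) (val j c)) ⟩
      ∑[ j ∈ Fin m ] err j c ∎
      where
      factor : ∀ x y z → x * y - x * z ≡ x * (y - z)
      factor = solve-∀ ℚ-ring
    -- The representative of a group is the chosen option itself and has no error. Any other point
    -- errs by at most its weight times the diameter.
    err≤ : ∀ j → ‖ err j ‖ ≤ (1ℚ - δ j (r (g j))) * B
    err≤ j with j Fin.≟ r (g j)
    ... | yes j≡r = begin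
      ‖ err j ‖ ≡⟨ ‖‖-zero (λ c → trans (cong (λ z → w j * (v (g j) (proj₂ (pt z)) c - val j c)) (sym j≡r))
                              (trans (cong (w j *_) (+-inverseʳ (val j c))) (*-zeroʳ (w j)))) ⟩
      0ℚ ≡⟨ *-zeroˡ B ⟨
      0ℚ * B ≡⟨⟩
      (1ℚ - 1ℚ) * B ∎
    ... | no  _ = begin
      ‖ err j ‖ ≡⟨ ‖‖-* (0≤w j) (λ c → v (g j) (s (g j)) c - val j c) ⟩
      w j * ‖ (λ c → v (g j) (s (g j)) c - val j c) ‖ ≤⟨ *-mono 0≤1 (0≤‖‖ (λ c → v (g j) (s (g j)) c - val j c)) (w≤1 j) (diam (g j) (s (g j)) (proj₂ (pt j))) ⟩
      1ℚ * B ≡⟨⟩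
      (1ℚ - 0ℚ) * B ∎
    -- `r` is injective because `g (r i) ≡ i`. So there are `M` representatives among at most
    -- `M + k` points, and at most `k` points err.
    count : ∑[ j ∈ Fin m ] δ j (r (g j)) ≡ ι M
    count = begin-equality
      ∑[ j ∈ Fin m ] δ j (r (g j)) ≡⟨ ∑-cong (λ j → ∑-single (g j) (λ i i≢ → δ-≢ (λ j≡r → i≢ (trans (sym (proj₂ (pick i))) (cong g (sym j≡r)))))) ⟨
      ∑[ j ∈ Fin m ] ∑[ i ∈ Fin M ] δ j (r i) ≡⟨ ∑-comm (λ j i → δ j (r i)) ⟩
      ∑[ i ∈ Fin M ] ∑[ j ∈ Fin m ] δ j (r i) ≡⟨ ∑-cong (λ i → trans (∑-single (r i) (λ j → δ-≢)) (δ-refl (r i))) ⟩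
      ∑[ i ∈ Fin M ] 1ℚ ≡⟨ ∑-Fin-const M 1ℚ ⟩
      ι M * 1ℚ ≡⟨ *-identityʳ (ι M) ⟩
      ι M ∎
    bound : ‖ (λ c → ∑[ i ∈ Fin M ] v i (s i) c - ∑[ i ∈ Fin M ] ∑[ o ∈ O ] (ω i o * v i o c)) ‖ ≤ ι k * B
    bound = begin
      ‖ (λ c → ∑[ i ∈ Fin M ] v i (s i) c - ∑[ i ∈ Fin M ] ∑[ o ∈ O ] (ω i o * v i o c)) ‖
                                                    ≡⟨ ‖‖-cong split ⟩
      ‖ (λ c → ∑[ j ∈ Fin m ] err j c) ‖ ≤⟨ ‖‖-∑ err ⟩
      ∑[ j ∈ Fin m ] ‖ err j ‖ ≤⟨ ∑-mono err≤ ⟩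
      ∑[ j ∈ Fin m ] ((1ℚ - δ j (r (g j))) * B) ≡⟨ ∑-*ʳ B (λ j → 1ℚ - δ j (r (g j))) ⟩
      ∑[ j ∈ Fin m ] (1ℚ - δ j (r (g j))) * B ≡⟨ cong (_* B) (∑-- (λ _ → 1ℚ) (λ j → δ j (r (g j)))) ⟩
      (∑[ j ∈ Fin m ] 1ℚ - ∑[ j ∈ Fin m ] δ j (r (g j))) * B
                                                    ≡⟨ cong (_* B) (cong₂ _-_ (trans (∑-Fin-const m 1ℚ) (*-identityʳ (ι m))) count) ⟩
      (ι m - ι M) * B ≤⟨ *-monoʳ B 0≤B (+-monoˡ-≤ (- ι M) (ι-mono m≤)) ⟩
      (ι (M ℕ.+ k) - ι M) * B ≡⟨ cong (λ z → (z - ι M) * B) (ι-+ M k) ⟩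
      (ι M + ι k - ι M) * B ≡⟨ cong (_* B) (cancel (ι M) (ι k)) ⟩
      ι k * B ∎
      where
      cancel : ∀ x y → x + y - x ≡ y
      cancel = solve-∀ ℚ-ring

-- Random permutations

infixr 5 _▹_

-- A Lehmer code: the image of `zero`, followed by a code for the permutation of the remaining
-- points. The uniform distribution becomes the product `prob`, and expectations are computed by
-- recursion.
data Code : ℕ → Set where
  nil  : Code 0
  _▹_ : ∀ {n} → Fin (suc n) → Code n → Code (suc n)

uncons : ∀ {n} → Code (suc n) ↔ (Fin (suc n) × Code n)
uncons = mk↔ₛ′ (λ { (x ▹ c) → x , c }) (uncurry _▹_) (λ _ → refl) (λ { (_ ▹ _) → refl })

opaque
  instance
    finite-Code : ∀ {n} → Finite (Code n)
    finite-Code {zero}  = record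
      { size = 1 ; index = mk↔ₛ′ (λ _ → zero) (λ _ → nil) (λ { zero → refl }) (λ { nil → refl }) }
    finite-Code {suc n} = record
      { size = _ ; index = Finite.index finite-× ↔-∘ uncons }

∑-Code : ∀ {n} (f : Code (suc n) → ℚ) → ∑ f ≡ ∑[ x ∈ Fin (suc n) ] ∑[ c ∈ Code n ] f (x ▹ c)
∑-Code {n} f = trans (∑-↔ (↔-sym uncons) f) (∑-× (λ x → f (uncurry _▹_ x)))

act : ∀ {n} → Code n → Permutation′ n
act nil      = Permutation.id
act (x ▹ c) = insert zero x (act c)

prob : ∀ {n} → Code n → ℚ
prob nil              = 1ℚ
prob {suc n} (_ ▹ c) = ρ n * prob c

0≤prob : ∀ {n} (c : Code n) → 0ℚ ≤ prob c
0≤prob nil              = 0≤1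
0≤prob {suc n} (_ ▹ c) = 0≤p*q (0≤ρ n) (0≤prob c)

∑-suc : ∀ {n} (f : Fin (suc n) → ℚ) → ∑ f ≡ f zero + ∑[ i ∈ Fin n ] f (suc i)
∑-suc = ∑-punchIn zero

∑-skip : ∀ {n} (x : Fin (suc n)) (f : Fin (suc n) → ℚ) → ∑[ y ∈ Fin n ] f (punchIn x y) ≡ ∑ f - f x
∑-skip {n} x f = sym (trans (cong (_- f x) (∑-punchIn x f)) (cancel (f x) (∑[ y ∈ Fin n ] f (punchIn x y))))
  where
  cancel : ∀ p q → p + q - p ≡ q
  cancel = solve-∀ ℚ-ring

𝔼 : ∀ {n} → (Code n → ℚ) → ℚ
𝔼 f = ∑[ c ∈ _ ] (prob c * f c)

𝔼-suc : ∀ {n} (f : Code (suc n) → ℚ) → 𝔼 f ≡ ρ n * ∑[ x ∈ Fin (suc n) ] 𝔼 (λ c → f (x ▹ c))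
𝔼-suc {n} f = begin-equality
  𝔼 f ≡⟨ ∑-Code (λ c → prob c * f c) ⟩
  ∑[ x ∈ _ ] ∑[ c ∈ Code n ] (ρ n * prob c * f (x ▹ c)) ≡⟨ ∑-cong (λ x → ∑-cong λ c → *-assoc (ρ n) (prob c) (f (x ▹ c))) ⟩
  ∑[ x ∈ _ ] ∑[ c ∈ Code n ] (ρ n * (prob c * f (x ▹ c))) ≡⟨ ∑-cong (λ x → ∑-* (ρ n) (λ c → prob c * f (x ▹ c))) ⟩
  ∑[ x ∈ _ ] (ρ n * 𝔼 (λ c → f (x ▹ c))) ≡⟨ ∑-* (ρ n) (λ x → 𝔼 (λ c → f (x ▹ c))) ⟩
  ρ n * ∑[ x ∈ Fin (suc n) ] 𝔼 (λ c → f (x ▹ c)) ∎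

𝔼-cong : ∀ {n} {f g : Code n → ℚ} → (∀ c → f c ≡ g c) → 𝔼 f ≡ 𝔼 g
𝔼-cong f≡g = ∑-cong λ c → cong (prob c *_) (f≡g c)

𝔼-const : ∀ n q → 𝔼 {n} (λ _ → q) ≡ q
𝔼-const zero q = trans (∑-single {Code 0} nil (λ { nil nil≢nil → contradiction refl nil≢nil })) (*-identityˡ q)
𝔼-const (suc n) q = begin-equality
  𝔼 {suc n} (λ _ → q) ≡⟨ 𝔼-suc {n} (λ _ → q) ⟩
  ρ n * ∑[ x ∈ Fin (suc n) ] 𝔼 {n} (λ _ → q) ≡⟨ cong (ρ n *_) (∑-cong λ _ → 𝔼-const n q) ⟩
  ρ n * ∑[ x ∈ Fin (suc n) ] q ≡⟨ cong (ρ n *_) (∑-Fin-const (suc n) q) ⟩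
  ρ n * (ι (suc n) * q) ≡⟨ *-assoc (ρ n) (ι (suc n)) q ⟨
  ρ n * ι (suc n) * q ≡⟨ cong (_* q) (ρ*ι n) ⟩
  1ℚ * q ≡⟨ *-identityˡ q ⟩
  q ∎

-- Given the image `x` of `zero`, the image of `suc a` is uniform on the complement of `x`, by
-- induction; each value lies in equally many of these complements.
𝔼-point : ∀ {n} (a : Fin (suc n)) (f : Fin (suc n) → ℚ) → 𝔼 (λ c → f (act c ⟨$⟩ʳ a)) ≡ ρ n * ∑ f
𝔼-point {n} zero f = begin-equality
  𝔼 (λ c → f (act c ⟨$⟩ʳ zero)) ≡⟨ 𝔼-suc (λ c → f (act c ⟨$⟩ʳ zero)) ⟩
  ρ n * ∑[ x ∈ _ ] 𝔼 {n} (λ _ → f x) ≡⟨ cong (ρ n *_) (∑-cong λ x → 𝔼-const n (f x)) ⟩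
  ρ n * ∑ f ∎
𝔼-point {suc n} (suc a) f = begin-equality
  𝔼 (λ c → f (act c ⟨$⟩ʳ suc a)) ≡⟨ 𝔼-suc (λ c → f (act c ⟨$⟩ʳ suc a)) ⟩
  ρ (suc n) * ∑[ x ∈ _ ] 𝔼 (λ c → f (act (x ▹ c) ⟨$⟩ʳ suc a)) ≡⟨ cong (ρ (suc n) *_) (∑-cong λ x → 𝔼-cong λ c → cong f (insert-punchIn zero x (act c) a)) ⟩
  ρ (suc n) * ∑[ x ∈ _ ] 𝔼 (λ c → f (punchIn x (act c ⟨$⟩ʳ a)))
    ≡⟨ cong (ρ (suc n) *_) (∑-cong λ x → trans (𝔼-point a (f ∘ punchIn x)) (cong (ρ n *_) (∑-skip x f))) ⟩
  ρ (suc n) * ∑[ x ∈ _ ] (ρ n * (∑ f - f x)) ≡⟨ cong (ρ (suc n) *_) (∑-* (ρ n) (λ x → ∑ f - f x)) ⟩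
  ρ (suc n) * (ρ n * ∑[ x ∈ _ ] (∑ f - f x)) ≡⟨ cong (λ z → ρ (suc n) * (ρ n * z)) (trans (∑-- (λ _ → ∑ f) f) (cong (_- ∑ f) (∑-Fin-const (suc (suc n)) (∑ f)))) ⟩
  ρ (suc n) * (ρ n * (ι (suc (suc n)) * ∑ f - ∑ f)) ≡⟨ rearrange (ρ (suc n)) (ρ n) (ι (suc n)) (∑ f) ⟩
  ρ (suc n) * (ρ n * ι (suc n) * ∑ f) ≡⟨ cong (λ z → ρ (suc n) * (z * ∑ f)) (ρ*ι n) ⟩
  ρ (suc n) * (1ℚ * ∑ f) ≡⟨ cong (ρ (suc n) *_) (*-identityˡ (∑ f)) ⟩
  ρ (suc n) * ∑ f ∎
  where
  rearrange : ∀ x y i z → x * (y * ((1ℚ + i) * z - z)) ≡ x * (y * i * z)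
  rearrange = solve-∀ ℚ-ring

module _ {n} (g : Fin (suc (suc n)) → Fin (suc (suc n)) → ℚ) (g≡0 : ∀ x → g x x ≡ 0ℚ) where
  𝔼-pair-zero : ∀ b → 𝔼 (λ c → g (act c ⟨$⟩ʳ zero) (act c ⟨$⟩ʳ suc b)) ≡ ρ (suc n) * (ρ n * ∑[ x ∈ _ ] ∑ (g x))
  𝔼-pair-zero b = begin-equality
    𝔼 (λ c → g (act c ⟨$⟩ʳ zero) (act c ⟨$⟩ʳ suc b)) ≡⟨ 𝔼-suc (λ c → g (act c ⟨$⟩ʳ zero) (act c ⟨$⟩ʳ suc b)) ⟩
    ρ (suc n) * ∑[ x ∈ _ ] 𝔼 (λ c → g x (act (x ▹ c) ⟨$⟩ʳ suc b)) ≡⟨ cong (ρ (suc n) *_) (∑-cong λ x → 𝔼-cong λ c → cong (g x) (insert-punchIn zero x (act c) b)) ⟩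
    ρ (suc n) * ∑[ x ∈ _ ] 𝔼 (λ c → g x (punchIn x (act c ⟨$⟩ʳ b)))
      ≡⟨ cong (ρ (suc n) *_) (∑-cong λ x → trans (𝔼-point b (g x ∘ punchIn x)) (cong (ρ n *_) (trans (∑-skip x (g x)) (trans (cong (_-_ (∑ (g x))) (g≡0 x)) (minus-zero (∑ (g x))))))) ⟩
    ρ (suc n) * ∑[ x ∈ _ ] (ρ n * ∑ (g x)) ≡⟨ cong (ρ (suc n) *_) (∑-* (ρ n) (λ x → ∑ (g x))) ⟩
    ρ (suc n) * (ρ n * ∑[ x ∈ _ ] ∑ (g x)) ∎
    where
    minus-zero : ∀ p → p - 0ℚ ≡ p
    minus-zero = solve-∀ ℚ-ring

-- If neither point is `zero`, the image `x` of `zero` deletes a row and a column of `g`. An entry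
-- with distinct indices survives in all but two of these minors and the diagonal is zero, so the
-- average over the minors is the average over all ordered pairs.
𝔼-pair : ∀ {n} (g : Fin (suc (suc n)) → Fin (suc (suc n)) → ℚ) → (∀ x → g x x ≡ 0ℚ) → ∀ a b → a ≢ b →
  𝔼 (λ c → g (act c ⟨$⟩ʳ a) (act c ⟨$⟩ʳ b)) ≡ ρ (suc n) * (ρ n * ∑[ x ∈ _ ] ∑ (g x))
𝔼-pair g g≡0 zero    zero    a≢b = contradiction refl a≢b
𝔼-pair g g≡0 zero    (suc b) a≢b = 𝔼-pair-zero g g≡0 b
𝔼-pair {n} g g≡0 (suc a) zero a≢b = trans (𝔼-pair-zero (λ x y → g y x) g≡0 a)
  (cong (λ z → ρ (suc n) * (ρ n * z)) (∑-comm (λ x y → g y x)))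
𝔼-pair {zero} g g≡0 (suc zero) (suc zero) a≢b = contradiction refl a≢b
𝔼-pair {suc n} g g≡0 (suc a) (suc b) a≢b = begin-equality
  𝔼 (λ c → g (act c ⟨$⟩ʳ suc a) (act c ⟨$⟩ʳ suc b)) ≡⟨ 𝔼-suc (λ c → g (act c ⟨$⟩ʳ suc a) (act c ⟨$⟩ʳ suc b)) ⟩
  ρ (suc (suc n)) * ∑[ x ∈ _ ] 𝔼 (λ c → g (act (x ▹ c) ⟨$⟩ʳ suc a) (act (x ▹ c) ⟨$⟩ʳ suc b))
    ≡⟨ cong (ρ (suc (suc n)) *_) (∑-cong λ x → trans (𝔼-cong λ c → cong₂ g (insert-punchIn zero x (act c) a) (insert-punchIn zero x (act c) b))
        (𝔼-pair (λ y z → g (punchIn x y) (punchIn x z)) (λ y → g≡0 (punchIn x y)) a b (a≢b ∘ cong suc))) ⟩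
  ρ (suc (suc n)) * ∑[ x ∈ _ ] (ρ (suc n) * (ρ n * ∑[ y ∈ _ ] ∑[ z ∈ _ ] g (punchIn x y) (punchIn x z)))
    ≡⟨ cong (ρ (suc (suc n)) *_) (trans (∑-* (ρ (suc n)) (λ x → ρ n * ∑[ y ∈ _ ] ∑[ z ∈ _ ] g (punchIn x y) (punchIn x z)))
         (cong (ρ (suc n) *_) (trans (∑-* (ρ n) (λ x → ∑[ y ∈ _ ] ∑[ z ∈ _ ] g (punchIn x y) (punchIn x z))) (cong (ρ n *_) minors)))) ⟩
  ρ (suc (suc n)) * (ρ (suc n) * (ρ n * (ι (suc n) * G)))
    ≡⟨ cong (λ z → ρ (suc (suc n)) * (ρ (suc n) * z)) (trans (sym (*-assoc (ρ n) (ι (suc n)) G)) (trans (cong (_* G) (ρ*ι n)) (*-identityˡ G))) ⟩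
  ρ (suc (suc n)) * (ρ (suc n) * G) ∎
  where
  G = ∑[ x ∈ _ ] ∑ (g x)
  minor : ∀ x → ∑[ y ∈ _ ] ∑[ z ∈ _ ] g (punchIn x y) (punchIn x z) ≡ G - ∑[ y ∈ _ ] g y x - ∑ (g x)
  minor x = begin-equality
    ∑[ y ∈ _ ] ∑[ z ∈ _ ] g (punchIn x y) (punchIn x z) ≡⟨ ∑-cong (λ y → ∑-skip x (g (punchIn x y))) ⟩
    ∑[ y ∈ _ ] (∑ (g (punchIn x y)) - g (punchIn x y) x) ≡⟨ ∑-- (λ y → ∑ (g (punchIn x y))) (λ y → g (punchIn x y) x) ⟩
    ∑[ y ∈ _ ] ∑ (g (punchIn x y)) - ∑[ y ∈ _ ] g (punchIn x y) x ≡⟨ cong₂ _-_ (∑-skip x (λ y → ∑ (g y))) (∑-skip x (λ y → g y x)) ⟩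
    G - ∑ (g x) - (∑[ y ∈ _ ] g y x - g x x) ≡⟨ cong (λ t → G - ∑ (g x) - (∑[ y ∈ _ ] g y x - t)) (g≡0 x) ⟩
    G - ∑ (g x) - (∑[ y ∈ _ ] g y x - 0ℚ) ≡⟨ lemma G (∑ (g x)) (∑[ y ∈ _ ] g y x) ⟩
    G - ∑[ y ∈ _ ] g y x - ∑ (g x) ∎
    where
    lemma : ∀ p q r → p - q - (r - 0ℚ) ≡ p - r - q
    lemma = solve-∀ ℚ-ring
  minors : ∑[ x ∈ _ ] ∑[ y ∈ _ ] ∑[ z ∈ _ ] g (punchIn x y) (punchIn x z) ≡ ι (suc n) * G
  minors = begin-equality
    ∑[ x ∈ _ ] ∑[ y ∈ _ ] ∑[ z ∈ _ ] g (punchIn x y) (punchIn x z) ≡⟨ ∑-cong minor ⟩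
    ∑[ x ∈ _ ] (G - ∑[ y ∈ _ ] g y x - ∑ (g x)) ≡⟨ ∑-- (λ x → G - ∑[ y ∈ _ ] g y x) (λ x → ∑ (g x)) ⟩
    ∑[ x ∈ _ ] (G - ∑[ y ∈ _ ] g y x) - G ≡⟨ cong (_- G) (∑-- (λ _ → G) (λ x → ∑[ y ∈ _ ] g y x)) ⟩
    ∑[ x ∈ Fin (suc (suc (suc n))) ] G - ∑[ x ∈ _ ] ∑[ y ∈ _ ] g y x - G ≡⟨ cong₂ (λ s t → s - t - G) (∑-Fin-const (suc (suc (suc n))) G) (∑-comm (λ x y → g y x)) ⟩
    ι (suc (suc (suc n))) * G - G - G ≡⟨ lemma (ι (suc n)) G ⟩
    ι (suc n) * G ∎
    where
    lemma : ∀ i z → (1ℚ + (1ℚ + i)) * z - z - z ≡ i * z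
    lemma = solve-∀ ℚ-ring

opaque
  unfolding ‖_‖

  ∣∣≤‖‖ : ∀ {k} (v : Fin k → ℚ) c → ∣ v c ∣ ≤ ‖ v ‖
  ∣∣≤‖‖ v = term≤∑ {f = ∣_∣ ∘ v} (λ c → 0≤∣p∣ (v c))

  ‖‖≤ : ∀ {k B} (v : Fin k → ℚ) → (∀ c → ∣ v c ∣ ≤ B) → ‖ v ‖ ≤ ι k * B
  ‖‖≤ {k} {B} v v≤B = ≤-trans (∑-mono v≤B) (≤-reflexive (∑-Fin-const k B))

  ‖‖-∣∣ : ∀ {k} (v : Fin k → ℚ) → ∑[ c ∈ Fin k ] ∣ v c ∣ ≡ ‖ v ‖
  ‖‖-∣∣ v = refl

-- Balancing signs by the second moment

sq : ℚ → ℚ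
sq p = p * p

∣∣-sq : ∀ p → ∣ p ∣ * ∣ p ∣ ≡ sq p
∣∣-sq p = trans (sym (∣p*q∣≡∣p∣*∣q∣ p p)) (0≤p⇒∣p∣≡p (0≤sq p))
  where
  0≤sq : ∀ p → 0ℚ ≤ p * p
  0≤sq p with ≤-total 0ℚ p
  ... | inj₁ 0≤p = 0≤p*q 0≤p 0≤p
  ... | inj₂ p≤0 = subst (0ℚ ≤_) (lemma p) (0≤p*q (neg-antimono-≤ p≤0) (neg-antimono-≤ p≤0))
    where
    lemma : ∀ p → (- p) * (- p) ≡ p * p
    lemma = solve-∀ ℚ-ring

0≤sq : ∀ p → 0ℚ ≤ sq p
0≤sq p = subst (0ℚ ≤_) (∣∣-sq p) (0≤p*q (0≤∣p∣ p) (0≤∣p∣ p))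

-- Stands in for a square root, which could be irrational; the second moment is therefore always
-- bounded by the square of a rational.
sq-cancel-≤ : ∀ {p q} → 0ℚ ≤ q → sq p ≤ sq q → ∣ p ∣ ≤ q
sq-cancel-≤ {p} {q} 0≤q p²≤q² with ∣ p ∣ ≤? q
... | yes p≤q = p≤q
... | no  p≰q = *-cancelʳ-≤-pos ∣ p ∣ {{positive (≤-<-trans 0≤q (≰⇒> p≰q))}} (begin
  ∣ p ∣ * ∣ p ∣ ≡⟨ ∣∣-sq p ⟩
  sq p ≤⟨ p²≤q² ⟩
  q * q ≤⟨ *-monoˡ q 0≤q (<⇒≤ (≰⇒> p≰q)) ⟩
  q * ∣ p ∣ ∎)

∑-sq≤ : ∀ {k} (v : Fin k → ℚ) {B} → ‖ v ‖ ≤ B → ∑[ c ∈ Fin k ] sq (v c) ≤ sq B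
∑-sq≤ {k} v {B} v≤B = begin
  ∑[ c ∈ Fin k ] sq (v c) ≡⟨ ∑-cong (λ c → ∣∣-sq (v c)) ⟨
  ∑[ c ∈ Fin k ] (∣ v c ∣ * ∣ v c ∣) ≤⟨ ∑-mono (λ c → *-monoˡ ∣ v c ∣ (0≤∣p∣ (v c)) (≤-trans (∣∣≤‖‖ v c) v≤B)) ⟩
  ∑[ c ∈ Fin k ] (∣ v c ∣ * B) ≡⟨ ∑-*ʳ B (λ c → ∣ v c ∣) ⟩
  ∑[ c ∈ Fin k ] ∣ v c ∣ * B ≡⟨ cong (_* B) (‖‖-∣∣ v) ⟩
  ‖ v ‖ * B ≤⟨ *-monoʳ B (≤-trans (0≤‖‖ v) v≤B) v≤B ⟩
  B * B ∎

sgn : Bool → ℚ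
sgn true  = 1ℚ
sgn false = - 1ℚ

2ℚ : ℚ
2ℚ = 1ℚ + 1ℚ

-- The constant and the linear part are there for the induction: fixing the first sign of a purely
-- quadratic form produces both.
quad : ∀ {n} → ℚ → (Fin n → ℚ) → (Fin n → Fin n → ℚ) → (Fin n → Bool) → ℚ
quad {n} a b q ε = a + ∑[ i ∈ Fin n ] (sgn (ε i) * b i) + ∑[ i ∈ Fin n ] ∑[ j ∈ Fin n ] (sgn (ε i) * sgn (ε j) * q i j)

-- An upper bound for the mean of the square of quad over all signs.
energy : ∀ {n} → ℚ → (Fin n → ℚ) → (Fin n → Fin n → ℚ) → ℚ
energy {n} a b q = sq (a + ∑[ i ∈ Fin n ] q i i) + ∑[ i ∈ Fin n ] sq (b i) + 2ℚ * ∑[ i ∈ Fin n ] ∑[ j ∈ Fin n ] sq (q i j)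

module _ {n} (a : ℚ) (b : Fin (suc n) → ℚ) (q : Fin (suc n) → Fin (suc n) → ℚ) (q-sym : ∀ i j → q i j ≡ q j i) where

  -- `a′`, `b′` and `q′` are the coefficients left after the first sign is fixed. The diagonal entry
  -- becomes constant because signs square to 1; the two symmetric entries that involve the first
  -- sign become a linear coefficient with the factor 2.
  a′ : Bool → ℚ
  a′ s = a + q zero zero + sgn s * b zero

  b′ : Bool → Fin n → ℚ
  b′ s i = b (suc i) + 2ℚ * (sgn s * q zero (suc i))

  q′ : Fin n → Fin n → ℚ
  q′ i j = q (suc i) (suc j)

  ∑∑-suc : (f : Fin (suc n) → Fin (suc n) → ℚ) → ∑[ i ∈ _ ] ∑[ j ∈ _ ] f i j ≡
    f zero zero + ∑[ j ∈ Fin n ] f zero (suc j) + ∑[ i ∈ Fin n ] f (suc i) zero + ∑[ i ∈ Fin n ] ∑[ j ∈ Fin n ] f (suc i) (suc j)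
  ∑∑-suc f = begin-equality
    ∑[ i ∈ _ ] ∑[ j ∈ _ ] f i j ≡⟨ ∑-suc (λ i → ∑[ j ∈ _ ] f i j) ⟩
    ∑[ j ∈ _ ] f zero j + ∑[ i ∈ Fin n ] ∑[ j ∈ _ ] f (suc i) j
      ≡⟨ cong₂ _+_ (∑-suc (f zero)) (trans (∑-cong λ i → ∑-suc (f (suc i))) (∑-+ (λ i → f (suc i) zero) (λ i → ∑[ j ∈ Fin n ] f (suc i) (suc j)))) ⟩
    f zero zero + F + (G + S) ≡⟨ +-assoc (f zero zero + F) G S ⟨
    f zero zero + F + G + S ∎
    where
    F = ∑[ j ∈ Fin n ] f zero (suc j)
    G = ∑[ i ∈ Fin n ] f (suc i) zero
    S = ∑[ i ∈ Fin n ] ∑[ j ∈ Fin n ] f (suc i) (suc j)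

  sgn-sq : ∀ s → sgn s * sgn s ≡ 1ℚ
  sgn-sq true  = refl
  sgn-sq false = refl

  quad-suc : ∀ ε → quad a b q ε ≡ quad (a′ (ε zero)) (b′ (ε zero)) q′ (ε ∘ suc)
  quad-suc ε = begin-equality
    a + ∑[ i ∈ _ ] (sgn (ε i) * b i) + ∑[ i ∈ _ ] ∑[ j ∈ _ ] (sgn (ε i) * sgn (ε j) * q i j)
      ≡⟨ cong₂ (λ x y → a + x + y) (∑-suc (λ i → sgn (ε i) * b i)) (∑∑-suc (λ i j → sgn (ε i) * sgn (ε j) * q i j)) ⟩
    a + (s * b zero + B) + (s * s * q zero zero + F + G + S)
      ≡⟨ cong₂ (λ x y → a + (s * b zero + B) + (x * q zero zero + y + G + S)) (sgn-sq (ε zero)) F≡ ⟩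
    a + (s * b zero + B) + (1ℚ * q zero zero + R + G + S)
      ≡⟨ cong (λ y → a + (s * b zero + B) + (1ℚ * q zero zero + R + y + S)) G≡ ⟩
    a + (s * b zero + B) + (1ℚ * q zero zero + R + R + S)
      ≡⟨ rearrange a (s * b zero) B (q zero zero) R S ⟩
    a′ (ε zero) + (B + 2ℚ * R) + S
      ≡⟨ cong (λ x → a′ (ε zero) + x + S) B′≡ ⟨
    quad (a′ (ε zero)) (b′ (ε zero)) q′ (ε ∘ suc) ∎
    where
    s = sgn (ε zero)
    σ : Fin n → ℚ
    σ i = sgn (ε (suc i))
    B = ∑[ i ∈ Fin n ] (σ i * b (suc i))
    F = ∑[ j ∈ Fin n ] (s * σ j * q zero (suc j))
    G = ∑[ i ∈ Fin n ] (σ i * s * q (suc i) zero)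
    R = ∑[ i ∈ Fin n ] (σ i * (s * q zero (suc i)))
    S = ∑[ i ∈ Fin n ] ∑[ j ∈ Fin n ] (σ i * σ j * q′ i j)
    rearrange : ∀ a x B y R S → a + (x + B) + (1ℚ * y + R + R + S) ≡ a + y + x + (B + 2ℚ * R) + S
    rearrange = solve-∀ ℚ-ring
    l₁ : ∀ x y z → x * y * z ≡ y * (x * z)
    l₁ = solve-∀ ℚ-ring
    F≡ : F ≡ R
    F≡ = ∑-cong λ j → l₁ s (σ j) (q zero (suc j))
    G≡ : G ≡ R
    G≡ = ∑-cong λ i → trans (*-assoc (σ i) s _) (cong (λ z → σ i * (s * z)) (q-sym (suc i) zero))
    l₂ : ∀ x y z → x * (y + 2ℚ * z) ≡ x * y + 2ℚ * (x * z)
    l₂ = solve-∀ ℚ-ring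
    B′≡ : ∑[ i ∈ Fin n ] (σ i * b′ (ε zero) i) ≡ B + 2ℚ * R
    B′≡ = begin-equality
      ∑[ i ∈ Fin n ] (σ i * b′ (ε zero) i) ≡⟨ ∑-cong (λ i → l₂ (σ i) (b (suc i)) (s * q zero (suc i))) ⟩
      ∑[ i ∈ Fin n ] (σ i * b (suc i) + 2ℚ * (σ i * (s * q zero (suc i))))
        ≡⟨ ∑-+ (λ i → σ i * b (suc i)) (λ i → 2ℚ * (σ i * (s * q zero (suc i)))) ⟩
      B + ∑[ i ∈ Fin n ] (2ℚ * (σ i * (s * q zero (suc i))))
        ≡⟨ cong (B +_) (∑-* 2ℚ (λ i → σ i * (s * q zero (suc i)))) ⟩
      B + 2ℚ * R ∎

  -- The terms that are odd in the fixed sign cancel. The slack is four times the square of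
  -- `q zero zero`, since `energy` counts the diagonal entries also among the squares, although only
  -- the trace contains them in the true second moment.
  energy-mean : energy (a′ true) (b′ true) q′ + energy (a′ false) (b′ false) q′ ≤ 2ℚ * energy a b q
  energy-mean = ≤-by (2ℚ * 2ℚ * sq (q zero zero)) (0≤p*q (nonNegative⁻¹ (2ℚ * 2ℚ)) (0≤sq (q zero zero))) (begin-equality
    2ℚ * energy a b q
      ≡⟨ cong₂ (λ x y → 2ℚ * (sq (a + x) + y + 2ℚ * QQ)) (∑-suc (λ i → q i i)) (∑-suc (λ i → sq (b i))) ⟩
    2ℚ * (sq (a + (q zero zero + t)) + (sq (b zero) + BB) + 2ℚ * QQ)
      ≡⟨ cong (λ z → 2ℚ * (sq (a + (q zero zero + t)) + (sq (b zero) + BB) + 2ℚ * z)) (trans (∑∑-suc (λ i j → sq (q i j)))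
           (cong (λ z → sq (q zero zero) + RR + z + QQ′) (∑-cong λ i → cong sq (q-sym (suc i) zero)))) ⟩
    2ℚ * (sq (a + (q zero zero + t)) + (sq (b zero) + BB) + 2ℚ * (sq (q zero zero) + RR + RR + QQ′))
      ≡⟨ rearrange a (q zero zero) t (b zero) BB RR QQ′ ⟩
    sq (a′ true + t) + sq (a′ false + t) + (2ℚ * BB + 2ℚ * 2ℚ * 2ℚ * RR) + 2ℚ * 2ℚ * QQ′ + 2ℚ * 2ℚ * sq (q zero zero)
      ≡⟨ cong (λ z → sq (a′ true + t) + sq (a′ false + t) + z + 2ℚ * 2ℚ * QQ′ + 2ℚ * 2ℚ * sq (q zero zero)) b′≡ ⟨
    sq (a′ true + t) + sq (a′ false + t) + (∑[ i ∈ Fin n ] sq (b′ true i) + ∑[ i ∈ Fin n ] sq (b′ false i)) + 2ℚ * 2ℚ * QQ′ + 2ℚ * 2ℚ * sq (q zero zero)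
      ≡⟨ regroup (sq (a′ true + t)) (sq (a′ false + t)) (∑[ i ∈ Fin n ] sq (b′ true i)) (∑[ i ∈ Fin n ] sq (b′ false i)) QQ′ (sq (q zero zero)) ⟩
    energy (a′ true) (b′ true) q′ + energy (a′ false) (b′ false) q′ + 2ℚ * 2ℚ * sq (q zero zero) ∎)
    where
    t = ∑[ i ∈ Fin n ] q (suc i) (suc i)
    BB = ∑[ i ∈ Fin n ] sq (b (suc i))
    RR = ∑[ i ∈ Fin n ] sq (q zero (suc i))
    QQ = ∑[ i ∈ _ ] ∑[ j ∈ _ ] sq (q i j)
    QQ′ = ∑[ i ∈ Fin n ] ∑[ j ∈ Fin n ] sq (q′ i j)
    b′≡ : ∑[ i ∈ Fin n ] sq (b′ true i) + ∑[ i ∈ Fin n ] sq (b′ false i) ≡ 2ℚ * BB + 2ℚ * 2ℚ * 2ℚ * RR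
    b′≡ = begin-equality
      ∑[ i ∈ Fin n ] sq (b′ true i) + ∑[ i ∈ Fin n ] sq (b′ false i) ≡⟨ ∑-+ (sq ∘ b′ true) (sq ∘ b′ false) ⟨
      ∑[ i ∈ Fin n ] (sq (b′ true i) + sq (b′ false i))
        ≡⟨ ∑-cong (λ i → lemma (b (suc i)) (q zero (suc i))) ⟩
      ∑[ i ∈ Fin n ] (2ℚ * sq (b (suc i)) + 2ℚ * 2ℚ * 2ℚ * sq (q zero (suc i)))
        ≡⟨ ∑-+ (λ i → 2ℚ * sq (b (suc i))) (λ i → 2ℚ * 2ℚ * 2ℚ * sq (q zero (suc i))) ⟩
      ∑[ i ∈ Fin n ] (2ℚ * sq (b (suc i))) + ∑[ i ∈ Fin n ] (2ℚ * 2ℚ * 2ℚ * sq (q zero (suc i)))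
        ≡⟨ cong₂ _+_ (∑-* 2ℚ (λ i → sq (b (suc i)))) (∑-* (2ℚ * 2ℚ * 2ℚ) (λ i → sq (q zero (suc i)))) ⟩
      2ℚ * BB + 2ℚ * 2ℚ * 2ℚ * RR ∎
      where
      lemma : ∀ x y → (x + 2ℚ * (1ℚ * y)) * (x + 2ℚ * (1ℚ * y)) + (x + 2ℚ * (- 1ℚ * y)) * (x + 2ℚ * (- 1ℚ * y)) ≡ 2ℚ * (x * x) + 2ℚ * 2ℚ * 2ℚ * (y * y)
      lemma = solve-∀ ℚ-ring
    rearrange : ∀ a q t b BB RR QQ → 2ℚ * ((a + (q + t)) * (a + (q + t)) + (b * b + BB) + 2ℚ * (q * q + RR + RR + QQ)) ≡
      (a + q + 1ℚ * b + t) * (a + q + 1ℚ * b + t) + (a + q + - 1ℚ * b + t) * (a + q + - 1ℚ * b + t) + (2ℚ * BB + 2ℚ * 2ℚ * 2ℚ * RR) + 2ℚ * 2ℚ * QQ + 2ℚ * 2ℚ * (q * q)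
    rearrange = solve-∀ ℚ-ring
    regroup : ∀ x y u v q z → x + y + (u + v) + 2ℚ * 2ℚ * q + 2ℚ * 2ℚ * z ≡ x + u + 2ℚ * q + (y + v + 2ℚ * q) + 2ℚ * 2ℚ * z
    regroup = solve-∀ ℚ-ring

-- The method of conditional expectations. The energies are summed over the coordinates, so that the
-- same sign serves all of them; one of its two values does not increase the sum.
signs : ∀ {n k} (a : Fin k → ℚ) (b : Fin n → Fin k → ℚ) (q : Fin n → Fin n → Fin k → ℚ) → (∀ i j c → q i j c ≡ q j i c) →
  Σ[ ε ∈ (Fin n → Bool) ] ∑[ c ∈ Fin k ] sq (quad (a c) (λ i → b i c) (λ i j → q i j c) ε)
    ≤ ∑[ c ∈ Fin k ] energy (a c) (λ i → b i c) (λ i j → q i j c)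
signs {zero} {k} a b q q-sym = (λ ()) , ∑-mono λ c → ≤-reflexive (begin-equality
  sq (quad (a c) (λ i → b i c) (λ i j → q i j c) (λ ())) ≡⟨ cong sq (quad-zero (a c) (λ i → b i c) (λ i j → q i j c) (λ ())) ⟩
  sq (a c + 0ℚ + 0ℚ) ≡⟨ lemma (a c) ⟩
  sq (a c + 0ℚ) + 0ℚ + 2ℚ * 0ℚ ≡⟨ energy-zero (a c) (λ i → b i c) (λ i j → q i j c) ⟨
  energy (a c) (λ i → b i c) (λ i j → q i j c) ∎)
  where
  lemma : ∀ x → (x + 0ℚ + 0ℚ) * (x + 0ℚ + 0ℚ) ≡ (x + 0ℚ) * (x + 0ℚ) + 0ℚ + 2ℚ * 0ℚ
  lemma = solve-∀ ℚ-ring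
  quad-zero : ∀ a b q ε → quad {0} a b q ε ≡ a + 0ℚ + 0ℚ
  quad-zero a b q ε = cong₂ (λ x y → a + x + y)
    (∑-Fin-zero (λ i → sgn (ε i) * b i)) (∑-Fin-zero (λ i → ∑[ j ∈ Fin 0 ] (sgn (ε i) * sgn (ε j) * q i j)))
  energy-zero : ∀ a b q → energy {0} a b q ≡ sq (a + 0ℚ) + 0ℚ + 2ℚ * 0ℚ
  energy-zero a b q = trans
    (cong₂ (λ x y → sq (a + x) + y + 2ℚ * ∑[ i ∈ Fin 0 ] ∑[ j ∈ Fin 0 ] sq (q i j)) (∑-Fin-zero (λ i → q i i)) (∑-Fin-zero (λ i → sq (b i))))
    (cong (λ x → sq (a + 0ℚ) + 0ℚ + 2ℚ * x) (∑-Fin-zero (λ i → ∑[ j ∈ Fin 0 ] sq (q i j))))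
signs {suc n} {k} a b q q-sym = result
  where
  A : Bool → Fin k → ℚ
  A s c = a′ (a c) (λ i → b i c) (λ i j → q i j c) (λ i j → q-sym i j c) s
  B : Bool → Fin n → Fin k → ℚ
  B s i c = b′ (a c) (λ i → b i c) (λ i j → q i j c) (λ i j → q-sym i j c) s i
  Q : Fin n → Fin n → Fin k → ℚ
  Q i j c = q (suc i) (suc j) c
  E : Bool → ℚ
  E s = ∑[ c ∈ Fin k ] energy (A s c) (λ i → B s i c) (λ i j → Q i j c)
  E₀ = ∑[ c ∈ Fin k ] energy (a c) (λ i → b i c) (λ i j → q i j c)
  E-mean : E true + E false ≤ 2ℚ * E₀
  E-mean = begin
    E true + E false
      ≡⟨ ∑-+ (λ c → energy (A true c) (λ i → B true i c) (λ i j → Q i j c)) (λ c → energy (A false c) (λ i → B false i c) (λ i j → Q i j c)) ⟨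
    ∑[ c ∈ Fin k ] (energy (A true c) (λ i → B true i c) (λ i j → Q i j c) + energy (A false c) (λ i → B false i c) (λ i j → Q i j c))
      ≤⟨ ∑-mono (λ c → energy-mean (a c) (λ i → b i c) (λ i j → q i j c) (λ i j → q-sym i j c)) ⟩
    ∑[ c ∈ Fin k ] (2ℚ * energy (a c) (λ i → b i c) (λ i j → q i j c))
      ≡⟨ ∑-* 2ℚ (λ c → energy (a c) (λ i → b i c) (λ i j → q i j c)) ⟩
    2ℚ * E₀ ∎
  good : ∃[ s ] E s ≤ E₀
  good with E true ≤? E₀ | E false ≤? E₀
  ... | yes t≤ | _      = true , t≤
  ... | no  _  | yes f≤ = false , f≤
  ... | no  t≰ | no f≰  = contradiction (<-≤-trans (+-mono-< (≰⇒> t≰) (≰⇒> f≰)) E-mean) (<-irrefl (double E₀))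
    where
    double : ∀ x → x + x ≡ 2ℚ * x
    double = solve-∀ ℚ-ring
  s = proj₁ good
  ih = signs (A s) (B s) Q (λ i j → q-sym (suc i) (suc j))
  result : _
  result = (s ∷ᵛ proj₁ ih) , (begin
    ∑[ c ∈ Fin k ] sq (quad (a c) (λ i → b i c) (λ i j → q i j c) (s ∷ᵛ proj₁ ih))
      ≡⟨ ∑-cong (λ c → cong sq (quad-suc (a c) (λ i → b i c) (λ i j → q i j c) (λ i j → q-sym i j c) (s ∷ᵛ proj₁ ih))) ⟩
    ∑[ c ∈ Fin k ] sq (quad (A s c) (λ i → B s i c) (λ i j → Q i j c) (proj₁ ih))
      ≤⟨ proj₂ ih ⟩
    E s ≤⟨ proj₂ good ⟩
    E₀ ∎)

∑≤ : ∀ {n} (f : Fin n → ℚ) {B} → (∀ i → f i ≤ B) → ∑ f ≤ ι n * B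
∑≤ {n} f {B} f≤B = ≤-trans (∑-mono f≤B) (≤-reflexive (∑-Fin-const n B))

opaque
  balancing-signs : ∀ {n k} (q : Fin n → Fin n → Fin k → ℚ) → (∀ i j c → q i j c ≡ q j i c) → ∀ {Q} → 0ℚ ≤ Q →
    (∀ i j → ‖ q i j ‖ ≤ Q) → Σ[ ε ∈ (Fin n → Bool) ]
      ‖ (λ c → ∑[ i ∈ Fin n ] ∑[ j ∈ Fin n ] (sgn (ε i) * sgn (ε j) * q i j c)) ‖ ≤ ι k * (2ℚ * (ι n * Q))
  balancing-signs {n} {k} q q-sym {Q} 0≤Q q≤Q = ε , ‖‖≤ S (λ c → sq-cancel-≤ (0≤p*q (0≤1+1) 0≤nQ) (≤-trans (term≤∑ (λ c′ → 0≤sq (S c′)) c) ∑S²≤))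
    where
    0≤1+1 : 0ℚ ≤ 2ℚ
    0≤1+1 = 0≤p+q 0≤1 0≤1
    nQ : ℚ
    nQ = ι n * Q
    0≤nQ : 0ℚ ≤ nQ
    0≤nQ = 0≤p*q (0≤ι n) 0≤Q
    ε : Fin n → Bool
    ε = proj₁ (signs (λ _ → 0ℚ) (λ _ _ → 0ℚ) q q-sym)
    S : Fin k → ℚ
    S c = ∑[ i ∈ Fin n ] ∑[ j ∈ Fin n ] (sgn (ε i) * sgn (ε j) * q i j c)
    quad≡S : ∀ c → quad 0ℚ (λ _ → 0ℚ) (λ i j → q i j c) ε ≡ S c
    quad≡S c = begin-equality
      0ℚ + ∑[ i ∈ Fin n ] (sgn (ε i) * 0ℚ) + S c ≡⟨ cong (λ x → 0ℚ + x + S c) (∑-zero λ i → *-zeroʳ (sgn (ε i))) ⟩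
      0ℚ + 0ℚ + S c ≡⟨ +-identityˡ (S c) ⟩
      S c ∎
    trace : Fin k → ℚ
    trace c = ∑[ i ∈ Fin n ] q i i c
    trace≤ : ‖ trace ‖ ≤ nQ
    trace≤ = ≤-trans (‖‖-∑ (λ i → q i i)) (∑≤ _ (λ i → q≤Q i i))
    squares : ∑[ c ∈ Fin k ] ∑[ i ∈ Fin n ] ∑[ j ∈ Fin n ] sq (q i j c) ≤ ι n * (ι n * sq Q)
    squares = begin
      ∑[ c ∈ Fin k ] ∑[ i ∈ Fin n ] ∑[ j ∈ Fin n ] sq (q i j c) ≡⟨ ∑-comm (λ c i → ∑[ j ∈ Fin n ] sq (q i j c)) ⟩
      ∑[ i ∈ Fin n ] ∑[ c ∈ Fin k ] ∑[ j ∈ Fin n ] sq (q i j c) ≡⟨ ∑-cong (λ i → ∑-comm (λ c j → sq (q i j c))) ⟩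
      ∑[ i ∈ Fin n ] ∑[ j ∈ Fin n ] ∑[ c ∈ Fin k ] sq (q i j c) ≤⟨ ∑≤ _ (λ i → ∑≤ _ (λ j → ∑-sq≤ (q i j) (q≤Q i j))) ⟩
      ι n * (ι n * sq Q) ∎
    ∑S²≤ : ∑[ c ∈ Fin k ] sq (S c) ≤ sq (2ℚ * nQ)
    ∑S²≤ = begin
      ∑[ c ∈ Fin k ] sq (S c) ≡⟨ ∑-cong (λ c → cong sq (quad≡S c)) ⟨
      _ ≤⟨ proj₂ (signs (λ _ → 0ℚ) (λ _ _ → 0ℚ) q q-sym) ⟩
      ∑[ c ∈ Fin k ] energy 0ℚ (λ _ → 0ℚ) (λ i j → q i j c)
        ≡⟨ ∑-cong (λ c → cong₂ (λ x y → sq x + y + 2ℚ * ∑[ i ∈ Fin n ] ∑[ j ∈ Fin n ] sq (q i j c)) (+-identityˡ (trace c)) (∑-zero {Fin n} λ _ → refl)) ⟩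
      ∑[ c ∈ Fin k ] (sq (trace c) + 0ℚ + 2ℚ * ∑[ i ∈ Fin n ] ∑[ j ∈ Fin n ] sq (q i j c))
        ≡⟨ ∑-+ (λ c → sq (trace c) + 0ℚ) (λ c → 2ℚ * ∑[ i ∈ Fin n ] ∑[ j ∈ Fin n ] sq (q i j c)) ⟩
      ∑[ c ∈ Fin k ] (sq (trace c) + 0ℚ) + ∑[ c ∈ Fin k ] (2ℚ * ∑[ i ∈ Fin n ] ∑[ j ∈ Fin n ] sq (q i j c))
        ≡⟨ cong₂ _+_ (∑-cong λ c → +-identityʳ (sq (trace c))) (∑-* 2ℚ (λ c → ∑[ i ∈ Fin n ] ∑[ j ∈ Fin n ] sq (q i j c))) ⟩
      ∑[ c ∈ Fin k ] sq (trace c) + 2ℚ * ∑[ c ∈ Fin k ] ∑[ i ∈ Fin n ] ∑[ j ∈ Fin n ] sq (q i j c)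
        ≤⟨ +-mono-≤ (∑-sq≤ trace trace≤) (*-monoˡ 2ℚ 0≤1+1 squares) ⟩
      -- This is three times `sq nQ`, rounded up to four times to become a perfect square.
      sq nQ + 2ℚ * (ι n * (ι n * sq Q))
        ≤⟨ ≤-by (sq nQ) (0≤sq nQ) (lemma (ι n) Q) ⟩
      sq (2ℚ * nQ) ∎
      where
      lemma : ∀ x y → 2ℚ * (x * y) * (2ℚ * (x * y)) ≡ x * y * (x * y) + 2ℚ * (x * (x * (y * y))) + x * y * (x * y)
      lemma = solve-∀ ℚ-ring

-- Weights on pairs of points

record Kernel (P : Set) (k : ℕ) : Set where
  field
    at       : P → P → Fin k → ℚ
    at-sym   : ∀ u v c → at u v c ≡ at v u c
    at-diag  : ∀ u c → at u u c ≡ 0ℚ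
    at-bound : ∀ u v → ‖ at u v ‖ ≤ 1ℚ

open Kernel public

pull : ∀ {P Q k} → (Q → P) → Kernel P k → Kernel Q k
pull f z = record
  { at       = λ u v → at z (f u) (f v)
  ; at-sym   = λ u v → at-sym z (f u) (f v)
  ; at-diag  = λ u → at-diag z (f u)
  ; at-bound = λ u v → at-bound z (f u) (f v) }

opaque
  -- Blobs are fixed sets of positions. Moving points between them means relabelling the kernel, so
  -- that a sequence of moves is a composition of bijections.
  rename : ∀ {P Q k} → Q ↔ P → Kernel P k → Kernel Q k
  rename π z = pull (Inverse.to π) z

  rename-pull : ∀ {P Q k} (π : Q ↔ P) (z : Kernel P k) → rename π z ≡ pull (Inverse.to π) z
  rename-pull π z = refl

  rename-id : ∀ {P k} (z : Kernel P k) → rename (↔-id P) z ≡ z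
  rename-id z = refl

  rename-∘ : ∀ {P Q R k} (π : Q ↔ P) (ρ : R ↔ Q) (z : Kernel P k) → rename ρ (rename π z) ≡ rename (π ↔-∘ ρ) z
  rename-∘ π ρ z = refl

module _ {P k} (z : Kernel P k) where

  cross : ∀ {m n} → (Fin m → P) → (Fin n → P) → Fin k → ℚ
  cross {m} {n} A B c = ∑[ a ∈ Fin m ] ∑[ b ∈ Fin n ] at z (A a) (B b) c

  cross-sym : ∀ {m n} (A : Fin m → P) (B : Fin n → P) c → cross A B c ≡ cross B A c
  cross-sym A B c = trans (∑-comm (λ a b → at z (A a) (B b) c)) (∑-cong λ b → ∑-cong λ a → at-sym z (A a) (B b) c)

  cross-bound : ∀ {m n} (A : Fin m → P) (B : Fin n → P) → ‖ cross A B ‖ ≤ ι m * ι n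
  cross-bound {m} {n} A B = begin
    ‖ cross A B ‖ ≤⟨ ‖‖-∑ (λ a c → ∑[ b ∈ Fin n ] at z (A a) (B b) c) ⟩
    _ ≤⟨ ∑≤ _ (λ a → ≤-trans (‖‖-∑ (λ b → at z (A a) (B b))) (∑≤ _ (λ b → at-bound z (A a) (B b)))) ⟩
    ι m * (ι n * 1ℚ) ≡⟨ cong (ι m *_) (*-identityʳ (ι n)) ⟩
    ι m * ι n ∎

  row : ∀ {n} → P → (Fin n → P) → Fin k → ℚ
  row {n} w A c = ∑[ x ∈ Fin n ] at z w (A x) c

  row-bound : ∀ {n} w (A : Fin n → P) → ‖ row w A ‖ ≤ ι n
  row-bound {n} w A = ≤-trans (‖‖-∑ (λ x → at z w (A x))) (≤-trans (∑≤ _ (λ x → at-bound z w (A x))) (≤-reflexive (*-identityʳ (ι n))))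

  -- Half the change of cross A A when the point A a is replaced by w.
  gain : ∀ {n} → (Fin n → P) → Fin n → P → Fin k → ℚ
  gain A a w c = row w A c - row (A a) A c - at z w (A a) c

  -- Only the row and the column of `a` change, equally by symmetry, hence the factor 2. The last
  -- term of `gain` removes the pair formed by the new and the old point, which are never in the
  -- blob together.
  cross-exchange : ∀ {n} (A B : Fin n → P) a → (∀ x → x ≢ a → B x ≡ A x) → ∀ c →
    cross B B c ≡ cross A A c + 2ℚ * gain A a (B a) c
  cross-exchange {suc n} A B a B≡A c = begin-equality
    cross B B c ≡⟨ expand B ⟩
    R B (B a) + R B (B a) + Q B ≡⟨ cong₂ (λ x y → x + x + y) R≡ Q≡ ⟩
    R A (B a) + R A (B a) + Q A ≡⟨ rearrange (R A (B a)) (R A (A a)) (Q A) (at z (B a) (A a) c) ⟩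
    R A (A a) + R A (A a) + Q A + 2ℚ * (at z (B a) (A a) c + R A (B a) - (0ℚ + R A (A a)) - at z (B a) (A a) c)
      ≡⟨ cong₂ (λ x y → x + 2ℚ * (at z (B a) (A a) c + R A (B a) - (y + R A (A a)) - at z (B a) (A a) c)) (expand A) (at-diag z (A a) c) ⟨
    cross A A c + 2ℚ * (at z (B a) (A a) c + R A (B a) - (at z (A a) (A a) c + R A (A a)) - at z (B a) (A a) c)
      ≡⟨ cong₂ (λ x y → cross A A c + 2ℚ * (x - y - at z (B a) (A a) c)) (∑-punchIn a (λ x → at z (B a) (A x) c)) (∑-punchIn a (λ x → at z (A a) (A x) c)) ⟨
    cross A A c + 2ℚ * gain A a (B a) c ∎
    where
    R : (Fin (suc n) → P) → P → ℚ
    R C w = ∑[ x ∈ Fin n ] at z w (C (punchIn a x)) c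
    Q : (Fin (suc n) → P) → ℚ
    Q C = ∑[ x ∈ Fin n ] ∑[ y ∈ Fin n ] at z (C (punchIn a x)) (C (punchIn a y)) c
    B≡A′ : ∀ x → B (punchIn a x) ≡ A (punchIn a x)
    B≡A′ x = B≡A (punchIn a x) (Fin.punchInᵢ≢i a x)
    R≡ : R B (B a) ≡ R A (B a)
    R≡ = ∑-cong λ x → cong (λ u → at z (B a) u c) (B≡A′ x)
    Q≡ : Q B ≡ Q A
    Q≡ = ∑-cong λ x → ∑-cong λ y → cong₂ (λ u v → at z u v c) (B≡A′ x) (B≡A′ y)
    rearrange : ∀ r s t x → r + r + t ≡ s + s + t + 2ℚ * (x + r - (0ℚ + s) - x)
    rearrange = solve-∀ ℚ-ring
    assoc : ∀ r t → 0ℚ + r + (r + t) ≡ r + r + t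
    assoc = solve-∀ ℚ-ring
    expand : ∀ C → cross C C c ≡ R C (C a) + R C (C a) + Q C
    expand C = begin-equality
      cross C C c
        ≡⟨ ∑-punchIn a (λ x → row (C x) C c) ⟩
      row (C a) C c + ∑[ x ∈ Fin n ] row (C (punchIn a x)) C c
        ≡⟨ cong₂ _+_ (∑-punchIn a (λ y → at z (C a) (C y) c)) (∑-cong λ x → ∑-punchIn a (λ y → at z (C (punchIn a x)) (C y) c)) ⟩
      at z (C a) (C a) c + R C (C a) + ∑[ x ∈ Fin n ] (at z (C (punchIn a x)) (C a) c + ∑[ y ∈ Fin n ] at z (C (punchIn a x)) (C (punchIn a y)) c)
        ≡⟨ cong₂ (λ x y → x + R C (C a) + y) (at-diag z (C a) c) (∑-+ (λ x → at z (C (punchIn a x)) (C a) c) (λ x → ∑[ y ∈ Fin n ] at z (C (punchIn a x)) (C (punchIn a y)) c)) ⟩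
      0ℚ + R C (C a) + (∑[ x ∈ Fin n ] at z (C (punchIn a x)) (C a) c + Q C)
        ≡⟨ cong (λ x → 0ℚ + R C (C a) + (x + Q C)) (∑-cong λ x → at-sym z (C (punchIn a x)) (C a) c) ⟩
      0ℚ + R C (C a) + (R C (C a) + Q C)
        ≡⟨ assoc (R C (C a)) (Q C) ⟩
      R C (C a) + R C (C a) + Q C ∎

∑∑-+ : ∀ {m n} (f g : Fin m → Fin n → ℚ) → ∑[ i ∈ Fin m ] ∑[ j ∈ Fin n ] (f i j + g i j) ≡
  ∑[ i ∈ Fin m ] ∑[ j ∈ Fin n ] f i j + ∑[ i ∈ Fin m ] ∑[ j ∈ Fin n ] g i j
∑∑-+ f g = trans (∑-cong λ i → ∑-+ (f i) (g i)) (∑-+ (λ i → ∑ (f i)) (λ i → ∑ (g i)))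

-- The blobs (true , i) and (false , i) form two sides of p blobs with r points each.
Pos : ℕ → ℕ → Set
Pos p r = Bool × Fin p × Fin r

blob : ∀ {p r} → Bool → Fin p → Fin r → Pos p r
blob s i a = s , i , a

module _ {p r k} (z : Kernel (Pos p r) k) where

  X : Bool → Fin p → Bool → Fin p → Fin k → ℚ
  X s i t j = cross z (blob s i) (blob t j)

  W : Fin k → ℚ
  W c = ∑[ i ∈ Fin p ] (X true i true i c + X false i false i c)

  LR : Fin k → ℚ
  LR c = ∑[ i ∈ Fin p ] ∑[ j ∈ Fin p ] X true i false j c

  Tot : Fin k → ℚ
  Tot c = ∑[ i ∈ Fin p ] ∑[ j ∈ Fin p ] (X true i true j c + X true i false j c + X false i true j c + X false i false j c)

  -- The weight across the sides minus the weight within them. Swapping sides at exactly one of `i`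
  -- and `j` changes its sign, which turns the choice of sides into a quadratic form in signs.
  cut : Fin p → Fin p → Fin k → ℚ
  cut i j c = X true i false j c + X false i true j c - X true i true j c - X false i false j c

  cut-sym : ∀ i j c → cut i j c ≡ cut j i c
  cut-sym i j c = trans
    (cong₂ (λ x y → x + y - X true i true j c - X false i false j c)
      (cross-sym z (blob true i) (blob false j) c) (cross-sym z (blob false i) (blob true j) c))
    (trans (cong₂ (λ x y → X false j true i c + X true j false i c - x - y)
      (cross-sym z (blob true i) (blob true j) c) (cross-sym z (blob false i) (blob false j) c))
      (cong (λ x → x - X true j true i c - X false j false i c) (+-comm (X false j true i c) (X true j false i c))))

  cut-bound : ∀ i j → ‖ cut i j ‖ ≤ 2ℚ * 2ℚ * (ι r * ι r)
  cut-bound i j = begin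
    ‖ cut i j ‖ ≤⟨ ‖‖-- (λ c → X true i false j c + X false i true j c - X true i true j c) (X false i false j) ⟩
    _ ≤⟨ +-monoˡ-≤ _ (≤-trans (‖‖-- (λ c → X true i false j c + X false i true j c) (X true i true j))
                                    (+-monoˡ-≤ _ (‖‖-+ (X true i false j) (X false i true j)))) ⟩
    ‖ X true i false j ‖ + ‖ X false i true j ‖ + ‖ X true i true j ‖ + ‖ X false i false j ‖
                      ≤⟨ +-mono-≤ (+-mono-≤ (+-mono-≤ (B true false) (B false true)) (B true true)) (B false false) ⟩
    ι r * ι r + ι r * ι r + ι r * ι r + ι r * ι r ≡⟨ four (ι r * ι r) ⟩
    2ℚ * 2ℚ * (ι r * ι r) ∎
    where
    B : ∀ s t → ‖ X s i t j ‖ ≤ ι r * ι r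
    B s t = cross-bound z (blob s i) (blob t j)
    four : ∀ x → x + x + x + x ≡ 2ℚ * 2ℚ * x
    four = solve-∀ ℚ-ring

  -- Across plus within is `Tot`, across minus within is the sum of the cuts, and across is `LR`
  -- twice by symmetry.
  4LR : ∀ c → 2ℚ * 2ℚ * LR c ≡ Tot c + ∑[ i ∈ Fin p ] ∑[ j ∈ Fin p ] cut i j c
  4LR c = begin-equality
    2ℚ * 2ℚ * LR c ≡⟨ double (LR c) ⟩
    2ℚ * (LR c + LR c) ≡⟨ cong (λ x → 2ℚ * (LR c + x)) swap ⟨
    2ℚ * (LR c + RL) ≡⟨ cong (2ℚ *_) (∑∑-+ (λ i j → X true i false j c) (λ i j → X false i true j c)) ⟨
    2ℚ * ∑[ i ∈ Fin p ] ∑[ j ∈ Fin p ] (X true i false j c + X false i true j c)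
      ≡⟨ trans (sym (∑-* 2ℚ _)) (∑-cong λ i → sym (∑-* 2ℚ _)) ⟩
    ∑[ i ∈ Fin p ] ∑[ j ∈ Fin p ] (2ℚ * (X true i false j c + X false i true j c))
      ≡⟨ ∑-cong (λ i → ∑-cong λ j → split (X true i true j c) (X true i false j c) (X false i true j c) (X false i false j c)) ⟩
    ∑[ i ∈ Fin p ] ∑[ j ∈ Fin p ] (X true i true j c + X true i false j c + X false i true j c + X false i false j c + cut i j c)
      ≡⟨ ∑∑-+ (λ i j → X true i true j c + X true i false j c + X false i true j c + X false i false j c) (λ i j → cut i j c) ⟩
    Tot c + ∑[ i ∈ Fin p ] ∑[ j ∈ Fin p ] cut i j c ∎
    where
    RL = ∑[ i ∈ Fin p ] ∑[ j ∈ Fin p ] X false i true j c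
    swap : RL ≡ LR c
    swap = trans (∑-comm (λ i j → X false i true j c))
      (∑-cong λ j → ∑-cong λ i → cross-sym z (blob false i) (blob true j) c)
    double : ∀ x → 2ℚ * 2ℚ * x ≡ 2ℚ * (x + x)
    double = solve-∀ ℚ-ring
    split : ∀ x y u v → 2ℚ * (y + u) ≡ x + y + u + v + (y + u - x - v)
    split = solve-∀ ℚ-ring

-- A sign only decides which of the two blobs of index `i` goes to which side; thus the sides keep
-- `p` blobs each, for any signs.
flip : ∀ {p r} → (Fin p → Bool) → Pos p r → Pos p r
flip ε (s , i , a) = (if ε i then s else not s) , i , a

flip-↔ : ∀ {p r} → (Fin p → Bool) → Pos p r ↔ Pos p r
flip-↔ ε = mk↔ₛ′ (flip ε) (flip ε) involutive involutive
  where
  involutive : ∀ u → flip ε (flip ε u) ≡ u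
  involutive (s , i , a) with ε i
  ... | true  = refl
  ... | false = cong (_, i , a) (not-involutive s)

module _ {p r k} (z : Kernel (Pos p r) k) (ε : Fin p → Bool) where

  W-pull-flip : ∀ c → W (pull (flip ε) z) c ≡ W z c
  W-pull-flip c = ∑-cong term
    where
    term : ∀ i → X (pull (flip ε) z) true i true i c + X (pull (flip ε) z) false i false i c ≡ X z true i true i c + X z false i false i c
    term i with ε i
    ... | true  = refl
    ... | false = +-comm (X z false i false i c) (X z true i true i c)

  Tot-flip : ∀ c → Tot (pull (flip ε) z) c ≡ Tot z c
  Tot-flip c = ∑-cong λ i → ∑-cong λ j → term i j
    where
    l₁ : ∀ x y u v → y + x + v + u ≡ x + y + u + v
    l₁ = solve-∀ ℚ-ring
    l₂ : ∀ x y u v → u + v + x + y ≡ x + y + u + v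
    l₂ = solve-∀ ℚ-ring
    l₃ : ∀ x y u v → v + u + y + x ≡ x + y + u + v
    l₃ = solve-∀ ℚ-ring
    term : ∀ i j → let y = pull (flip ε) z in
      X y true i true j c + X y true i false j c + X y false i true j c + X y false i false j c ≡
      X z true i true j c + X z true i false j c + X z false i true j c + X z false i false j c
    term i j with ε i | ε j
    ... | true  | true  = refl
    ... | true  | false = l₁ (X z true i true j c) (X z true i false j c) (X z false i true j c) (X z false i false j c)
    ... | false | true  = l₂ (X z true i true j c) (X z true i false j c) (X z false i true j c) (X z false i false j c)
    ... | false | false = l₃ (X z true i true j c) (X z true i false j c) (X z false i true j c) (X z false i false j c)

  cut-flip : ∀ i j c → cut (pull (flip ε) z) i j c ≡ sgn (ε i) * sgn (ε j) * cut z i j c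
  cut-flip i j c with ε i | ε j
  ... | true  | true  = l₀ (X z true i false j c) (X z false i true j c) (X z true i true j c) (X z false i false j c)
    where
    l₀ : ∀ x y u v → x + y - u - v ≡ 1ℚ * 1ℚ * (x + y - u - v)
    l₀ = solve-∀ ℚ-ring
  ... | true  | false = l₁ (X z true i false j c) (X z false i true j c) (X z true i true j c) (X z false i false j c)
    where
    l₁ : ∀ x y u v → u + v - x - y ≡ 1ℚ * - 1ℚ * (x + y - u - v)
    l₁ = solve-∀ ℚ-ring
  ... | false | true  = l₂ (X z true i false j c) (X z false i true j c) (X z true i true j c) (X z false i false j c)
    where
    l₂ : ∀ x y u v → v + u - y - x ≡ - 1ℚ * 1ℚ * (x + y - u - v)
    l₂ = solve-∀ ℚ-ring
  ... | false | false = l₃ (X z true i false j c) (X z false i true j c) (X z true i true j c) (X z false i false j c)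
    where
    l₃ : ∀ x y u v → y + x - v - u ≡ - 1ℚ * - 1ℚ * (x + y - u - v)
    l₃ = solve-∀ ℚ-ring

  W-flip : ∀ c → W (rename (flip-↔ ε) z) c ≡ W z c
  W-flip c = trans (cong (λ y → W y c) (rename-pull (flip-↔ ε) z)) (W-pull-flip c)

balanced-sides : ∀ {p r k} (z : Kernel (Pos p r) k) → Σ[ ε ∈ (Fin p → Bool) ]
  ‖ (λ c → 2ℚ * 2ℚ * LR (rename (flip-↔ ε) z) c) ‖ ≤ ‖ Tot z ‖ + ι k * (2ℚ * (ι p * (2ℚ * 2ℚ * (ι r * ι r))))
balanced-sides {p} {r} {k} z = ε , (begin
  ‖ (λ c → 2ℚ * 2ℚ * LR (rename (flip-↔ ε) z) c) ‖
    ≡⟨ cong (λ y → ‖ (λ c → 2ℚ * 2ℚ * LR y c) ‖) (rename-pull (flip-↔ ε) z) ⟩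
  ‖ (λ c → 2ℚ * 2ℚ * LR (pull (flip ε) z) c) ‖
    ≡⟨ ‖‖-cong (λ c → trans (4LR (pull (flip ε) z) c) (cong₂ _+_ (Tot-flip z ε c) (∑-cong λ i → ∑-cong λ j → cut-flip z ε i j c))) ⟩
  ‖ (λ c → Tot z c + ∑[ i ∈ Fin p ] ∑[ j ∈ Fin p ] (sgn (ε i) * sgn (ε j) * cut z i j c)) ‖
    ≤⟨ ‖‖-+ (Tot z) (λ c → ∑[ i ∈ Fin p ] ∑[ j ∈ Fin p ] (sgn (ε i) * sgn (ε j) * cut z i j c)) ⟩
  _ ≤⟨ +-monoʳ-≤ ‖ Tot z ‖ (proj₂ found) ⟩
  ‖ Tot z ‖ + ι k * (2ℚ * (ι p * (2ℚ * 2ℚ * (ι r * ι r)))) ∎)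
  where
  found = balancing-signs (cut z) (cut-sym z) (0≤p*q (nonNegative⁻¹ (2ℚ * 2ℚ)) (0≤p*q (0≤ι r) (0≤ι r))) (cut-bound z)
  ε = proj₁ found

-- Simultaneous exchanges between the two sides

choose : ∀ {A B : Set} → Dec A → B → B → B
choose d x y = if does d then x else y

choose-yes : ∀ {A B : Set} (d : Dec A) {x y : B} → A → choose d x y ≡ x
choose-yes (yes _) _ = refl
choose-yes (no ¬a) a = contradiction a ¬a

choose-no : ∀ {A B : Set} (d : Dec A) {x y : B} → ¬ A → choose d x y ≡ y
choose-no (yes a) ¬a = contradiction a ¬a
choose-no (no _)  _  = refl

δ-≡ : ∀ {n} {i j : Fin n} → i ≡ j → δ i j ≡ 1ℚ
δ-≡ {i = i} refl = δ-refl i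

-- Blob (true , i) proposes, via the matching κ (s i), to exchange its point a i
-- with the point b i of its partner on the other side.  The partner accepts only
-- proposals made via the matching that it has chosen itself, so that the accepted
-- exchanges concern disjoint pairs of blobs.
module Exchange {p r m} (κ : Fin m → Permutation′ p) (τ s : Fin p → Fin m) (a b : Fin p → Fin r) where

  partner back : Fin p → Fin p
  partner i = κ (s i) ⟨$⟩ʳ i
  back j    = κ (τ j) ⟨$⟩ˡ j

  partner-back : ∀ j → s (back j) ≡ τ j → partner (back j) ≡ j
  partner-back j eq = trans (cong (λ t → κ t ⟨$⟩ʳ back j) eq) (Permutation.inverseʳ (κ (τ j)))

  back-unique : ∀ i j → s i ≡ τ j → partner i ≡ j → back j ≡ i
  back-unique i j eq refl = trans (cong (λ t → κ t ⟨$⟩ˡ partner i) (sym eq)) (Permutation.inverseˡ (κ (s i)))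

  left? : ∀ i x → Dec (s i ≡ τ (partner i) × x ≡ a i)
  left? i x = (s i Fin.≟ τ (partner i)) ×-dec (x Fin.≟ a i)

  right? : ∀ j y → Dec (s (back j) ≡ τ j × y ≡ b (back j))
  right? j y = (s (back j) Fin.≟ τ j) ×-dec (y Fin.≟ b (back j))

  exchange : Pos p r → Pos p r
  exchange (true  , i , x) = choose (left? i x) (false , partner i , b i) (true , i , x)
  exchange (false , j , y) = choose (right? j y) (true , back j , a (back j)) (false , j , y)

  involutive : ∀ u → exchange (exchange u) ≡ u
  involutive (true , i , x) = by (left? i x)
    where
    by : Dec (s i ≡ τ (partner i) × x ≡ a i) → exchange (exchange (true , i , x)) ≡ (true , i , x)
    by (no ¬p) = trans (cong exchange (choose-no (left? i x) ¬p)) (choose-no (left? i x) ¬p)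
    by (yes p@(eq , refl)) = trans (cong exchange (choose-yes (left? i x) p)) (trans
      (choose-yes (right? (partner i) (b i)) (trans (cong s i≡) eq , cong b (sym i≡)))
      (cong (λ l → true , l , a l) i≡))
      where
      i≡ : back (partner i) ≡ i
      i≡ = back-unique i (partner i) eq refl
  involutive (false , j , y) = by (right? j y)
    where
    by : Dec (s (back j) ≡ τ j × y ≡ b (back j)) → exchange (exchange (false , j , y)) ≡ (false , j , y)
    by (no ¬p) = trans (cong exchange (choose-no (right? j y) ¬p)) (choose-no (right? j y) ¬p)
    by (yes p@(eq , refl)) = trans (cong exchange (choose-yes (right? j y) p)) (trans
      (choose-yes (left? (back j) (a (back j))) (trans eq (cong τ (sym j≡)) , refl))
      (cong (λ l → false , l , b (back j)) j≡))
      where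
      j≡ : partner (back j) ≡ j
      j≡ = partner-back j eq

  exchange-↔ : Pos p r ↔ Pos p r
  exchange-↔ = mk↔ₛ′ exchange exchange involutive involutive

  module _ {k} (z : Kernel (Pos p r) k) (c : Fin k) where

    α β : Fin p → Fin p → ℚ
    α i j = gain z (blob true i) (a i) (false , j , b i) c
    β i j = gain z (blob false j) (b i) (true , i , a i) c

    -- The incidence matrix of the accepted exchanges. `partner` need not be injective before
    -- acceptance, so the gains of the right blobs are moved to the left ones through `M`: its row
    -- `i` lives at `partner i`, its column `j` at `back j`.
    M : Fin p → Fin p → ℚ
    M i j = δ (s i) (τ j) * δ (partner i) j

    χ : Fin p → ℚ
    χ i = δ (s i) (τ (partner i))

    unchanged : ∀ t i → (∀ x → exchange (t , i , x) ≡ (t , i , x)) → X (pull exchange z) t i t i c ≡ X z t i t i c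
    unchanged t i eq = ∑-cong λ x → ∑-cong λ y → cong₂ (λ u v → at z u v c) (eq x) (eq y)

    drop : ∀ x y {q} → q ≡ 0ℚ → x ≡ x + 2ℚ * (q * y)
    drop x y refl = lemma x y
      where
      lemma : ∀ x y → x ≡ x + 2ℚ * (0ℚ * y)
      lemma = solve-∀ ℚ-ring

    scale : ∀ x {q} → q ≡ 1ℚ → x ≡ q * x
    scale x refl = sym (*-identityˡ x)

    left : ∀ i → X (pull exchange z) true i true i c ≡ X z true i true i c + 2ℚ * (χ i * α i (partner i))
    left i = by (s i Fin.≟ τ (partner i))
      where
      by : Dec (s i ≡ τ (partner i)) → X (pull exchange z) true i true i c ≡ X z true i true i c + 2ℚ * (χ i * α i (partner i))
      by (no s≢τ) = trans
        (unchanged true i λ x → choose-no (left? i x) (s≢τ ∘ proj₁))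
        (drop (X z true i true i c) (α i (partner i)) (δ-≢ s≢τ))
      by (yes eq) = trans
        (cross-exchange z (blob true i) (exchange ∘ blob true i) (a i) (λ x x≢a → choose-no (left? i x) (x≢a ∘ proj₂)) c)
        (cong (λ w → X z true i true i c + 2ℚ * w)
          (trans (cong (λ u → gain z (blob true i) (a i) u c) (choose-yes (left? i (a i)) (eq , refl)))
                 (scale (α i (partner i)) (δ-≡ eq))))

    right : ∀ j → X (pull exchange z) false j false j c ≡ X z false j false j c + 2ℚ * (δ (s (back j)) (τ j) * β (back j) j)
    right j = by (s (back j) Fin.≟ τ j)
      where
      by : Dec (s (back j) ≡ τ j) → X (pull exchange z) false j false j c ≡ X z false j false j c + 2ℚ * (δ (s (back j)) (τ j) * β (back j) j)
      by (no s≢τ) = trans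
        (unchanged false j λ y → choose-no (right? j y) (s≢τ ∘ proj₁))
        (drop (X z false j false j c) (β (back j) j) (δ-≢ s≢τ))
      by (yes eq) = trans
        (cross-exchange z (blob false j) (exchange ∘ blob false j) (b (back j)) (λ y y≢b → choose-no (right? j y) (y≢b ∘ proj₂)) c)
        (cong (λ w → X z false j false j c + 2ℚ * w)
          (trans (cong (λ u → gain z (blob false j) (b (back j)) u c) (choose-yes (right? j (b (back j))) (eq , refl)))
                 (scale (β (back j) j) (δ-≡ eq))))

    M-back : ∀ j → ∑[ i ∈ Fin p ] (M i j * β i j) ≡ δ (s (back j)) (τ j) * β (back j) j
    M-back j = trans (∑-single (back j) (λ i i≢ → trans (cong (_* β i j) (vanish i i≢)) (*-zeroˡ (β i j))))
      (cong (_* β (back j) j) at-back)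
      where
      vanish : ∀ i → i ≢ back j → M i j ≡ 0ℚ
      vanish i i≢ with s i Fin.≟ τ j
      ... | no _ = *-zeroˡ (δ (partner i) j)
      ... | yes eq = trans (cong (1ℚ *_) (δ-≢ λ eq′ → i≢ (sym (back-unique i j eq eq′)))) (*-zeroʳ 1ℚ)
      at-back : M (back j) j ≡ δ (s (back j)) (τ j)
      at-back with s (back j) Fin.≟ τ j
      ... | no _ = *-zeroˡ (δ (partner (back j)) j)
      ... | yes eq = trans (cong (λ l → 1ℚ * δ l j) (partner-back j eq)) (cong (1ℚ *_) (δ-refl j))

    M-partner : ∀ i → ∑[ j ∈ Fin p ] (M i j * β i j) ≡ χ i * β i (partner i)
    M-partner i = trans (∑-single (partner i) (λ j j≢ → trans (cong (_* β i j)
        (trans (cong (δ (s i) (τ j) *_) (δ-≢ (j≢ ∘ sym))) (*-zeroʳ (δ (s i) (τ j))))) (*-zeroˡ (β i j))))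
      (cong (_* β i (partner i)) (trans (cong (χ i *_) (δ-refl (partner i))) (*-identityʳ (χ i))))

    -- At most one point of each blob is replaced, so every gain may be computed from the contents
    -- before the round, and the gains add up.
    W-exchange : W (rename exchange-↔ z) c ≡ W z c + 2ℚ * ∑[ i ∈ Fin p ] (χ i * (α i (partner i) + β i (partner i)))
    W-exchange = begin-equality
      W (rename exchange-↔ z) c
        ≡⟨ cong (λ y → W y c) (rename-pull exchange-↔ z) ⟩
      W (pull exchange z) c
        ≡⟨ ∑-cong (λ i → cong₂ _+_ (left i) (right i)) ⟩
      ∑[ i ∈ Fin p ] (xt i + 2ℚ * A i + (xf i + 2ℚ * B i))
        ≡⟨ ∑-cong (λ i → regroup (xt i) (A i) (xf i) (B i)) ⟩
      ∑[ i ∈ Fin p ] (xt i + xf i + 2ℚ * (A i + B i))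
        ≡⟨ trans (∑-+ (λ i → xt i + xf i) (λ i → 2ℚ * (A i + B i))) (cong (W z c +_) (∑-* 2ℚ (λ i → A i + B i))) ⟩
      W z c + 2ℚ * ∑[ i ∈ Fin p ] (A i + B i)
        ≡⟨ cong (λ x → W z c + 2ℚ * x) (∑-+ A B) ⟩
      W z c + 2ℚ * (∑ A + ∑ B)
        ≡⟨ cong (λ x → W z c + 2ℚ * (∑ A + x)) reindex ⟩
      W z c + 2ℚ * (∑ A + ∑[ i ∈ Fin p ] (χ i * β i (partner i)))
        ≡⟨ cong (λ x → W z c + 2ℚ * x) (∑-+ A (λ i → χ i * β i (partner i))) ⟨
      W z c + 2ℚ * ∑[ i ∈ Fin p ] (A i + χ i * β i (partner i))
        ≡⟨ cong (λ x → W z c + 2ℚ * x) (∑-cong λ i → *-distribˡ-+ (χ i) (α i (partner i)) (β i (partner i))) ⟨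
      W z c + 2ℚ * ∑[ i ∈ Fin p ] (χ i * (α i (partner i) + β i (partner i))) ∎
      where
      xt xf A B : Fin p → ℚ
      xt i = X z true i true i c
      xf i = X z false i false i c
      A i = χ i * α i (partner i)
      B j = δ (s (back j)) (τ j) * β (back j) j
      regroup : ∀ x a y b → x + 2ℚ * a + (y + 2ℚ * b) ≡ x + y + 2ℚ * (a + b)
      regroup = solve-∀ ℚ-ring
      reindex : ∑ B ≡ ∑[ i ∈ Fin p ] (χ i * β i (partner i))
      reindex = begin-equality
        ∑ B ≡⟨ ∑-cong M-back ⟨
        ∑[ j ∈ Fin p ] ∑[ i ∈ Fin p ] (M i j * β i j) ≡⟨ ∑-comm (λ j i → M i j * β i j) ⟩
        ∑[ i ∈ Fin p ] ∑[ j ∈ Fin p ] (M i j * β i j) ≡⟨ ∑-cong M-partner ⟩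
        ∑[ i ∈ Fin p ] (χ i * β i (partner i)) ∎

-- Size and average of the gain of an exchange

ρ-antitone : ∀ {m n} → m ℕ.≤ n → ρ n ≤ ρ m
ρ-antitone {m} {n} m≤n = begin
  ρ n ≡⟨ *-identityʳ (ρ n) ⟨
  ρ n * 1ℚ ≡⟨ cong (ρ n *_) (ι*ρ m) ⟨
  ρ n * (ι (suc m) * ρ m) ≤⟨ *-monoˡ (ρ n) (0≤ρ n) (*-monoʳ (ρ m) (0≤ρ m) (ι-mono (ℕ.s≤s m≤n))) ⟩
  ρ n * (ι (suc n) * ρ m) ≡⟨ *-assoc (ρ n) (ι (suc n)) (ρ m) ⟨
  ρ n * ι (suc n) * ρ m ≡⟨ cong (_* ρ m) (ρ*ι n) ⟩
  1ℚ * ρ m ≡⟨ *-identityˡ (ρ m) ⟩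
  ρ m ∎

ρ≤1 : ∀ n → ρ n ≤ 1ℚ
ρ≤1 n = ≤-trans (ρ-antitone {0} {n} ℕ.z≤n) (≤-reflexive (trans (sym (*-identityˡ (ρ 0))) (ι*ρ 0)))

module _ {P k} (z : Kernel P k) where

  gain-bound : ∀ {n} (A : Fin n → P) a w → ‖ gain z A a w ‖ ≤ ι n + ι n + 1ℚ
  gain-bound A a w = ≤-trans (‖‖-- (λ c → row z w A c - row z (A a) A c) (at z w (A a)))
    (+-mono-≤ (≤-trans (‖‖-- (row z w A) (row z (A a) A)) (+-mono-≤ (row-bound z w A) (row-bound z (A a) A))) (at-bound z w (A a)))

  ∑-gain : ∀ {n} (A B : Fin n → P) c → ∑[ a ∈ Fin n ] ∑[ b ∈ Fin n ] gain z A a (B b) c ≡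
    ι n * cross z B A c - ι n * cross z A A c - cross z B A c
  ∑-gain {n} A B c = begin-equality
    ∑[ a ∈ Fin n ] ∑[ b ∈ Fin n ] gain z A a (B b) c
      ≡⟨ ∑-cong (λ a → trans (∑-- (λ b → row z (B b) A c - row z (A a) A c) (λ b → at z (B b) (A a) c))
           (cong (_- ∑[ b ∈ Fin n ] at z (B b) (A a) c) (trans (∑-- (λ b → row z (B b) A c) (λ _ → row z (A a) A c))
             (cong (_-_ (cross z B A c)) (∑-Fin-const n (row z (A a) A c)))))) ⟩
    ∑[ a ∈ Fin n ] (cross z B A c - ι n * row z (A a) A c - ∑[ b ∈ Fin n ] at z (B b) (A a) c)
      ≡⟨ ∑-- (λ a → cross z B A c - ι n * row z (A a) A c) (λ a → ∑[ b ∈ Fin n ] at z (B b) (A a) c) ⟩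
    ∑[ a ∈ Fin n ] (cross z B A c - ι n * row z (A a) A c) - ∑[ a ∈ Fin n ] ∑[ b ∈ Fin n ] at z (B b) (A a) c
      ≡⟨ cong₂ _-_ (trans (∑-- (λ _ → cross z B A c) (λ a → ι n * row z (A a) A c))
           (cong₂ _-_ (∑-Fin-const n (cross z B A c)) (∑-* (ι n) (λ a → row z (A a) A c))))
           (∑-comm (λ a b → at z (B b) (A a) c)) ⟩
    ι n * cross z B A c - ι n * cross z A A c - cross z B A c ∎

module _ {p r k} (z : Kernel (Pos p r) k) where

  pairGain : Fin p → Fin p → Fin r → Fin r → Fin k → ℚ
  pairGain i j a b c = gain z (blob true i) a (false , j , b) c + gain z (blob false j) b (true , i , a) c

  totalGain : Fin p → Fin p → Fin k → ℚ
  totalGain i j c = ∑[ a ∈ Fin r ] ∑[ b ∈ Fin r ] pairGain i j a b c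

  -- The negative drift that makes exchanging worthwhile: a point entering a blob loses on average
  -- the internal weight of the point it replaces. The weight across comes with `r - 1` for each
  -- blob instead of `r`, because the pair of exchanged points is excluded.
  totalGain≡ : ∀ i j c → totalGain i j c ≡ 2ℚ * (ι r - 1ℚ) * X z true i false j c - ι r * (X z true i true i c + X z false j false j c)
  totalGain≡ i j c = begin-equality
    totalGain i j c
      ≡⟨ trans (∑-cong λ a → ∑-+ (λ b → gain z (blob true i) a (false , j , b) c) (λ b → gain z (blob false j) b (true , i , a) c))
               (∑-+ (λ a → ∑[ b ∈ Fin r ] gain z (blob true i) a (false , j , b) c) (λ a → ∑[ b ∈ Fin r ] gain z (blob false j) b (true , i , a) c)) ⟩
    ∑[ a ∈ Fin r ] ∑[ b ∈ Fin r ] gain z (blob true i) a (false , j , b) c + ∑[ a ∈ Fin r ] ∑[ b ∈ Fin r ] gain z (blob false j) b (true , i , a) c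
      ≡⟨ cong₂ _+_ (∑-gain z (blob true i) (blob false j) c)
           (trans (∑-comm (λ a b → gain z (blob false j) b (true , i , a) c)) (∑-gain z (blob false j) (blob true i) c)) ⟩
    ι r * X z false j true i c - ι r * X z true i true i c - X z false j true i c + (ι r * x - ι r * X z false j false j c - x)
      ≡⟨ cong (λ y → ι r * y - ι r * X z true i true i c - y + (ι r * x - ι r * X z false j false j c - x)) (cross-sym z (blob false j) (blob true i) c) ⟩
    ι r * x - ι r * X z true i true i c - x + (ι r * x - ι r * X z false j false j c - x)
      ≡⟨ lemma (ι r) x (X z true i true i c) (X z false j false j c) ⟩
    2ℚ * (ι r - 1ℚ) * x - ι r * (X z true i true i c + X z false j false j c) ∎
    where
    x = X z true i false j c
    lemma : ∀ r x u v → r * x - r * u - x + (r * x - r * v - x) ≡ 2ℚ * (r - 1ℚ) * x - r * (u + v)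
    lemma = solve-∀ ℚ-ring

  ∑totalGain : ∀ c → ∑[ i ∈ Fin p ] ∑[ j ∈ Fin p ] totalGain i j c ≡ 2ℚ * (ι r - 1ℚ) * LR z c - ι r * (ι p * W z c)
  ∑totalGain c = begin-equality
    ∑[ i ∈ Fin p ] ∑[ j ∈ Fin p ] totalGain i j c
      ≡⟨ ∑-cong (λ i → trans (∑-cong λ j → totalGain≡ i j c) (trans (∑-- (λ j → q * X z true i false j c) (λ j → ι r * (t i + f j)))
           (cong₂ _-_ (∑-* q (λ j → X z true i false j c)) (∑-* (ι r) (λ j → t i + f j))))) ⟩
    ∑[ i ∈ Fin p ] (q * ∑[ j ∈ Fin p ] X z true i false j c - ι r * ∑[ j ∈ Fin p ] (t i + f j))
      ≡⟨ trans (∑-- (λ i → q * ∑[ j ∈ Fin p ] X z true i false j c) (λ i → ι r * ∑[ j ∈ Fin p ] (t i + f j)))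
           (cong₂ _-_ (∑-* q (λ i → ∑[ j ∈ Fin p ] X z true i false j c)) (∑-* (ι r) (λ i → ∑[ j ∈ Fin p ] (t i + f j)))) ⟩
    q * LR z c - ι r * ∑[ i ∈ Fin p ] ∑[ j ∈ Fin p ] (t i + f j)
      ≡⟨ cong (λ x → q * LR z c - ι r * x) (trans (∑-cong λ i → trans (∑-+ (λ _ → t i) f) (cong (_+ ∑ f) (∑-Fin-const p (t i))))
           (trans (∑-+ (λ i → ι p * t i) (λ _ → ∑ f)) (cong₂ _+_ (∑-* (ι p) t) (∑-Fin-const p (∑ f))))) ⟩
    q * LR z c - ι r * (ι p * ∑ t + ι p * ∑ f)
      ≡⟨ cong (λ x → q * LR z c - ι r * x) (trans (sym (*-distribˡ-+ (ι p) (∑ t) (∑ f))) (cong (ι p *_) (sym (∑-+ t f)))) ⟩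
    q * LR z c - ι r * (ι p * W z c) ∎
    where
    q = 2ℚ * (ι r - 1ℚ)
    t f : Fin p → ℚ
    t i = X z true i true i c
    f i = X z false i false i c

-- An exchange has two gains of norm at most `2 r + 1` each, and `4 r + 2 ≤ 6 r`.
6ℚ : ℚ
6ℚ = ι 6

module _ {p r′ k} (z : Kernel (Pos p (suc r′)) k) where

  private
    r = suc r′

  pairGain-bound : ∀ i j a b → ‖ pairGain z i j a b ‖ ≤ 6ℚ * ι r
  pairGain-bound i j a b = begin
    ‖ pairGain z i j a b ‖ ≤⟨ ‖‖-+ (gain z (blob true i) a (false , j , b)) (gain z (blob false j) b (true , i , a)) ⟩
    _ ≤⟨ +-mono-≤ (gain-bound z (blob true i) a _) (gain-bound z (blob false j) b _) ⟩
    ι r + ι r + 1ℚ + (ι r + ι r + 1ℚ) ≤⟨ ≤-by (2ℚ * ι r′) (0≤p*q (0≤p+q 0≤1 0≤1) (0≤ι r′)) (lemma (ι r′)) ⟩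
    6ℚ * ι r ∎
    where
    lemma : ∀ x → 6ℚ * (1ℚ + x) ≡ 1ℚ + x + (1ℚ + x) + 1ℚ + (1ℚ + x + (1ℚ + x) + 1ℚ) + 2ℚ * x
    lemma = solve-∀ ℚ-ring

  totalGain-bound : ∀ i j → ‖ totalGain z i j ‖ ≤ ι r * (ι r * (6ℚ * ι r))
  totalGain-bound i j = ≤-trans (‖‖-∑ (λ a c → ∑[ b ∈ Fin r ] pairGain z i j a b c))
    (∑≤ _ λ a → ≤-trans (‖‖-∑ (λ b → pairGain z i j a b)) (∑≤ _ λ b → pairGain-bound i j a b))

-- One derandomised round of exchanges

diameter : ∀ {k B} (v w : Fin k → ℚ) → ‖ v ‖ ≤ B → ‖ w ‖ ≤ B → ‖ (λ c → v c - w c) ‖ ≤ 2ℚ * B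
diameter {B = B} v w v≤ w≤ = ≤-trans (‖‖-- v w) (≤-trans (+-mono-≤ v≤ w≤) (≤-reflexive (lemma B)))
  where
  lemma : ∀ x → x + x ≡ 2ℚ * x
  lemma = solve-∀ ℚ-ring

-- A sparse convex combination of perfect matchings between the two sides that
-- behaves like the uniform distribution on all pairs.
record Matchings (p′ k : ℕ) (v : Fin (suc p′) → Fin (suc p′) → Fin k → ℚ) : Set where
  field
    m′      : ℕ
    m′≤k    : m′ ℕ.≤ k
    κ       : Fin (suc m′) → Permutation′ (suc p′)
    weight  : Fin (suc m′) → ℚ
    0≤weight : ∀ t → 0ℚ ≤ weight t
    ∑weight : ∑ weight ≡ 1ℚ
    mean    : ∀ c → ∑[ t ∈ _ ] (weight t * ∑[ i ∈ _ ] v i (κ t ⟨$⟩ʳ i) c) ≡ ρ p′ * ∑[ i ∈ _ ] ∑[ j ∈ _ ] v i j c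

opaque
  matchings : ∀ {p′ k} v → Matchings p′ k v
  matchings {p′} {k} v = from (caratheodory prob 0≤prob a)
    where
    p : ℕ
    p = suc p′
    val : Code p → Fin k → ℚ
    val c x = ∑[ i ∈ Fin p ] v i (act c ⟨$⟩ʳ i) x
    a : Code p → Fin (suc k) → ℚ
    -- The constant coordinate keeps the total weight 1; it accounts for the one matching beyond
    -- `k`.
    a c zero    = 1ℚ
    a c (suc x) = val c x
    from : Sparse prob a → Matchings p′ k v
    from record { count = zero ; weight = w ; mean = eq ; point = s } = contradiction
      (trans (sym (trans (eq zero) (𝔼-const p 1ℚ))) (∑-Fin-zero (λ j → w j * a (s j) zero))) 1≢0
    from record { count = suc m′ ; count≤d = ℕ.s≤s m′≤k ; point = s ; weight = w ; 0≤weight = 0≤w ; mean = eq } = record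
      { m′ = m′ ; m′≤k = m′≤k ; κ = act ∘ s ; weight = w ; 0≤weight = 0≤w
      ; ∑weight = trans (∑-cong λ j → sym (*-identityʳ (w j))) (trans (eq zero) (𝔼-const p 1ℚ))
      ; mean = λ c → trans (eq (suc c)) (mean c) }
      where
      mean : ∀ c → 𝔼 (λ d → val d c) ≡ ρ p′ * ∑[ i ∈ _ ] ∑[ j ∈ _ ] v i j c
      mean c = begin-equality
        ∑[ d ∈ Code p ] (prob d * val d c) ≡⟨ ∑-cong (λ d → ∑-* (prob d) (λ i → v i (act d ⟨$⟩ʳ i) c)) ⟨
        ∑[ d ∈ Code p ] ∑[ i ∈ Fin p ] (prob d * v i (act d ⟨$⟩ʳ i) c) ≡⟨ ∑-comm (λ d i → prob d * v i (act d ⟨$⟩ʳ i) c) ⟩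
        ∑[ i ∈ Fin p ] 𝔼 (λ d → v i (act d ⟨$⟩ʳ i) c) ≡⟨ ∑-cong (λ i → 𝔼-point i (λ j → v i j c)) ⟩
        ∑[ i ∈ Fin p ] (ρ p′ * ∑[ j ∈ _ ] v i j c) ≡⟨ ∑-* (ρ p′) (λ i → ∑[ j ∈ _ ] v i j c) ⟩
        ρ p′ * ∑[ i ∈ _ ] ∑[ j ∈ _ ] v i j c ∎

∑-perm : ∀ {p} (π : Permutation′ p) (f : Fin p → Fin p → ℚ) → ∑[ i ∈ Fin p ] f i (π ⟨$⟩ʳ i) ≡ ∑[ j ∈ Fin p ] f (π ⟨$⟩ˡ j) j
∑-perm π f = sym (trans (∑-↔ π (λ j → f (π ⟨$⟩ˡ j) j))
  (∑-cong λ i → cong (λ l → f l (π ⟨$⟩ʳ i)) (Permutation.inverseˡ π)))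

module Round {p′ r″ k} (z : Kernel (Pos (suc p′) (suc (suc r″))) k) where

  p r′ r : ℕ
  p  = suc p′
  r′ = suc r″
  r  = suc r′

  open Matchings (matchings (totalGain z))

  m : ℕ
  m = suc m′

  u₁ : Fin p → Fin m → Fin k → ℚ
  u₁ j t = totalGain z (κ t ⟨$⟩ˡ j) j

  BV BG : ℚ
  BV = ι r * (ι r * (6ℚ * ι r))
  BG = 6ℚ * ι r

  0≤BG : 0ℚ ≤ BG
  0≤BG = 0≤p*q (0≤ι 6) (0≤ι r)

  0≤BV : 0ℚ ≤ BV
  0≤BV = 0≤p*q (0≤ι r) (0≤p*q (0≤ι r) 0≤BG)

  0≤2 : 0ℚ ≤ 2ℚ
  0≤2 = 0≤p+q 0≤1 0≤1

  -- The right blobs decide first. The value of a decision is the gain summed over all `r * r` pairs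
  -- of points, as the points are chosen only in the second stage.
  first = select {O = Fin m} (λ _ → weight) (λ _ → 0≤weight) (λ _ → ∑weight) u₁ (0≤p*q 0≤2 0≤BV)
    (λ j t t′ → diameter (u₁ j t) (u₁ j t′) (totalGain-bound z (κ t ⟨$⟩ˡ j) j) (totalGain-bound z (κ t′ ⟨$⟩ˡ j) j))

  τ : Fin p → Fin m
  τ = proj₁ first

  VB : Fin k → ℚ
  VB c = ∑[ j ∈ Fin p ] u₁ j (τ j) c

  eB : Fin k → ℚ
  eB c = VB c - ∑[ j ∈ Fin p ] ∑[ t ∈ Fin m ] (weight t * u₁ j t c)

  V̄ : ∀ c → ∑[ j ∈ Fin p ] ∑[ t ∈ Fin m ] (weight t * u₁ j t c) ≡ ρ p′ * ∑[ i ∈ Fin p ] ∑[ j ∈ Fin p ] totalGain z i j c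
  V̄ c = begin-equality
    ∑[ j ∈ Fin p ] ∑[ t ∈ Fin m ] (weight t * u₁ j t c) ≡⟨ ∑-comm (λ j t → weight t * u₁ j t c) ⟩
    ∑[ t ∈ Fin m ] ∑[ j ∈ Fin p ] (weight t * u₁ j t c) ≡⟨ ∑-cong (λ t → trans (∑-* (weight t) (λ j → u₁ j t c)) (cong (weight t *_) (sym (∑-perm (κ t) (λ i j → totalGain z i j c))))) ⟩
    ∑[ t ∈ Fin m ] (weight t * ∑[ i ∈ Fin p ] totalGain z i (κ t ⟨$⟩ʳ i) c) ≡⟨ mean c ⟩
    ρ p′ * ∑[ i ∈ Fin p ] ∑[ j ∈ Fin p ] totalGain z i j c ∎

  Option : Set
  Option = Fin m × (Fin r × Fin r)

  -- With `τ` fixed, the effect of the proposal of `i` does not depend on the other proposals, as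
  -- `select` requires. A rejected proposal has the value zero.
  u₂ : Fin p → Option → Fin k → ℚ
  u₂ i (t , a , b) c = δ t (τ (κ t ⟨$⟩ʳ i)) * pairGain z i (κ t ⟨$⟩ʳ i) a b c

  -- Uniform on the options, because the weights of the matchings are already spent on `τ`: each
  -- accepted pair is then proposed with the same probability, and the mean gain is a multiple of
  -- `VB`.
  ω : ℚ
  ω = ρ m′ * (ρ r′ * ρ r′)

  ∑-Option : (f : Option → ℚ) → ∑ f ≡ ∑[ t ∈ Fin m ] ∑[ a ∈ Fin r ] ∑[ b ∈ Fin r ] f (t , a , b)
  ∑-Option f = trans (∑-× f) (∑-cong λ t → ∑-× (λ x → f (t , x)))

  ∑ω≡1 : ∑[ o ∈ Option ] ω ≡ 1ℚ
  ∑ω≡1 = begin-equality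
    ∑[ o ∈ Option ] ω ≡⟨ ∑-Option (λ _ → ω) ⟩
    ∑[ t ∈ Fin m ] ∑[ a ∈ Fin r ] ∑[ b ∈ Fin r ] ω
      ≡⟨ trans (∑-Fin-const m _) (cong (ι m *_) (trans (∑-Fin-const r _) (cong (ι r *_) (∑-Fin-const r ω)))) ⟩
    ι m * (ι r * (ι r * ω)) ≡⟨ lemma (ι m) (ι r) (ρ m′) (ρ r′) ⟩
    ι m * ρ m′ * (ι r * ρ r′ * (ι r * ρ r′)) ≡⟨ cong₂ (λ x y → x * (y * y)) (ι*ρ m′) (ι*ρ r′) ⟩
    1ℚ ∎
    where
    lemma : ∀ m r x y → m * (r * (r * (x * (y * y)))) ≡ m * x * (r * y * (r * y))
    lemma = solve-∀ ℚ-ring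

  0≤ω : 0ℚ ≤ ω
  0≤ω = 0≤p*q (0≤ρ m′) (0≤p*q (0≤ρ r′) (0≤ρ r′))

  δ≤1 : ∀ {n} (i j : Fin n) → δ i j ≤ 1ℚ
  δ≤1 i j = ≤-trans (term≤∑ {f = δ i} (0≤δ i) j)
    (≤-reflexive (trans (∑-cong λ l → sym (*-identityʳ (δ i l))) (∑-δˡ i (λ _ → 1ℚ))))

  u₂-bound : ∀ i o → ‖ u₂ i o ‖ ≤ BG
  u₂-bound i (t , a , b) = begin
    ‖ u₂ i (t , a , b) ‖ ≡⟨ ‖‖-* (0≤δ t (τ (κ t ⟨$⟩ʳ i))) (pairGain z i (κ t ⟨$⟩ʳ i) a b) ⟩
    δ t (τ (κ t ⟨$⟩ʳ i)) * ‖ pairGain z i (κ t ⟨$⟩ʳ i) a b ‖ ≤⟨ *-mono 0≤1 (0≤‖‖ (pairGain z i (κ t ⟨$⟩ʳ i) a b)) (δ≤1 t (τ (κ t ⟨$⟩ʳ i))) (pairGain-bound z i (κ t ⟨$⟩ʳ i) a b) ⟩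
    1ℚ * BG ≡⟨ *-identityˡ BG ⟩
    BG ∎

  second = select {O = Option} (λ _ _ → ω) (λ _ _ → 0≤ω) (λ _ → ∑ω≡1) u₂ (0≤p*q 0≤2 0≤BG)
    (λ i o o′ → diameter (u₂ i o) (u₂ i o′) (u₂-bound i o) (u₂-bound i o′))

  choice : Fin p → Option
  choice = proj₁ second

  U : Fin k → ℚ
  U c = ∑[ i ∈ Fin p ] u₂ i (choice i) c

  eC : Fin k → ℚ
  eC c = U c - ∑[ i ∈ Fin p ] ∑[ o ∈ Option ] (ω * u₂ i o c)

  χ : Fin m → Fin p → ℚ
  χ t j = δ t (τ j)

  ∑u₂ : ∀ i c → ∑[ o ∈ Option ] u₂ i o c ≡ ∑[ t ∈ Fin m ] (χ t (κ t ⟨$⟩ʳ i) * totalGain z i (κ t ⟨$⟩ʳ i) c)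
  ∑u₂ i c = trans (∑-Option (λ o → u₂ i o c)) (∑-cong inner)
    where
    inner : ∀ t → ∑[ a ∈ Fin r ] ∑[ b ∈ Fin r ] u₂ i (t , a , b) c ≡ χ t (κ t ⟨$⟩ʳ i) * totalGain z i (κ t ⟨$⟩ʳ i) c
    inner t = begin-equality
      ∑[ a ∈ Fin r ] ∑[ b ∈ Fin r ] (q * pairGain z i j a b c) ≡⟨ ∑-cong (λ a → ∑-* q (λ b → pairGain z i j a b c)) ⟩
      ∑[ a ∈ Fin r ] (q * ∑[ b ∈ Fin r ] pairGain z i j a b c) ≡⟨ ∑-* q (λ a → ∑[ b ∈ Fin r ] pairGain z i j a b c) ⟩
      q * totalGain z i j c ∎
      where
      j : Fin p
      j = κ t ⟨$⟩ʳ i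
      q : ℚ
      q = χ t j

  accepted : ∀ j c → ∑[ t ∈ Fin m ] (χ t j * u₁ j t c) ≡ u₁ j (τ j) c
  accepted j c = begin-equality
    ∑[ t ∈ Fin m ] (χ t j * u₁ j t c) ≡⟨ ∑-single (τ j) (λ t t≢τ → trans (cong (_* u₁ j t c) (δ-≢ t≢τ)) (*-zeroˡ (u₁ j t c))) ⟩
    χ (τ j) j * u₁ j (τ j) c ≡⟨ cong (_* u₁ j (τ j) c) (δ-refl (τ j)) ⟩
    1ℚ * u₁ j (τ j) c ≡⟨ *-identityˡ (u₁ j (τ j) c) ⟩
    u₁ j (τ j) c ∎

  -- Read from the right side: blob `j` accepts only the matching `τ j`, which joins it to exactly
  -- one left blob, so one term for each `j` remains.
  Ū : ∀ c → ∑[ i ∈ Fin p ] ∑[ o ∈ Option ] (ω * u₂ i o c) ≡ ω * VB c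
  Ū c = trans pull-out (cong (ω *_) reindex)
    where
    pull-out : ∑[ i ∈ Fin p ] ∑[ o ∈ Option ] (ω * u₂ i o c) ≡ ω * ∑[ i ∈ Fin p ] ∑[ o ∈ Option ] u₂ i o c
    pull-out = trans (∑-cong (λ i → ∑-* ω (λ o → u₂ i o c))) (∑-* ω (λ i → ∑[ o ∈ Option ] u₂ i o c))
    reindex : ∑[ i ∈ Fin p ] ∑[ o ∈ Option ] u₂ i o c ≡ VB c
    reindex = begin-equality
      ∑[ i ∈ Fin p ] ∑[ o ∈ Option ] u₂ i o c ≡⟨ ∑-cong (λ i → ∑u₂ i c) ⟩
      ∑[ i ∈ Fin p ] ∑[ t ∈ Fin m ] (χ t (κ t ⟨$⟩ʳ i) * totalGain z i (κ t ⟨$⟩ʳ i) c) ≡⟨ ∑-comm (λ i t → χ t (κ t ⟨$⟩ʳ i) * totalGain z i (κ t ⟨$⟩ʳ i) c) ⟩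
      ∑[ t ∈ Fin m ] ∑[ i ∈ Fin p ] (χ t (κ t ⟨$⟩ʳ i) * totalGain z i (κ t ⟨$⟩ʳ i) c) ≡⟨ ∑-cong (λ t → ∑-perm (κ t) (λ i j → χ t j * totalGain z i j c)) ⟩
      ∑[ t ∈ Fin m ] ∑[ j ∈ Fin p ] (χ t j * u₁ j t c) ≡⟨ ∑-comm (λ t j → χ t j * u₁ j t c) ⟩
      ∑[ j ∈ Fin p ] ∑[ t ∈ Fin m ] (χ t j * u₁ j t c) ≡⟨ ∑-cong (λ j → accepted j c) ⟩
      VB c ∎

  s : Fin p → Fin m
  s i = proj₁ (choice i)
  a b : Fin p → Fin r
  a i = proj₁ (proj₂ (choice i))
  b i = proj₂ (proj₂ (choice i))

  open Exchange {p} {r} {m} κ τ s a b using (exchange-↔; W-exchange) public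

  error : Fin k → ℚ
  error c = 2ℚ * eC c + (2ℚ * ω * eB c + ω * ρ p′ * (ι r - 1ℚ) * (2ℚ * 2ℚ * LR z c))

  -- This is `2ℚ * ω * ι r`, that is `2 / (m r)`: the 2 comes from `W-exchange`, and `r` is the
  -- coefficient of the internal weights in `totalGain≡`.
  θ : ℚ
  θ = 2ℚ * (ρ m′ * ρ r′)

  W′ : ∀ c → W (rename exchange-↔ z) c ≡ (1ℚ - θ) * W z c + error c
  W′ c = begin-equality
    W (rename exchange-↔ z) c ≡⟨ W-exchange z c ⟩
    w + 2ℚ * U c ≡⟨ cong (λ x → w + 2ℚ * x) (shift (U c) Ū′) ⟩
    w + 2ℚ * (eC c + Ū′) ≡⟨ cong (λ x → w + 2ℚ * (eC c + x)) (Ū c) ⟩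
    w + 2ℚ * (eC c + ω * VB c) ≡⟨ cong (λ x → w + 2ℚ * (eC c + ω * x)) (shift (VB c) V̄′) ⟩
    w + 2ℚ * (eC c + ω * (eB c + V̄′)) ≡⟨ cong (λ x → w + 2ℚ * (eC c + ω * (eB c + x))) (trans (V̄ c) (cong (ρ p′ *_) (∑totalGain z c))) ⟩
    w + 2ℚ * (eC c + ω * (eB c + ρ p′ * (2ℚ * (ι r - 1ℚ) * LR z c - ι r * (ι p * w))))
      ≡⟨ rearrange w (eC c) (ρ m′) (ρ r′) (eB c) (ρ p′) (ι r) (LR z c) (ι p) ⟩
    (1ℚ - 2ℚ * (ρ m′ * (ρ r′ * (ρ r′ * ι r))) * (ρ p′ * ι p)) * w + error c
      ≡⟨ cong₂ (λ x y → (1ℚ - 2ℚ * (ρ m′ * (ρ r′ * x)) * y) * w + error c) (ρ*ι r′) (ρ*ι p′) ⟩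
    (1ℚ - 2ℚ * (ρ m′ * (ρ r′ * 1ℚ)) * 1ℚ) * w + error c
      ≡⟨ cong (λ x → (1ℚ - x) * w + error c) (ones (ρ m′) (ρ r′)) ⟩
    (1ℚ - θ) * w + error c ∎
    where
    w = W z c
    Ū′ = ∑[ i ∈ Fin p ] ∑[ o ∈ Option ] (ω * u₂ i o c)
    V̄′ = ∑[ j ∈ Fin p ] ∑[ t ∈ Fin m ] (weight t * u₁ j t c)
    shift : ∀ x y → x ≡ x - y + y
    shift = solve-∀ ℚ-ring
    ones : ∀ x y → 2ℚ * (x * (y * 1ℚ)) * 1ℚ ≡ 2ℚ * (x * y)
    ones = solve-∀ ℚ-ring
    rearrange : ∀ w eC x y eB q r l p →
      w + 2ℚ * (eC + x * (y * y) * (eB + q * (2ℚ * (r - 1ℚ) * l - r * (p * w)))) ≡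
      (1ℚ - 2ℚ * (x * (y * (y * r))) * (q * p)) * w + (2ℚ * eC + (2ℚ * (x * (y * y)) * eB + x * (y * y) * q * (r - 1ℚ) * (2ℚ * 2ℚ * l)))
    rearrange = solve-∀ ℚ-ring

  -- The proposals cost `24 k r`, the choices `τ` cost `24 k r / m`, and the weight between the
  -- sides costs `16 k (r - 1) / m`; together at most `64 k r`.
  error-bound : ‖ (λ c → 2ℚ * 2ℚ * LR z c) ‖ ≤ ι 16 * (ι k * (ι p * (ι r * ι r))) → ‖ error ‖ ≤ ι 64 * (ι k * ι r)
  error-bound LR≤ = begin
    ‖ error ‖
      ≤⟨ ‖‖-+ (λ c → 2ℚ * eC c) (λ c → 2ℚ * ω * eB c + ω * ρ p′ * (ι r - 1ℚ) * (2ℚ * 2ℚ * LR z c)) ⟩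
    _ ≤⟨ +-mono-≤ (≤-reflexive (‖‖-* 0≤2 eC))
           (≤-trans (‖‖-+ (λ c → 2ℚ * ω * eB c) (λ c → ω * ρ p′ * (ι r - 1ℚ) * (2ℚ * 2ℚ * LR z c)))
             (+-mono-≤ (≤-reflexive (‖‖-* (0≤p*q 0≤2 0≤ω) eB)) (≤-reflexive (‖‖-* 0≤coef (λ c → 2ℚ * 2ℚ * LR z c))))) ⟩
    2ℚ * ‖ eC ‖ + (2ℚ * ω * ‖ eB ‖ + ω * ρ p′ * (ι r - 1ℚ) * ‖ (λ c → 2ℚ * 2ℚ * LR z c) ‖)
      ≤⟨ +-mono-≤ (*-monoˡ 2ℚ 0≤2 (proj₂ second)) (+-mono-≤ (*-monoˡ (2ℚ * ω) (0≤p*q 0≤2 0≤ω) (proj₂ first)) (*-monoˡ _ 0≤coef LR≤)) ⟩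
    2ℚ * (ι k * (2ℚ * BG)) + (2ℚ * ω * (ι k * (2ℚ * BV)) + ω * ρ p′ * (ι r - 1ℚ) * (ι 16 * (ι k * (ι p * (ι r * ι r)))))
      ≡⟨ collect (ι k) (ι r) (ρ m′) (ρ r′) (ρ p′) (ι p) ⟩
    ι 24 * (ι k * ι r) + ρ m′ * (ρ r′ * ι r * (ρ r′ * ι r)) * (ι 24 * (ι k * ι r) + ρ p′ * ι p * (ι r - 1ℚ) * (ι 16 * ι k))
      ≡⟨ cong₂ (λ x y → ι 24 * (ι k * ι r) + ρ m′ * (x * x) * (ι 24 * (ι k * ι r) + y * (ι r - 1ℚ) * (ι 16 * ι k))) (ρ*ι r′) (ρ*ι p′) ⟩
    ι 24 * (ι k * ι r) + ρ m′ * (1ℚ * 1ℚ) * (ι 24 * (ι k * ι r) + 1ℚ * (ι r - 1ℚ) * (ι 16 * ι k))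
      ≤⟨ +-monoʳ-≤ (ι 24 * (ι k * ι r)) (*-mono 0≤1 0≤rest (≤-trans (≤-reflexive (*-identityʳ (ρ m′))) (ρ≤1 m′)) ≤-refl) ⟩
    ι 24 * (ι k * ι r) + 1ℚ * (ι 24 * (ι k * ι r) + 1ℚ * (ι r - 1ℚ) * (ι 16 * ι k))
      ≤⟨ ≤-by (ι 16 * ι k) (0≤p*q (0≤ι 16) (0≤ι k)) (finish (ι k) (ι r)) ⟩
    ι 64 * (ι k * ι r) ∎
    where
    0≤r-1 : 0ℚ ≤ ι r - 1ℚ
    0≤r-1 = 0≤q-p (1≤ι r′)
    0≤coef : 0ℚ ≤ ω * ρ p′ * (ι r - 1ℚ)
    0≤coef = 0≤p*q (0≤p*q 0≤ω (0≤ρ p′)) 0≤r-1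
    0≤rest : 0ℚ ≤ ι 24 * (ι k * ι r) + 1ℚ * (ι r - 1ℚ) * (ι 16 * ι k)
    0≤rest = 0≤p+q (0≤p*q (0≤ι 24) (0≤p*q (0≤ι k) (0≤ι r))) (0≤p*q (0≤p*q 0≤1 0≤r-1) (0≤p*q (0≤ι 16) (0≤ι k)))
    collect : ∀ k r x y q p → 2ℚ * (k * (2ℚ * (6ℚ * r))) + (2ℚ * (x * (y * y)) * (k * (2ℚ * (r * (r * (6ℚ * r))))) + x * (y * y) * q * (r - 1ℚ) * (ι 16 * (k * (p * (r * r))))) ≡
      ι 24 * (k * r) + x * (y * r * (y * r)) * (ι 24 * (k * r) + q * p * (r - 1ℚ) * (ι 16 * k))
    collect = solve-∀ ℚ-ring
    finish : ∀ k r → ι 64 * (k * r) ≡ ι 24 * (k * r) + 1ℚ * (ι 24 * (k * r) + 1ℚ * (r - 1ℚ) * (ι 16 * k)) + ι 16 * k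
    finish = solve-∀ ℚ-ring

  -- This uses `r ≥ 2`: the factor `ρ r′` is at most one half.
  θ≤1 : θ ≤ 1ℚ
  θ≤1 = begin
    2ℚ * (ρ m′ * ρ r′) ≤⟨ *-monoˡ 2ℚ 0≤2 (*-mono 0≤1 (0≤ρ r′) (ρ≤1 m′) (ρ-antitone {1} {r′} (ℕ.s≤s ℕ.z≤n))) ⟩
    2ℚ * (1ℚ * ρ 1) ≡⟨ cong (2ℚ *_) (*-identityˡ (ρ 1)) ⟩
    2ℚ * ρ 1 ≡⟨ ι*ρ 1 ⟩
    1ℚ ∎

  contraction : ‖ (λ c → 2ℚ * 2ℚ * LR z c) ‖ ≤ ι 16 * (ι k * (ι p * (ι r * ι r))) →
    ‖ W (rename exchange-↔ z) ‖ ≤ (1ℚ - 2ℚ * (ρ k * ρ r′)) * ‖ W z ‖ + ι 64 * (ι k * ι r)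
  contraction LR≤ = begin
    ‖ W (rename exchange-↔ z) ‖ ≡⟨ ‖‖-cong W′ ⟩
    ‖ (λ c → (1ℚ - θ) * W z c + error c) ‖ ≤⟨ ‖‖-+ (λ c → (1ℚ - θ) * W z c) error ⟩
    _ ≤⟨ +-mono-≤ (≤-reflexive (‖‖-* (0≤q-p θ≤1) (W z))) (error-bound LR≤) ⟩
    (1ℚ - θ) * ‖ W z ‖ + ι 64 * (ι k * ι r) ≤⟨ +-monoˡ-≤ (ι 64 * (ι k * ι r)) (*-monoʳ ‖ W z ‖ (0≤‖‖ (W z)) (+-monoʳ-≤ 1ℚ (neg-antimono-≤
                                                   (*-monoˡ 2ℚ 0≤2 (*-monoʳ (ρ r′) (0≤ρ r′) (ρ-antitone m′≤k)))))) ⟩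
    (1ℚ - 2ℚ * (ρ k * ρ r′)) * ‖ W z ‖ + ι 64 * (ι k * ι r) ∎

-- Total mass and iteration of the rounds

mass : ∀ {P k} {{_ : Finite P}} → Kernel P k → Fin k → ℚ
mass {P} z c = ∑[ u ∈ P ] ∑[ v ∈ P ] at z u v c

mass-rename : ∀ {P Q k} {{_ : Finite P}} {{_ : Finite Q}} (π : Q ↔ P) (z : Kernel P k) c → mass (rename π z) c ≡ mass z c
mass-rename π z c = trans (cong (λ y → mass y c) (rename-pull π z))
  (sym (trans (∑-↔ π (λ u → ∑ (λ v → at z u v c))) (∑-cong λ u → ∑-↔ π (λ v → at z (Inverse.to π u) v c))))

side : ∀ {p r} → (Pos p r → ℚ) → Bool → ℚ
side {p} {r} f s = ∑[ i ∈ Fin p ] ∑[ a ∈ Fin r ] f (s , i , a)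

∑-Pos : ∀ {p r} (f : Pos p r → ℚ) → ∑ f ≡ side f false + side f true
∑-Pos {p} {r} f = trans (∑-× f) (trans (∑-Bool (λ s → ∑[ x ∈ Fin p × Fin r ] f (s , x)))
  (cong₂ _+_ (halve false) (halve true)))
  where
  halve : ∀ s → ∑[ x ∈ Fin p × Fin r ] f (s , x) ≡ side f s
  halve s = ∑-× (λ x → f (s , x))

module _ {p r k} (z : Kernel (Pos p r) k) (c : Fin k) where

  ∑X : Bool → Bool → ℚ
  ∑X s t = ∑[ i ∈ Fin p ] ∑[ j ∈ Fin p ] X z s i t j c

  side-swap : ∀ s i t → ∑[ a ∈ Fin r ] side (λ v → at z (s , i , a) v c) t ≡ ∑[ j ∈ Fin p ] X z s i t j c
  side-swap s i t = ∑-comm (λ a j → ∑[ b ∈ Fin r ] at z (s , i , a) (t , j , b) c)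

  side-row : ∀ s i → ∑[ a ∈ Fin r ] ∑ (λ v → at z (s , i , a) v c) ≡ ∑[ j ∈ Fin p ] X z s i false j c + ∑[ j ∈ Fin p ] X z s i true j c
  side-row s i = trans (∑-cong (λ a → ∑-Pos (λ v → at z (s , i , a) v c)))
    (trans (∑-+ (λ a → side (λ v → at z (s , i , a) v c) false) (λ a → side (λ v → at z (s , i , a) v c) true))
      (cong₂ _+_ (side-swap s i false) (side-swap s i true)))

  rowTotal : Pos p r → ℚ
  rowTotal u = ∑[ v ∈ Pos p r ] at z u v c

  side-∑X : ∀ s → side rowTotal s ≡ ∑X s false + ∑X s true
  side-∑X s = trans (∑-cong (side-row s)) (∑-+ (λ i → ∑[ j ∈ Fin p ] X z s i false j c) (λ i → ∑[ j ∈ Fin p ] X z s i true j c))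

  Tot-∑X : Tot z c ≡ ∑X true true + ∑X true false + ∑X false true + ∑X false false
  Tot-∑X = trans (∑∑-+ (λ i j → X z true i true j c + X z true i false j c + X z false i true j c) (λ i j → X z false i false j c))
    (cong (_+ ∑X false false) (trans three (cong (_+ ∑X false true) two)))
    where
    two : ∑[ i ∈ Fin p ] ∑[ j ∈ Fin p ] (X z true i true j c + X z true i false j c) ≡ ∑X true true + ∑X true false
    two = ∑∑-+ (λ i j → X z true i true j c) (λ i j → X z true i false j c)
    three : ∑[ i ∈ Fin p ] ∑[ j ∈ Fin p ] (X z true i true j c + X z true i false j c + X z false i true j c) ≡
      ∑[ i ∈ Fin p ] ∑[ j ∈ Fin p ] (X z true i true j c + X z true i false j c) + ∑X false true
    three = ∑∑-+ (λ i j → X z true i true j c + X z true i false j c) (λ i j → X z false i true j c)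

  halves : mass z c ≡ side rowTotal false + side rowTotal true
  halves = ∑-Pos rowTotal

  quarters : side rowTotal false + side rowTotal true ≡ (∑X false false + ∑X false true) + (∑X true false + ∑X true true)
  quarters = cong₂ _+_ (side-∑X false) (side-∑X true)

  mass-Pos : mass z c ≡ Tot z c
  mass-Pos = trans halves (trans quarters (trans
    (reorder (∑X false false) (∑X false true) (∑X true false) (∑X true true)) (sym Tot-∑X)))
    where
    reorder : ∀ a b c d → (a + b) + (c + d) ≡ d + c + b + a
    reorder = solve-∀ ℚ-ring

mass-norm : ∀ {p r k} (π : Pos p r ↔ Pos p r) (z : Kernel (Pos p r) k) → ‖ mass (rename π z) ‖ ≡ ‖ mass z ‖
mass-norm π z = ‖‖-cong (mass-rename π z)

W-∘ : ∀ {p r k} (π ρ : Pos p r ↔ Pos p r) (z : Kernel (Pos p r) k) → ‖ W (rename ρ (rename π z)) ‖ ≡ ‖ W (rename (π ↔-∘ ρ) z) ‖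
W-∘ π ρ z = cong (λ y → ‖ W y ‖) (rename-∘ π ρ z)

module _ {p′ r″ k′ : ℕ} where
  private
    p r′ r k : ℕ
    p  = suc p′
    r′ = suc r″
    r  = suc r′
    k  = suc k′

  -- `limit` is twice the fixed point of `w ↦ shrink * w + step-error`. Above it the contraction
  -- removes at least twice `step-error`, so that a round gains at least `step-error` net.
  step-error limit : ℚ
  step-error = ι 64 * (ι k * ι r)
  limit      = step-error * (ι (suc k) * ι r)

  1≤step-error : 1ℚ ≤ step-error
  1≤step-error = *-mono {1ℚ} {ι 64} {1ℚ * 1ℚ} {ι k * ι r} (0≤ι 64) 0≤1 (1≤ι 63) (*-mono (0≤ι k) 0≤1 (1≤ι k′) (1≤ι r′))

  -- The mass of the two sides need not vanish if a blob is left over. The constant 8 equals that of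
  -- the balancing of signs, and both together make up the 16 in `contraction`. Relabelling
  -- preserves the mass, so the condition persists through the rounds.
  Small : Kernel (Pos p r) k → Set
  Small z = ‖ mass z ‖ ≤ ι 8 * (ι k * (ι p * (ι r * ι r)))

  shrink : ℚ
  shrink = 1ℚ - 2ℚ * (ρ k * ρ r′)

  module _ (z : Kernel (Pos p r) k) (small : Small z) (ε : Fin p → Bool) where
    private
      z′ : Kernel (Pos p r) k
      z′ = rename (flip-↔ ε) z
      module R = Round z′
      A B C : ℚ
      A = ι k * (2ℚ * (ι p * (2ℚ * 2ℚ * (ι r * ι r))))
      B = ι 8 * (ι k * (ι p * (ι r * ι r)))
      C = ι 16 * (ι k * (ι p * (ι r * ι r)))
      B+A≡C : B + A ≡ C
      B+A≡C = lemma (ι k) (ι p) (ι r)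
        where
        lemma : ∀ k p r → ι 8 * (k * (p * (r * r))) + k * (2ℚ * (p * (2ℚ * 2ℚ * (r * r)))) ≡ ι 16 * (k * (p * (r * r)))
        lemma = solve-∀ ℚ-ring
      Tot≤ : ‖ Tot z ‖ ≤ B
      Tot≤ = subst (_≤ B) (‖‖-cong (mass-Pos z)) small

    exchange-step : ‖ (λ c → 2ℚ * 2ℚ * LR z′ c) ‖ ≤ ‖ Tot z ‖ + A →
      ‖ W (rename (flip-↔ ε ↔-∘ R.exchange-↔) z) ‖ ≤ shrink * ‖ W z ‖ + step-error
    exchange-step LR≤ = ≤-trans (≤-reflexive (sym (W-∘ (flip-↔ ε) R.exchange-↔ z))) (≤-trans
      (R.contraction (≤-trans LR≤ (≤-trans (+-monoˡ-≤ A Tot≤) (≤-reflexive B+A≡C))))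
      (≤-reflexive (cong (λ x → shrink * x + step-error) {‖ W z′ ‖} {‖ W z ‖} (‖‖-cong (W-flip z ε)))))

  round-step : (z : Kernel (Pos p r) k) → Small z → Σ[ π ∈ Pos p r ↔ Pos p r ]
    ‖ W (rename π z) ‖ ≤ shrink * ‖ W z ‖ + step-error
  round-step z small = by (balanced-sides z)
    where
    by : (Σ[ ε ∈ (Fin p → Bool) ] ‖ (λ c → 2ℚ * 2ℚ * LR (rename (flip-↔ ε) z) c) ‖ ≤ ‖ Tot z ‖ + ι k * (2ℚ * (ι p * (2ℚ * 2ℚ * (ι r * ι r))))) →
      Σ[ π ∈ Pos p r ↔ Pos p r ] ‖ W (rename π z) ‖ ≤ shrink * ‖ W z ‖ + step-error
    by (ε , LR≤) = _ , exchange-step z small ε LR≤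

  gap : ρ k * ρ r′ * limit ≡ step-error
  gap = trans (regroup (ρ k) (ρ r′) step-error (ι (suc k)) (ι r))
    (trans (cong₂ (λ x y → x * y * step-error) {ρ k * ι (suc k)} {1ℚ} {ρ r′ * ι r} {1ℚ} (ρ*ι k) (ρ*ι r′)) (*-identityˡ step-error))
    where
    regroup : ∀ x y e k r → x * y * (e * (k * r)) ≡ x * k * (y * r) * e
    regroup = solve-∀ ℚ-ring

  decrease : ∀ {w w′} n → limit ≤ w → w ≤ limit + ι (suc n) * step-error → w′ ≤ shrink * w + step-error →
    w′ ≤ limit + ι n * step-error
  decrease {w} {w′} n large w≤ w′≤ = ≤-trans w′≤ (≤-by _
    (0≤p+q (0≤q-p w≤) (0≤p*q (0≤p+q 0≤1 0≤1) (0≤q-p (subst (_≤ ρ k * ρ r′ * w) gap (*-monoˡ (ρ k * ρ r′) (0≤p*q (0≤ρ k) (0≤ρ r′)) large)))))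
    (lemma limit (ι n) step-error w (ρ k * ρ r′)))
    where
    lemma : ∀ l n e w x → l + n * e ≡ (1ℚ - 2ℚ * x) * w + e + ((l + (1ℚ + n) * e - w) + 2ℚ * (x * w - e))
    lemma = solve-∀ ℚ-ring

  -- Recursion on a bound for the number of rounds left: by `decrease`, a round that starts above
  -- `limit` lowers this bound by one.
  descent : ∀ n (z : Kernel (Pos p r) k) → Small z → ‖ W z ‖ ≤ limit + ι n * step-error →
    Σ[ π ∈ Pos p r ↔ Pos p r ] ‖ W (rename π z) ‖ ≤ limit
  descent zero z small W≤ = ↔-id (Pos p r) , subst (λ y → ‖ W y ‖ ≤ limit) (sym (rename-id z)) (≤-trans W≤ (≤-reflexive (lemma limit step-error)))
    where
    lemma : ∀ x y → x + 0ℚ * y ≡ x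
    lemma = solve-∀ ℚ-ring
  descent (suc n) z small W≤ = by (‖ W z ‖ ≤? limit) (round-step z small)
    where
    Good : Set
    Good = Σ[ π ∈ Pos p r ↔ Pos p r ] ‖ W (rename π z) ‖ ≤ limit
    by : Dec (‖ W z ‖ ≤ limit) → Σ[ π ∈ Pos p r ↔ Pos p r ] ‖ W (rename π z) ‖ ≤ shrink * ‖ W z ‖ + step-error → Good
    by (yes done) _ = ↔-id (Pos p r) , subst (λ y → ‖ W y ‖ ≤ limit) (sym (rename-id z)) done
    by (no large) (π , W′≤) = continue (descent n (rename π z) small′ (decrease n (<⇒≤ (≰⇒> large)) W≤ W′≤))
      where
      small′ : Small (rename π z)
      small′ = subst (_≤ ι 8 * (ι k * (ι p * (ι r * ι r)))) (sym (mass-norm π z)) small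
      continue : Σ[ π′ ∈ Pos p r ↔ Pos p r ] ‖ W (rename π′ (rename π z)) ‖ ≤ limit → Good
      continue (π′ , W″≤) = π ↔-∘ π′ , subst (_≤ limit) (W-∘ π π′ z) W″≤

  even-case : (z : Kernel (Pos p r) k) → Small z → Σ[ π ∈ Pos p r ↔ Pos p r ] ‖ W (rename π z) ‖ ≤ limit
  even-case z small = descent N z small (begin
    ‖ W z ‖ ≤⟨ ‖‖-∑ (λ i c → X z true i true i c + X z false i false i c) ⟩
    _ ≤⟨ ∑≤ _ (λ i → ≤-trans (‖‖-+ (X z true i true i) (X z false i false i))
                                         (+-mono-≤ (cross-bound z (blob true i) (blob true i)) (cross-bound z (blob false i) (blob false i)))) ⟩
    ι p * (ι r * ι r + ι r * ι r) ≡⟨ N≡ ⟨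
    ι N ≡⟨ *-identityʳ (ι N) ⟨
    ι N * 1ℚ ≤⟨ *-monoˡ (ι N) (0≤ι N) 1≤step-error ⟩
    ι N * step-error ≤⟨ ≤-by limit 0≤limit (+-comm limit (ι N * step-error)) ⟩
    limit + ι N * step-error ∎)
    where
    -- The trivial bound `2 p r²` on the initial weight serves as the number of rounds, since a
    -- round gains at least `step-error`, which is at least 1.
    N : ℕ
    N = p ℕ.* (r ℕ.* r ℕ.+ r ℕ.* r)
    N≡ : ι N ≡ ι p * (ι r * ι r + ι r * ι r)
    N≡ = trans (ι-* p (r ℕ.* r ℕ.+ r ℕ.* r)) (cong (ι p *_) (trans (ι-+ (r ℕ.* r) (r ℕ.* r)) (cong₂ _+_ (ι-* r r) (ι-* r r))))
    0≤limit : 0ℚ ≤ limit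
    0≤limit = 0≤p*q (≤-trans 0≤1 1≤step-error) (0≤p*q (0≤ι (suc k)) (0≤ι r))

-- Dividing the blobs into two sides and a remainder

spread : ∀ {I : Set} {r k} {{_ : Finite I}} → Kernel (I × Fin r) k → Fin k → ℚ
spread {I} z c = ∑[ i ∈ I ] cross z (i ,_) (i ,_) c

∑-×≤ : ∀ {m n} (f : Fin m × Fin n → ℚ) {B} → (∀ u → f u ≤ B) → ∑ f ≤ ι m * (ι n * B)
∑-×≤ f f≤B = ≤-trans (≤-reflexive (∑-× f)) (∑≤ _ λ i → ∑≤ _ λ j → f≤B (i , j))

∑-Pos≤ : ∀ {p r} (f : Pos p r → ℚ) {B} → (∀ u → f u ≤ B) → ∑ f ≤ 2ℚ * (ι p * (ι r * B))
∑-Pos≤ {p} {r} f {B} f≤B = begin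
  ∑ f ≡⟨ ∑-Pos f ⟩
  side f false + side f true ≤⟨ +-mono-≤ (bound false) (bound true) ⟩
  ι p * (ι r * B) + ι p * (ι r * B) ≡⟨ lemma (ι p * (ι r * B)) ⟩
  2ℚ * (ι p * (ι r * B)) ∎
  where
  bound : ∀ s → side f s ≤ ι p * (ι r * B)
  bound s = ∑≤ _ λ i → ∑≤ _ λ a → f≤B (s , i , a)
  lemma : ∀ x → x + x ≡ 2ℚ * x
  lemma = solve-∀ ℚ-ring

-- The blobs, split into two sides and a remainder of size d.
module Split (p d r : ℕ) where

  Blobs : Set
  Blobs = (Bool × Fin p) ⊎ Fin d

  inU : Pos p r → Blobs × Fin r
  inU (s , i , a) = inj₁ (s , i) , a

  inL : Fin d × Fin r → Blobs × Fin r
  inL (i , a) = inj₂ i , a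

  assemble : (Pos p r ⊎ (Fin d × Fin r)) ↔ (Blobs × Fin r)
  assemble = mk↔ₛ′ [ inU , inL ]′ back (λ { (inj₁ _ , _) → refl ; (inj₂ _ , _) → refl }) (λ { (inj₁ _) → refl ; (inj₂ _) → refl })
    where
    back : Blobs × Fin r → Pos p r ⊎ (Fin d × Fin r)
    back (inj₁ (s , i) , a) = inj₁ (s , i , a)
    back (inj₂ i , a)       = inj₂ (i , a)

  ∑-split : (f : Blobs × Fin r → ℚ) → ∑ f ≡ ∑[ u ∈ Pos p r ] f (inU u) + ∑[ v ∈ Fin d × Fin r ] f (inL v)
  ∑-split f = trans (∑-↔ assemble f) (∑-⊎ (λ x → f (Inverse.to assemble x)))

  extend : Pos p r ↔ Pos p r → (Blobs × Fin r) ↔ (Blobs × Fin r)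
  extend π = assemble ↔-∘ ((π ⊎-↔ ↔-id (Fin d × Fin r)) ↔-∘ ↔-sym assemble)

  module _ {k} (z : Kernel (Blobs × Fin r) k) where

    upper : Kernel (Pos p r) k
    upper = pull inU z

    mixed : Fin k → ℚ
    mixed c = ∑[ u ∈ Pos p r ] ∑[ v ∈ Fin d × Fin r ] at z (inU u) (inL v) c

    lower : Fin k → ℚ
    lower c = ∑[ v ∈ Fin d × Fin r ] ∑[ w ∈ Blobs × Fin r ] at z (inL v) w c

    mass-split : ∀ c → mass z c ≡ mass upper c + mixed c + lower c
    mass-split c = trans (∑-split rowTotal′) (cong (_+ lower c) (trans (∑-cong λ u → ∑-split (λ w → at z (inU u) w c)) parts))
      where
      rowTotal′ : Blobs × Fin r → ℚ
      rowTotal′ u = ∑[ w ∈ Blobs × Fin r ] at z u w c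
      parts : ∑[ u ∈ Pos p r ] (∑[ v ∈ Pos p r ] at z (inU u) (inU v) c + ∑[ v ∈ Fin d × Fin r ] at z (inU u) (inL v) c) ≡ mass upper c + mixed c
      parts = ∑-+ (λ u → ∑[ v ∈ Pos p r ] at z (inU u) (inU v) c) (λ u → ∑[ v ∈ Fin d × Fin r ] at z (inU u) (inL v) c)

    mixed-bound : ‖ mixed ‖ ≤ 2ℚ * (ι p * (ι r * (ι d * (ι r * 1ℚ))))
    mixed-bound = ≤-trans (‖‖-∑ (λ u c → ∑[ v ∈ Fin d × Fin r ] at z (inU u) (inL v) c))
      (∑-Pos≤ _ λ u → ≤-trans (‖‖-∑ (λ v → at z (inU u) (inL v))) (∑-×≤ _ λ v → at-bound z (inU u) (inL v)))

    lower-bound : ‖ lower ‖ ≤ ι d * (ι r * (2ℚ * (ι p * (ι r * 1ℚ)) + ι d * (ι r * 1ℚ)))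
    lower-bound = ≤-trans (‖‖-∑ (λ v c → ∑[ w ∈ Blobs × Fin r ] at z (inL v) w c)) (∑-×≤ _ λ v →
      ≤-trans (‖‖-∑ (λ w → at z (inL v) w)) (≤-trans (≤-reflexive (∑-split (λ w → ‖ at z (inL v) w ‖)))
        (+-mono-≤ (∑-Pos≤ _ λ u → at-bound z (inL v) (inU u)) (∑-×≤ _ λ u → at-bound z (inL v) (inL u)))))

    spread-split : ∀ π c → spread (rename (extend π) z) c ≡ W (rename π upper) c + ∑[ i ∈ Fin d ] cross z (λ a → inL (i , a)) (λ a → inL (i , a)) c
    spread-split π c = begin-equality
      spread (rename (extend π) z) c ≡⟨ cong (λ y → spread y c) (rename-pull (extend π) z) ⟩
      spread (pull (Inverse.to (extend π)) z) c
        ≡⟨ ∑-⊎ (λ i → cross (pull (Inverse.to (extend π)) z) (i ,_) (i ,_) c) ⟩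
      ∑[ x ∈ Bool × Fin p ] D x + L ≡⟨ cong (_+ L) (trans (∑-× D) (trans (∑-Bool (λ s → ∑[ i ∈ Fin p ] D (s , i))) (+-comm (∑[ i ∈ Fin p ] D (false , i)) (∑[ i ∈ Fin p ] D (true , i))))) ⟩
      ∑[ i ∈ Fin p ] D (true , i) + ∑[ i ∈ Fin p ] D (false , i) + L
        ≡⟨ cong (_+ L) (∑-+ (λ i → D (true , i)) (λ i → D (false , i))) ⟨
      W (pull (Inverse.to π) upper) c + L ≡⟨ cong (λ y → W y c + L) (rename-pull π upper) ⟨
      W (rename π upper) c + L ∎
      where
      D : Bool × Fin p → ℚ
      D (s , i) = X (pull (Inverse.to π) upper) s i s i c
      L = ∑[ i ∈ Fin d ] cross z (λ a → inL (i , a)) (λ a → inL (i , a)) c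

module _ {r″ k′ : ℕ} where
  private
    r k : ℕ
    r = suc (suc r″)
    k = suc k′

  -- `limit` with `k + 1 ≤ 2 k`, plus `r²` for the remaining blob, which gives the constant
  -- `2 * 64 + 1`.
  spread-limit : ℚ
  spread-limit = ι 129 * (ι k * ι k) * (ι r * ι r)

  split-case : ∀ p d → d ℕ.≤ 1 → (z : Kernel (Split.Blobs p d r × Fin r) k) → (∀ c → mass z c ≡ 0ℚ) →
    Σ[ π ∈ (Split.Blobs p d r × Fin r) ↔ (Split.Blobs p d r × Fin r) ] ‖ spread (rename π z) ‖ ≤ spread-limit
  split-case p d d≤1 z mass≡0 = let π , W≤ = sides p refl in extend π , assembled π W≤
    where
    open Split p d r
    L : Fin k → ℚ
    L c = ∑[ i ∈ Fin d ] cross z (λ a → inL (i , a)) (λ a → inL (i , a)) c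
    ιd≤1 : ι d ≤ 1ℚ
    ιd≤1 = ≤-trans (ι-mono d≤1) (≤-reflexive (+-identityʳ 1ℚ))
    0≤r : 0ℚ ≤ ι r
    0≤r = 0≤ι r
    0≤r² : 0ℚ ≤ ι r * ι r
    0≤r² = 0≤p*q 0≤r 0≤r
    L≤ : ‖ L ‖ ≤ 1ℚ * (ι r * ι r)
    L≤ = ≤-trans (‖‖-∑ (λ i → cross z (λ a → inL (i , a)) (λ a → inL (i , a))))
      (≤-trans (∑≤ _ (λ i → cross-bound z (λ a → inL (i , a)) (λ a → inL (i , a)))) (*-monoʳ (ι r * ι r) 0≤r² ιd≤1))
    1≤k : 1ℚ ≤ ι k
    1≤k = 1≤ι k′
    -- The whole mass is zero, so the mass of the sides is minus that of the pairs that meet the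
    -- remainder. As the remainder is at most one blob, this is at most `5 p r²`.
    upper-small : ∀ p′ → p ≡ suc p′ → ‖ mass (upper z) ‖ ≤ ι 8 * (ι k * (ι p * (ι r * ι r)))
    upper-small p′ refl = begin
      ‖ mass (upper z) ‖ ≡⟨ ‖‖-cong solved ⟩
      ‖ (λ c → - (mixed z c + lower z c)) ‖ ≡⟨ ‖‖-neg (λ c → mixed z c + lower z c) ⟩
      ‖ (λ c → mixed z c + lower z c) ‖ ≤⟨ ‖‖-+ (mixed z) (lower z) ⟩
      ‖ mixed z ‖ + ‖ lower z ‖ ≤⟨ +-mono-≤ (mixed-bound z) (lower-bound z) ⟩
      2ℚ * (P * (R * (D * (R * 1ℚ)))) + D * (R * (2ℚ * (P * (R * 1ℚ)) + D * (R * 1ℚ)))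
                                                ≡⟨ collect P R D ⟩
      D * (2ℚ * 2ℚ * (P * (R * R)) + D * (R * R))
        ≤⟨ *-mono 0≤1 (0≤p+q (0≤p*q (nonNegative⁻¹ (2ℚ * 2ℚ)) 0≤PRR) (0≤p*q (0≤ι d) 0≤r²)) ιd≤1
             (+-monoʳ-≤ (2ℚ * 2ℚ * (P * (R * R))) (*-monoʳ (R * R) 0≤r² (≤-trans ιd≤1 (1≤ι p′)))) ⟩
      1ℚ * (2ℚ * 2ℚ * (P * (R * R)) + P * (R * R))
        ≤⟨ ≤-by (ι 3 * (P * (R * R)) + ι 8 * ((ι k - 1ℚ) * (P * (R * R))))
             (0≤p+q (0≤p*q (0≤ι 3) 0≤PRR) (0≤p*q (0≤ι 8) (0≤p*q (0≤q-p 1≤k) 0≤PRR))) (finish (P * (R * R)) (ι k)) ⟩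
      ι 8 * (ι k * (P * (R * R))) ∎
      where
      P = ι p
      R = ι r
      D = ι d
      0≤PRR : 0ℚ ≤ P * (R * R)
      0≤PRR = 0≤p*q (0≤ι p) 0≤r²
      collect : ∀ P R D → 2ℚ * (P * (R * (D * (R * 1ℚ)))) + D * (R * (2ℚ * (P * (R * 1ℚ)) + D * (R * 1ℚ))) ≡
        D * (2ℚ * 2ℚ * (P * (R * R)) + D * (R * R))
      collect = solve-∀ ℚ-ring
      finish : ∀ x k → ι 8 * (k * x) ≡ 1ℚ * (2ℚ * 2ℚ * x + x) + (ι 3 * x + ι 8 * ((k - 1ℚ) * x))
      finish = solve-∀ ℚ-ring
      solved : ∀ c → mass (upper z) c ≡ - (mixed z c + lower z c)
      solved c = trans (lemma (mass (upper z) c) (mixed z c) (lower z c))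
        (trans (cong (_- (mixed z c + lower z c)) (trans (sym (mass-split z c)) (mass≡0 c))) (+-identityˡ _))
        where
        lemma : ∀ x y t → x ≡ x + y + t - (y + t)
        lemma = solve-∀ ℚ-ring
    sides : ∀ q → p ≡ q → Σ[ π ∈ Pos p r ↔ Pos p r ] ‖ W (rename π (upper z)) ‖ ≤ ι 64 * (ι k * ι r) * (ι (suc k) * ι r)
    -- With at most one blob altogether both sides are empty, and no exchange is possible.
    sides zero refl = ↔-id (Pos 0 r) , ≤-trans (≤-reflexive (‖‖-zero λ c → ∑-Fin-zero _))
      (0≤p*q (0≤p*q (0≤ι 64) (0≤p*q (0≤ι k) 0≤r)) (0≤p*q (0≤ι (suc k)) 0≤r))
    sides (suc p′) refl = even-case (upper z) (upper-small p′ refl)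
    assembled : ∀ π → ‖ W (rename π (upper z)) ‖ ≤ ι 64 * (ι k * ι r) * (ι (suc k) * ι r) → ‖ spread (rename (extend π) z) ‖ ≤ spread-limit
    assembled π W≤ = begin
      ‖ spread (rename (extend π) z) ‖ ≡⟨ ‖‖-cong (spread-split z π) ⟩
      ‖ (λ c → W (rename π (upper z)) c + L c) ‖ ≤⟨ ‖‖-+ (W (rename π (upper z))) L ⟩
      ‖ W (rename π (upper z)) ‖ + ‖ L ‖ ≤⟨ +-mono-≤ W≤ L≤ ⟩
      ι 64 * (ι k * ι r) * ((1ℚ + ι k) * ι r) + 1ℚ * (ι r * ι r)
        ≤⟨ ≤-by ((ι 64 * ι k * (ι k - 1ℚ) + (ι k - 1ℚ + ι k * (ι k - 1ℚ))) * (ι r * ι r))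
             (0≤p*q (0≤p+q (0≤p*q (0≤p*q (0≤ι 64) (0≤ι k)) (0≤q-p 1≤k)) (0≤p+q (0≤q-p 1≤k) (0≤p*q (0≤ι k) (0≤q-p 1≤k)))) 0≤r²)
             (finish (ι k) (ι r)) ⟩
      spread-limit ∎
      where
      finish : ∀ k r → ι 129 * (k * k) * (r * r) ≡ ι 64 * (k * r) * ((1ℚ + k) * r) + 1ℚ * (r * r) + (ι 64 * k * (k - 1ℚ) + (k - 1ℚ + k * (k - 1ℚ))) * (r * r)
      finish = solve-∀ ℚ-ring

halve : ∀ m → Fin m ↔ ((Bool × Fin (m ℕ./ 2)) ⊎ Fin (m ℕ.% 2))
halve m = (((Fin.2↔Bool ×-↔ ↔-id _) ↔-∘ (×-comm _ _ ↔-∘ Fin.*↔×)) ⊎-↔ ↔-id _)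
  ↔-∘ (⊎-comm _ _ ↔-∘ (Fin.+↔⊎ {m ℕ.% 2} {m ℕ./ 2 ℕ.* 2} ↔-∘ cast-id (m≡m%n+[m/n]*n m 2)))

module _ {I J : Set} {r k : ℕ} {{_ : Finite I}} {{_ : Finite J}} (ξ : J ↔ I) where

  blobwise : (J × Fin r) ↔ (I × Fin r)
  blobwise = ξ ×-↔ ↔-id (Fin r)

  spread-blobwise : (z : Kernel (I × Fin r) k) → ∀ c → spread (rename blobwise z) c ≡ spread z c
  spread-blobwise z c = trans (cong (λ y → spread y c) (rename-pull blobwise z))
    (sym (∑-↔ ξ (λ i → cross z (i ,_) (i ,_) c)))

even-spread : ∀ {m r″ k′} (z : Kernel (Fin m × Fin (suc (suc r″))) (suc k′)) → (∀ c → mass z c ≡ 0ℚ) →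
  Σ[ π ∈ (Fin m × Fin (suc (suc r″))) ↔ (Fin m × Fin (suc (suc r″))) ] ‖ spread (rename π z) ‖ ≤ spread-limit {r″} {k′}
even-spread {m} {r″} {k′} z mass≡0 = by (split-case (m ℕ./ 2) (m ℕ.% 2) (ℕ.≤-pred (m%n<n m 2)) z′ λ c → trans (mass-rename (↔-sym ξr) z c) (mass≡0 c))
  where
  r : ℕ
  r = suc (suc r″)
  ξr : (Fin m × Fin r) ↔ (Split.Blobs (m ℕ./ 2) (m ℕ.% 2) r × Fin r)
  ξr = blobwise {r = r} {suc k′} (halve m)
  z′ : Kernel (Split.Blobs (m ℕ./ 2) (m ℕ.% 2) r × Fin r) (suc k′)
  z′ = rename (↔-sym ξr) z
  by : Σ[ π ∈ (Split.Blobs (m ℕ./ 2) (m ℕ.% 2) r × Fin r) ↔ (Split.Blobs (m ℕ./ 2) (m ℕ.% 2) r × Fin r) ] ‖ spread (rename π z′) ‖ ≤ spread-limit {r″} {k′} →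
    Σ[ π ∈ (Fin m × Fin r) ↔ (Fin m × Fin r) ] ‖ spread (rename π z) ‖ ≤ spread-limit {r″} {k′}
  by (π , S≤) = (↔-sym ξr ↔-∘ π) ↔-∘ ξr , subst (_≤ spread-limit {r″} {k′}) same S≤
    where
    same : ‖ spread (rename π z′) ‖ ≡ ‖ spread (rename ((↔-sym ξr ↔-∘ π) ↔-∘ ξr) z) ‖
    same = trans (‖‖-cong λ c → sym (spread-blobwise {k = suc k′} (halve m) (rename π z′) c))
      (cong (λ y → ‖ spread y ‖) (trans (cong (rename ξr) (rename-∘ (↔-sym ξr) π z)) (rename-∘ (↔-sym ξr ↔-∘ π) ξr z)))

-- Random placement inside the blobs

weighted : ∀ {m r k} → (Fin r → Fin r → ℚ) → Kernel (Fin m × Fin r) k → Fin k → ℚ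
weighted {m} {r} φ z c = ∑[ i ∈ Fin m ] ∑[ a ∈ Fin r ] ∑[ b ∈ Fin r ] (φ a b * at z (i , a) (i , b) c)

within : ∀ {m r} → (Fin m → Permutation′ r) → (Fin m × Fin r) ↔ (Fin m × Fin r)
within σ = mk↔ₛ′ (λ (i , a) → i , σ i ⟨$⟩ʳ a) (λ (i , a) → i , σ i ⟨$⟩ˡ a)
  (λ (i , a) → cong (i ,_) (Permutation.inverseʳ (σ i))) (λ (i , a) → cong (i ,_) (Permutation.inverseˡ (σ i)))

-- Placing the weights φ by a random permutation in each blob replaces each entry
-- by the average over the blob, so that only the sum over the blob matters.
module Place {m r″ k} (z : Kernel (Fin m × Fin (suc (suc r″))) k)
  (φ : Fin (suc (suc r″)) → Fin (suc (suc r″)) → ℚ) (0≤φ : ∀ a b → 0ℚ ≤ φ a b) (φ≡0 : ∀ a → φ a a ≡ 0ℚ) where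

  r : ℕ
  r = suc (suc r″)

  total-weight : ℚ
  total-weight = ∑[ a ∈ Fin r ] ∑[ b ∈ Fin r ] φ a b

  0≤total-weight : 0ℚ ≤ total-weight
  0≤total-weight = ∑-nonneg λ a → ∑-nonneg λ b → 0≤φ a b

  u : Fin m → Code r → Fin k → ℚ
  u i d c = ∑[ a ∈ Fin r ] ∑[ b ∈ Fin r ] (φ a b * at z (i , act d ⟨$⟩ʳ a) (i , act d ⟨$⟩ʳ b) c)

  u-bound : ∀ i d → ‖ u i d ‖ ≤ total-weight
  u-bound i d = ≤-trans (‖‖-∑ (λ a c → ∑[ b ∈ Fin r ] (φ a b * entryAt a b c)))
    (∑-mono λ a → ≤-trans (‖‖-∑ (λ b c → φ a b * entryAt a b c)) (∑-mono λ b → begin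
      ‖ (λ c → φ a b * entryAt a b c) ‖ ≡⟨ ‖‖-* (0≤φ a b) (entryAt a b) ⟩
      φ a b * ‖ entryAt a b ‖ ≤⟨ *-monoˡ (φ a b) (0≤φ a b) (at-bound z _ _) ⟩
      φ a b * 1ℚ ≡⟨ *-identityʳ (φ a b) ⟩
      φ a b ∎))
    where
    entryAt : Fin r → Fin r → Fin k → ℚ
    entryAt a b = at z (i , act d ⟨$⟩ʳ a) (i , act d ⟨$⟩ʳ b)

  -- `1 / (r (r - 1))`, the probability that two given distinct points are mapped to a given ordered
  -- pair of distinct positions.
  rate : ℚ
  rate = ρ (suc r″) * ρ r″

  mean : ∀ i c → ∑[ d ∈ Code r ] (prob d * u i d c) ≡ total-weight * (rate * cross z (i ,_) (i ,_) c)
  mean i c = begin-equality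
    ∑[ d ∈ Code r ] (prob d * u i d c)
      ≡⟨ ∑-cong (λ d → trans (sym (∑-* (prob d) (λ a → ∑[ b ∈ Fin r ] (φ a b * entryAt d a b)))) (∑-cong λ a → sym (∑-* (prob d) (λ b → φ a b * entryAt d a b)))) ⟩
    ∑[ d ∈ Code r ] ∑[ a ∈ Fin r ] ∑[ b ∈ Fin r ] (prob d * (φ a b * entryAt d a b))
      ≡⟨ trans (∑-comm (λ d a → ∑[ b ∈ Fin r ] (prob d * (φ a b * entryAt d a b)))) (∑-cong λ a → ∑-comm (λ d b → prob d * (φ a b * entryAt d a b))) ⟩
    ∑[ a ∈ Fin r ] ∑[ b ∈ Fin r ] ∑[ d ∈ Code r ] (prob d * (φ a b * entryAt d a b))
      ≡⟨ ∑-cong (λ a → ∑-cong λ b → entry a b) ⟩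
    ∑[ a ∈ Fin r ] ∑[ b ∈ Fin r ] (φ a b * Y)
      ≡⟨ trans (∑-cong λ a → ∑-*ʳ Y (φ a)) (∑-*ʳ Y (λ a → ∑ (φ a))) ⟩
    total-weight * Y
      ≡⟨ cong (total-weight *_) (*-assoc (ρ (suc r″)) (ρ r″) (cross z (i ,_) (i ,_) c)) ⟨
    total-weight * (rate * cross z (i ,_) (i ,_) c) ∎
    where
    g : Fin r → Fin r → ℚ
    g x y = at z (i , x) (i , y) c
    Y : ℚ
    Y = ρ (suc r″) * (ρ r″ * ∑[ x ∈ Fin r ] ∑ (g x))
    entryAt : Code r → Fin r → Fin r → ℚ
    entryAt d a b = g (act d ⟨$⟩ʳ a) (act d ⟨$⟩ʳ b)
    swap : ∀ x y t → x * (y * t) ≡ y * (x * t)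
    swap = solve-∀ ℚ-ring
    pull-φ : ∀ a b → ∑[ d ∈ Code r ] (prob d * (φ a b * entryAt d a b)) ≡ φ a b * 𝔼 (λ d → entryAt d a b)
    pull-φ a b = trans (∑-cong λ d → swap (prob d) (φ a b) (entryAt d a b)) (∑-* (φ a b) (λ d → prob d * entryAt d a b))
    entry : ∀ a b → ∑[ d ∈ Code r ] (prob d * (φ a b * entryAt d a b)) ≡ φ a b * Y
    entry a b with a Fin.≟ b
    ... | no a≢b = trans (pull-φ a b) (cong (φ a b *_) (𝔼-pair g (λ x → at-diag z (i , x) c) a b a≢b))
    ... | yes refl = trans (pull-φ a a) (trans (cong (_* 𝔼 (λ d → entryAt d a a)) (φ≡0 a))
      (trans (*-zeroˡ (𝔼 (λ d → entryAt d a a))) (sym (trans (cong (_* Y) (φ≡0 a)) (*-zeroˡ Y)))))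

  codes = select {m} {k} {Code r} (λ _ → prob) (λ _ → 0≤prob) (λ _ → trans (∑-cong λ d → sym (*-identityʳ (prob d))) (𝔼-const r 1ℚ))
    u (0≤p*q (0≤p+q 0≤1 0≤1) 0≤total-weight) (λ i d d′ → diameter (u i d) (u i d′) (u-bound i d) (u-bound i d′))

  placement : (Fin m × Fin r) ↔ (Fin m × Fin r)
  placement = within (act ∘ proj₁ codes)

  placed-bound : ‖ weighted φ (rename placement z) ‖ ≤ ι k * (2ℚ * total-weight) + total-weight * (rate * ‖ spread z ‖)
  placed-bound = begin
    ‖ weighted φ (rename placement z) ‖ ≡⟨ cong (λ y → ‖ weighted φ y ‖) (rename-pull placement z) ⟩
    ‖ (λ c → U c) ‖ ≡⟨ ‖‖-cong (λ c → shift (U c) (M c)) ⟩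
    ‖ (λ c → (U c - M c) + M c) ‖ ≤⟨ ‖‖-+ (λ c → U c - M c) M ⟩
    ‖ (λ c → U c - M c) ‖ + ‖ M ‖ ≤⟨ +-mono-≤ (proj₂ codes) (≤-reflexive M≡) ⟩
    ι k * (2ℚ * total-weight) + total-weight * (rate * ‖ spread z ‖) ∎
    where
    U M : Fin k → ℚ
    U c = ∑[ i ∈ Fin m ] u i (proj₁ codes i) c
    M c = ∑[ i ∈ Fin m ] ∑[ d ∈ Code r ] (prob d * u i d c)
    shift : ∀ x y → x ≡ x - y + y
    shift = solve-∀ ℚ-ring
    0≤rate : 0ℚ ≤ rate
    0≤rate = 0≤p*q (0≤ρ (suc r″)) (0≤ρ r″)
    M-entry : ∀ c → M c ≡ total-weight * (rate * spread z c)
    M-entry c = trans (∑-cong λ i → mean i c) (trans (∑-* total-weight (λ i → rate * cross z (i ,_) (i ,_) c))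
      (cong (total-weight *_) (∑-* rate (λ i → cross z (i ,_) (i ,_) c))))
    M≡ : ‖ M ‖ ≡ total-weight * (rate * ‖ spread z ‖)
    M≡ = trans (‖‖-cong M-entry) (trans (‖‖-* 0≤total-weight (λ c → rate * spread z c)) (cong (total-weight *_) (‖‖-* 0≤rate (spread z))))

balanced-placement : ∀ {m r″ k′} (z : Kernel (Fin m × Fin (suc (suc r″))) (suc k′)) → (∀ c → mass z c ≡ 0ℚ) →
  (φ : Fin (suc (suc r″)) → Fin (suc (suc r″)) → ℚ) → (∀ a b → 0ℚ ≤ φ a b) → (∀ a → φ a a ≡ 0ℚ) →
  Σ[ π ∈ (Fin m × Fin (suc (suc r″))) ↔ (Fin m × Fin (suc (suc r″))) ]
    ‖ weighted φ (rename π z) ‖ ≤ ι 260 * (ι (suc k′) * ι (suc k′)) * ∑[ a ∈ _ ] ∑[ b ∈ _ ] φ a b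
balanced-placement {m} {r″} {k′} z mass≡0 φ 0≤φ φ≡0 = by (even-spread z mass≡0)
  where
  r k : ℕ
  r = suc (suc r″)
  k = suc k′
  f : ℚ
  f = ∑[ a ∈ Fin r ] ∑[ b ∈ Fin r ] φ a b
  0≤f : 0ℚ ≤ f
  0≤f = ∑-nonneg λ a → ∑-nonneg λ b → 0≤φ a b
  x : ℚ
  x = ρ r″
  y : ℚ
  y = ι (suc r″)
  -- `rate * r²` equals `r / (r - 1) = 1 + x`, which is at most 2. With the price of derandomising,
  -- the constant is `2 + 2 * 129`.
  arith : ι k * (2ℚ * f) + f * (ρ (suc r″) * x * (ι 129 * (ι k * ι k) * (ι r * ι r))) ≤ ι 260 * (ι k * ι k) * f
  arith = begin
    ι k * (2ℚ * f) + f * (ρ (suc r″) * x * (ι 129 * (ι k * ι k) * (ι r * ι r)))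
      ≡⟨ collect (ι k) f (ρ (suc r″)) x (ι r) ⟩
    (2ℚ * ι k + ι 129 * (ι k * ι k) * (ρ (suc r″) * ι r * (x * ι r))) * f
      ≡⟨ cong (λ t → (2ℚ * ι k + ι 129 * (ι k * ι k) * (t * (x * (1ℚ + y)))) * f) (ρ*ι (suc r″)) ⟩
    (2ℚ * ι k + ι 129 * (ι k * ι k) * (1ℚ * (x * (1ℚ + y)))) * f
      ≡⟨ cong (λ t → (2ℚ * ι k + ι 129 * (ι k * ι k) * t) * f) (trans (distribute x y) (cong (x +_) (ρ*ι r″))) ⟩
    (2ℚ * ι k + ι 129 * (ι k * ι k) * (x + 1ℚ)) * f
      ≤⟨ *-monoʳ {2ℚ * ι k + ι 129 * (ι k * ι k) * (x + 1ℚ)} {ι 260 * (ι k * ι k)} f 0≤f (≤-by (2ℚ * (ι k * (ι k - 1ℚ)) + ι 129 * (ι k * ι k) * (1ℚ - x))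
           (0≤p+q (0≤p*q (0≤p+q 0≤1 0≤1) (0≤p*q (0≤ι k) (0≤q-p (1≤ι k′)))) (0≤p*q (0≤p*q (0≤ι 129) (0≤p*q (0≤ι k) (0≤ι k))) (0≤q-p (ρ≤1 r″)))) (finish (ι k) x)) ⟩
    ι 260 * (ι k * ι k) * f ∎
    where
    collect : ∀ k f w x r → k * (2ℚ * f) + f * (w * x * (ι 129 * (k * k) * (r * r))) ≡ (2ℚ * k + ι 129 * (k * k) * (w * r * (x * r))) * f
    collect = solve-∀ ℚ-ring
    distribute : ∀ x y → 1ℚ * (x * (1ℚ + y)) ≡ x + x * y
    distribute = solve-∀ ℚ-ring
    finish : ∀ k x → ι 260 * (k * k) ≡ 2ℚ * k + ι 129 * (k * k) * (x + 1ℚ) + (2ℚ * (k * (k - 1ℚ)) + ι 129 * (k * k) * (1ℚ - x))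
    finish = solve-∀ ℚ-ring
  by : Σ[ π ∈ (Fin m × Fin r) ↔ (Fin m × Fin r) ] ‖ spread (rename π z) ‖ ≤ spread-limit {r″} {k′} →
    Σ[ π ∈ (Fin m × Fin r) ↔ (Fin m × Fin r) ] ‖ weighted φ (rename π z) ‖ ≤ ι 260 * (ι k * ι k) * f
  by (π , S≤) = π ↔-∘ P.placement , (begin
    ‖ weighted φ (rename (π ↔-∘ P.placement) z) ‖ ≡⟨ cong (λ w → ‖ weighted φ w ‖) (rename-∘ π P.placement z) ⟨
    ‖ weighted φ (rename P.placement (rename π z)) ‖ ≤⟨ P.placed-bound ⟩
    ι k * (2ℚ * f) + f * (ρ (suc r″) * x * ‖ spread (rename π z) ‖)
      ≤⟨ +-monoʳ-≤ (ι k * (2ℚ * f)) (*-monoˡ f 0≤f (*-monoˡ (ρ (suc r″) * x) (0≤p*q (0≤ρ (suc r″)) (0≤ρ r″)) S≤)) ⟩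
    ι k * (2ℚ * f) + f * (ρ (suc r″) * x * (ι 129 * (ι k * ι k) * (ι r * ι r))) ≤⟨ arith ⟩
    ι 260 * (ι k * ι k) * f ∎)
    where
    module P = Place (rename π z) φ 0≤φ φ≡0

-- Numerals

ι≡/1 : ∀ n → ι n ≡ ℤ.+ n / 1
ι≡/1 zero    = refl
ι≡/1 (suc n) = trans (cong (1ℚ +_) (ι≡/1 n)) (toℚᵘ-injective (ℚᵘ.≃-trans (toℚᵘ-homo-+ 1ℚ (ℤ.+ n / 1))
  (ℚᵘ.≃-trans (ℚᵘ.+-cong (ℚᵘ.≃-refl {toℚᵘ 1ℚ}) (toℚᵘ-fromℚᵘ (mkℚᵘ (ℤ.+ n) 0)))
  (ℚᵘ.≃-trans (*≡* (lemma (ℤ.+ n))) (ℚᵘ.≃-sym (toℚᵘ-fromℚᵘ (mkℚᵘ (ℤ.+ suc n) 0)))))))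
  where
  lemma : ∀ x → (ℤ.1ℤ ℤ.* ℤ.1ℤ ℤ.+ x ℤ.* ℤ.1ℤ) ℤ.* ℤ.1ℤ ≡ (ℤ.1ℤ ℤ.+ x) ℤ.* (ℤ.1ℤ ℤ.* ℤ.1ℤ)
  lemma = ℤ-solve-∀

÷-cancel : ∀ a b → (a ÷ suc b) * ι (suc b) ≡ ι a
÷-cancel a b = trans (cong ((a ÷ suc b) *_) (ι≡/1 (suc b))) (trans (toℚᵘ-injective (ℚᵘ.≃-trans (toℚᵘ-homo-* (ℤ.+ a / suc b) (ℤ.+ suc b / 1))
  (ℚᵘ.≃-trans (ℚᵘ.*-cong (toℚᵘ-fromℚᵘ (mkℚᵘ (ℤ.+ a) b)) (toℚᵘ-fromℚᵘ (mkℚᵘ (ℤ.+ suc b) 0)))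
  (ℚᵘ.≃-trans (*≡* (lemma (ℤ.+ a) (ℤ.+ suc b))) (ℚᵘ.≃-sym (toℚᵘ-fromℚᵘ (mkℚᵘ (ℤ.+ a) 0))))))) (sym (ι≡/1 a)))
  where
  lemma : ∀ x y → (x ℤ.* y) ℤ.* ℤ.1ℤ ≡ x ℤ.* (y ℤ.* ℤ.1ℤ)
  lemma = ℤ-solve-∀

0÷ : ∀ b → 0 ÷ b ≡ 0ℚ
0÷ zero    = refl
0÷ (suc b) = 0/n≡0 (suc b)

ι-zero : ∀ n → ι n ≡ 0ℚ → n ≡ 0
ι-zero zero    _  = refl
ι-zero (suc n) eq = contradiction (≤-trans (1≤ι n) (≤-reflexive eq)) (<⇒≱ (positive⁻¹ 1ℚ))
  where
  <⇒≱ : ∀ {p q} → p < q → ¬ (q ≤ p)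
  <⇒≱ p<q q≤p = <-irrefl refl (<-≤-trans p<q q≤p)

-- Sums over lists

Σˡ : ∀ {A : Set} → List A → (A → ℚ) → ℚ
Σˡ xs f = foldr _+_ 0ℚ (map f xs)

Σˡ-cong : ∀ {A : Set} (xs : List A) {f g : A → ℚ} → (∀ x → f x ≡ g x) → Σˡ xs f ≡ Σˡ xs g
Σˡ-cong []       f≡g = refl
Σˡ-cong (x ∷ xs) f≡g = cong₂ _+_ (f≡g x) (Σˡ-cong xs f≡g)

Σˡ-++ : ∀ {A : Set} (xs ys : List A) (f : A → ℚ) → Σˡ (xs ++ ys) f ≡ Σˡ xs f + Σˡ ys f
Σˡ-++ []       ys f = sym (+-identityˡ (Σˡ ys f))
Σˡ-++ (x ∷ xs) ys f = trans (cong (f x +_) (Σˡ-++ xs ys f)) (sym (+-assoc (f x) (Σˡ xs f) (Σˡ ys f)))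

Σˡ-map : ∀ {A B : Set} (g : A → B) (xs : List A) (f : B → ℚ) → Σˡ (map g xs) f ≡ Σˡ xs (λ x → f (g x))
Σˡ-map g []       f = refl
Σˡ-map g (x ∷ xs) f = cong (f (g x) +_) (Σˡ-map g xs f)

Σˡ-mapMaybe : ∀ {A B : Set} (g : A → Maybe B) (xs : List A) (f : B → ℚ) →
  Σˡ (mapMaybe g xs) f ≡ Σˡ xs (λ x → maybe′ f 0ℚ (g x))
Σˡ-mapMaybe g []       f = refl
Σˡ-mapMaybe g (x ∷ xs) f with g x
... | just y  = cong (f y +_) (Σˡ-mapMaybe g xs f)
... | nothing = trans (Σˡ-mapMaybe g xs f) (sym (+-identityˡ _))

Σˡ-× : ∀ {A B : Set} (xs : List A) (ys : List B) (f : A × B → ℚ) →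
  Σˡ (cartesianProduct xs ys) f ≡ Σˡ xs (λ x → Σˡ ys (λ y → f (x , y)))
Σˡ-× []       ys f = refl
Σˡ-× (x ∷ xs) ys f = trans (Σˡ-++ (map (x ,_) ys) (cartesianProduct xs ys) f)
  (cong₂ _+_ (Σˡ-map (x ,_) ys f) (Σˡ-× xs ys f))

Σˡ-tabulate : ∀ {A : Set} n (g : Fin n → A) (f : A → ℚ) → Σˡ (tabulate g) f ≡ ∑[ i ∈ Fin n ] f (g i)
Σˡ-tabulate zero    g f = sym (∑-Fin-zero (λ i → f (g i)))
Σˡ-tabulate (suc n) g f = trans (cong (f (g zero) +_) (Σˡ-tabulate n (g ∘ suc) f)) (sym (∑-suc (λ i → f (g i))))

Σˡ-allFin : ∀ n (f : Fin n → ℚ) → Σˡ (allFin n) f ≡ ∑ f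
Σˡ-allFin n f = Σˡ-tabulate n id f

Σˡ-one : ∀ {A : Set} (xs : List A) → Σˡ xs (λ _ → 1ℚ) ≡ ι (length xs)
Σˡ-one []       = refl
Σˡ-one (x ∷ xs) = cong (1ℚ +_) (Σˡ-one xs)

𝟙 : Bool → ℚ
𝟙 true  = 1ℚ
𝟙 false = 0ℚ

0≤𝟙 : ∀ b → 0ℚ ≤ 𝟙 b
0≤𝟙 true  = 0≤1
0≤𝟙 false = ≤-refl

length-filterᵇ : ∀ {A : Set} (p : A → Bool) (xs : List A) → ι (length (filterᵇ p xs)) ≡ Σˡ xs (λ x → 𝟙 (p x))
length-filterᵇ p []       = refl
length-filterᵇ p (x ∷ xs) with p x
... | true  = cong (1ℚ +_) (length-filterᵇ p xs)
... | false = trans (length-filterᵇ p xs) (sym (+-identityˡ _))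

-- Edge sums

module _ {n} (G : Graph (Fin n)) where

  adjacencies : (Fin n → Fin n → ℚ) → ℚ
  adjacencies y = ∑[ u ∈ Fin n ] ∑[ v ∈ Fin n ] (𝟙 (adj G u v) * y u v)

  edgeSum : (Fin n → Fin n → ℚ) → ℚ
  edgeSum y = Σˡ (edges G) (λ a → y (Edge.source a) (Edge.target a))

  -- Each edge appears twice, once in each order, in the sum over ordered pairs.
  edgeSum-double : ∀ y → (∀ u v → y u v ≡ y v u) → edgeSum y + edgeSum y ≡ adjacencies y
  edgeSum-double y y-sym = begin-equality
    edgeSum y + edgeSum y
      ≡⟨ cong₂ _+_ {edgeSum y} {∑∑t} {edgeSum y} {∑∑t′} edgeSum≡ (trans edgeSum≡ (∑-comm t)) ⟩
    ∑∑t + ∑∑t′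
      ≡⟨ trans (∑-cong λ u → ∑-+ (t u) (λ v → t v u)) (∑-+ (λ u → ∑ (t u)) (λ u → ∑[ v ∈ Fin n ] t v u)) ⟨
    ∑[ u ∈ Fin n ] ∑[ v ∈ Fin n ] (t u v + t v u)
      ≡⟨ ∑-cong (λ u → ∑-cong λ v → pair u v) ⟩
    adjacencies y ∎
    where
    val : Maybe (Edge G) → ℚ
    val = maybe′ (λ a → y (Edge.source a) (Edge.target a)) 0ℚ
    t : Fin n → Fin n → ℚ
    t u v = val (edge? G (u , v))
    ∑∑t = ∑[ u ∈ Fin n ] ∑[ v ∈ Fin n ] t u v
    ∑∑t′ = ∑[ u ∈ Fin n ] ∑[ v ∈ Fin n ] t v u
    edgeSum≡ : edgeSum y ≡ ∑∑t
    edgeSum≡ = trans (Σˡ-mapMaybe (edge? G) (cartesianProduct (allFin n) (allFin n)) _)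
      (trans (Σˡ-× (allFin n) (allFin n) (λ uv → val (edge? G uv)))
      (trans (Σˡ-allFin n (λ u → Σˡ (allFin n) (t u))) (∑-cong λ u → Σˡ-allFin n (t u))))
    t-< : ∀ u v → u Fin.< v → t u v ≡ 𝟙 (adj G u v) * y u v
    t-< u v u<v with u Fin.<? v | T? (adj G u v)
    ... | no u≮v | _ = contradiction u<v u≮v
    ... | yes _ | yes uv = sym (trans (cong (λ b → 𝟙 b * y u v) (T⇒true uv)) (*-identityˡ (y u v)))
      where
      T⇒true : ∀ {b} → T b → b ≡ true
      T⇒true {true} _ = refl
    ... | yes _ | no ¬uv = sym (trans (cong (λ b → 𝟙 b * y u v) (¬T⇒false ¬uv)) (*-zeroˡ (y u v)))
      where
      ¬T⇒false : ∀ {b} → ¬ T b → b ≡ false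
      ¬T⇒false {true}  ¬t = contradiction _ ¬t
      ¬T⇒false {false} _  = refl
    t-≮ : ∀ u v → (u Fin.< v → Fin 0) → t u v ≡ 0ℚ
    t-≮ u v u≮v with u Fin.<? v | T? (adj G u v)
    ... | yes u<v | _ = contradiction (u≮v u<v) λ ()
    ... | no _ | yes _ = refl
    ... | no _ | no _  = refl
    pair : ∀ u v → t u v + t v u ≡ 𝟙 (adj G u v) * y u v
    pair u v with Fin.<-cmp u v
    ... | tri< u<v _ v≮u = trans (cong₂ _+_ {t u v} {𝟙 (adj G u v) * y u v} {t v u} {0ℚ} (t-< u v u<v) (t-≮ v u λ v<u → contradiction v<u v≮u)) (+-identityʳ _)
    ... | tri> u≮v _ v<u = trans (cong₂ _+_ {t u v} {0ℚ} {t v u} {𝟙 (adj G v u) * y v u} (t-≮ u v λ u<v → contradiction u<v u≮v) (t-< v u v<u))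
      (trans (+-identityˡ _) (cong₂ (λ b x → 𝟙 b * x) (symmetric G v u) (y-sym v u)))
    ... | tri≈ u≮u refl _ = trans (cong₂ _+_ {t u u} {0ℚ} {t u u} {0ℚ} (t-≮ u u λ u<u → contradiction u<u u≮u) (t-≮ u u λ u<u → contradiction u<u u≮u))
      (sym (trans (cong (λ b → 𝟙 b * y u u) (loopless G u)) (*-zeroˡ (y u u))))

  edge-count : ι (e G) + ι (e G) ≡ adjacencies (λ _ _ → 1ℚ)
  edge-count = trans (cong (λ x → x + x) (sym (Σˡ-one (edges G)))) (edgeSum-double (λ _ _ → 1ℚ) (λ _ _ → refl))

degree-sum : ∀ {r} (F : Graph (Fin r)) a → ∑[ b ∈ Fin r ] 𝟙 (adj F a b) ≤ ι (maxDegree F)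
degree-sum {r} F a = begin
  ∑[ b ∈ Fin r ] 𝟙 (adj F a b) ≡⟨ Σˡ-allFin r (λ b → 𝟙 (adj F a b)) ⟨
  Σˡ (allFin r) (λ b → 𝟙 (adj F a b)) ≡⟨ length-filterᵇ (adj F a) (allFin r) ⟨
  ι (degree F a) ≤⟨ ι-mono (All.lookup (xs≤max 0 (map (degree F) (allFin r))) (∈-map⁺ (degree F) (∈-allFin a))) ⟩
  ι (maxDegree F) ∎

-- Placed copies of F

factor : ∀ {m r n} → Graph (Fin r) → Fin n ↔ (Fin m × Fin r) → Graph (Fin n)
factor {m} F ψ = record
  { adj       = λ u v → adj (copies m F) (Inverse.to ψ u) (Inverse.to ψ v)
  ; symmetric = λ u v → symmetric (copies m F) (Inverse.to ψ u) (Inverse.to ψ v)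
  ; loopless  = λ v → loopless (copies m F) (Inverse.to ψ v) }

factor-≅ : ∀ {m r n} {F : Graph (Fin r)} {H : Graph (Fin n)} (ψ : Fin n ↔ (Fin m × Fin r)) → H ≅ copies m F → factor F ψ ≅ H
factor-≅ {m} {F = F} ψ H≅ = record
  { bijection = ↔-sym φ ↔-∘ ψ
  ; preserves = λ u v → sym (trans (_≅_.preserves H≅ (Inverse.from φ (Inverse.to ψ u)) (Inverse.from φ (Inverse.to ψ v)))
      (cong₂ (adj (copies m F)) (Inverse.strictlyInverseˡ φ (Inverse.to ψ u)) (Inverse.strictlyInverseˡ φ (Inverse.to ψ v)))) }
  where
  φ = _≅_.bijection H≅

⊆-K : ∀ {n} (G : Graph (Fin n)) → G ⊆ K n
⊆-K G u v uv with u Fin.≟ v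
... | no _     = _
... | yes refl = subst T (loopless G u) uv

module _ {m r n} (F : Graph (Fin r)) (ψ : Fin n ↔ (Fin m × Fin r)) where

  copySum : (Fin n → Fin n → ℚ) → ℚ
  copySum y = ∑[ i ∈ Fin m ] ∑[ a ∈ Fin r ] ∑[ b ∈ Fin r ] (𝟙 (adj F a b) * y (Inverse.from ψ (i , a)) (Inverse.from ψ (i , b)))

  adjacencies-factor : ∀ y → adjacencies (factor F ψ) y ≡ copySum y
  adjacencies-factor y = begin-equality
    ∑[ u ∈ Fin n ] ∑[ v ∈ Fin n ] (𝟙 (adj (factor F ψ) u v) * y u v)
      ≡⟨ trans (∑-↔ (↔-sym ψ) (λ u → ∑[ v ∈ Fin n ] (𝟙 (adj (factor F ψ) u v) * y u v)))
           (∑-cong λ s → ∑-↔ (↔-sym ψ) (λ v → 𝟙 (adj (factor F ψ) (f s) v) * y (f s) v)) ⟩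
    ∑[ s ∈ Fin m × Fin r ] ∑[ t ∈ Fin m × Fin r ] (𝟙 (adj (copies m F) (Inverse.to ψ (f s)) (Inverse.to ψ (f t))) * y (f s) (f t))
      ≡⟨ ∑-cong (λ s → ∑-cong λ t → cong₂ (λ s′ t′ → 𝟙 (adj (copies m F) s′ t′) * y (f s) (f t)) (Inverse.strictlyInverseˡ ψ s) (Inverse.strictlyInverseˡ ψ t)) ⟩
    ∑[ s ∈ Fin m × Fin r ] ∑[ t ∈ Fin m × Fin r ] g s t
      ≡⟨ trans (∑-× (λ s → ∑ (g s))) (∑-cong λ i → ∑-cong λ a → ∑-× (g (i , a))) ⟩
    ∑[ i ∈ Fin m ] ∑[ a ∈ Fin r ] ∑[ j ∈ Fin m ] ∑[ b ∈ Fin r ] g (i , a) (j , b)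
      ≡⟨ ∑-cong (λ i → ∑-cong λ a → ∑-single i (λ j j≢i → ∑-zero λ b → off i a j b (j≢i ∘ sym))) ⟩
    ∑[ i ∈ Fin m ] ∑[ a ∈ Fin r ] ∑[ b ∈ Fin r ] g (i , a) (i , b)
      ≡⟨ ∑-cong (λ i → ∑-cong λ a → ∑-cong λ b → on i a b) ⟩
    copySum y ∎
    where
    f = Inverse.from ψ
    g : Fin m × Fin r → Fin m × Fin r → ℚ
    g s t = 𝟙 (adj (copies m F) s t) * y (f s) (f t)
    off : ∀ i a j b → i ≢ j → g (i , a) (j , b) ≡ 0ℚ
    off i a j b i≢j with i Fin.≟ j
    ... | yes i≡j = contradiction i≡j i≢j
    ... | no _    = *-zeroˡ (y (f (i , a)) (f (j , b)))
    on : ∀ i a b → g (i , a) (i , b) ≡ 𝟙 (adj F a b) * y (f (i , a)) (f (i , b))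
    on i a b with i Fin.≟ i
    ... | yes _  = refl
    ... | no i≢i = contradiction refl i≢i

-- Approximation of the real discrepancy

approx-‖‖ : ∀ {k} (v : Vector ℝ k) l → approx ‖ v ‖₁ l ≡ ‖ (λ i → approx (v i) l) ‖
approx-‖‖ v l = trans (go v) (‖‖-∣∣ (λ i → approx (v i) l))
  where
  go : ∀ {k} (v : Vector ℝ k) → approx ‖ v ‖₁ l ≡ ∑[ i ∈ Fin k ] ∣ approx (v i) l ∣
  go {zero}  v = sym (∑-Fin-zero _)
  go {suc k} v = trans (cong (∣ approx (v zero) l ∣ +_) (go (v ∘ suc))) (sym (∑-suc (λ i → ∣ approx (v i) l ∣)))

approx-total : ∀ {n k} (G G′ : Graph (Fin n)) (h : Edge G → Vector ℝ k) (G′⊆G : G′ ⊆ G) i l →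
  approx (total G G′ h G′⊆G i) l ≡ Σˡ (edges G′) (λ a → approx (h (include G′ G G′⊆G a) i) l)
approx-total G G′ h G′⊆G i l = go (edges G′)
  where
  go : ∀ xs → approx (foldr _+ℝ_ 0ℝ (map (λ a → h (include G′ G G′⊆G a) i) xs)) l ≡ Σˡ xs (λ a → approx (h (include G′ G G′⊆G a) i) l)
  go []       = refl
  go (a ∷ xs) = cong (approx (h (include G′ G G′⊆G a) i) l +_) (go xs)

module _ {n k} (h : Edge (K n) → Vector ℝ k) where

  K-adj : ∀ {u v : Fin n} → u Fin.< v → T (adj (K n) u v)
  K-adj {u} {v} u<v with u Fin.≟ v
  ... | yes refl = contradiction u<v (ℕ.<-irrefl refl)
  ... | no _     = _

  -- h as a symmetric function of the two endpoints, zero on the diagonal.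
  pairs : Fin n → Fin n → Vector ℝ k
  pairs u v with Fin.<-cmp u v
  ... | tri< u<v _ _ = h (edge u v u<v (K-adj u<v))
  ... | tri≈ _ _ _   = λ _ → 0ℝ
  ... | tri> _ _ v<u = h (edge v u v<u (K-adj v<u))

  pairs-edge : ∀ u v .(u<v : u Fin.< v) .(uv : T (adj (K n) u v)) → pairs u v ≡ h (edge u v u<v uv)
  pairs-edge u v u<v uv with Fin.<-cmp u v
  ... | tri< _ _ _   = refl
  ... | tri≈ u≮v _ _ = ⊥-elim-irr (u≮v u<v)
  ... | tri> u≮v _ _ = ⊥-elim-irr (u≮v u<v)

  pairs-sym : ∀ u v → pairs u v ≡ pairs v u
  pairs-sym u v with Fin.<-cmp u v | Fin.<-cmp v u
  ... | tri< _ _ _   | tri> _ _ _   = refl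
  ... | tri> _ _ _   | tri< _ _ _   = refl
  ... | tri≈ _ _ _   | tri≈ _ _ _   = refl
  ... | tri< u<v _ _ | tri< _ _ u≮v = contradiction u<v u≮v
  ... | tri< _ u≢v _ | tri≈ _ v≡u _ = contradiction (sym v≡u) u≢v
  ... | tri≈ _ u≡v _ | tri< _ v≢u _ = contradiction (sym u≡v) v≢u
  ... | tri≈ _ u≡v _ | tri> _ v≢u _ = contradiction (sym u≡v) v≢u
  ... | tri> _ u≢v _ | tri≈ _ v≡u _ = contradiction (sym v≡u) u≢v
  ... | tri> _ _ v<u | tri> v≮u _ _ = contradiction v<u v≮u

  value : ℕ → Fin n → Fin n → Fin k → ℚ
  value l u v i = approx (pairs u v i) l

  value-sym : ∀ l u v i → value l u v i ≡ value l v u i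
  value-sym l u v i = cong (λ w → approx (w i) l) (pairs-sym u v)

  pairs-elim : (P : Vector ℝ k → Set) → P (λ _ → 0ℝ) → (∀ a → P (h a)) → ∀ u v → P (pairs u v)
  pairs-elim P P0 Ph u v with Fin.<-cmp u v
  ... | tri< u<v _ _ = Ph (edge u v u<v (K-adj u<v))
  ... | tri≈ _ _ _   = P0
  ... | tri> _ _ v<u = Ph (edge v u v<u (K-adj v<u))

  -- A bound by `1ℝ` bounds the approximations only by `1 + ε`, from some index on; `ε = 1` is good
  -- enough and only affects the absolute constant.
  pairs-norm : (∀ a → ‖ h a ‖₁ ≤ℝ 1ℝ) → ∀ u v → ∃[ N ] (∀ l → N ℕ.≤ l → ‖ value l u v ‖ ≤ 2ℚ)
  pairs-norm h≤1 = pairs-elim Bounded (0 , λ l _ → zero-bound) (λ a → norm-bound (h a) (h≤1 a))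
    where
    Bounded : Vector ℝ k → Set
    Bounded w = ∃[ N ] (∀ l → N ℕ.≤ l → ‖ (λ i → approx (w i) l) ‖ ≤ 2ℚ)
    zero-bound : ‖ (λ (_ : Fin k) → 0ℚ) ‖ ≤ 2ℚ
    zero-bound = ≤-trans (≤-reflexive (‖‖-zero λ _ → refl)) (0≤p+q 0≤1 0≤1)
    norm-bound : ∀ w → ‖ w ‖₁ ≤ℝ 1ℝ → Bounded w
    norm-bound w w≤1 = proj₁ (w≤1 1ℚ (positive⁻¹ 1ℚ)) , λ l N≤l →
      subst (_≤ 2ℚ) (approx-‖‖ w l) (proj₂ (w≤1 1ℚ (positive⁻¹ 1ℚ)) l N≤l)

  total-double : ∀ (G : Graph (Fin n)) (G⊆K : G ⊆ K n) i l →
    2ℚ * approx (total (K n) G h G⊆K i) l ≡ adjacencies G (λ u v → value l u v i)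
  total-double G G⊆K i l = begin-equality
    2ℚ * approx (total (K n) G h G⊆K i) l ≡⟨ cong (2ℚ *_) (approx-total (K n) G h G⊆K i l) ⟩
    2ℚ * Σˡ (edges G) (λ a → approx (h (include G (K n) G⊆K a) i) l)
      ≡⟨ cong (2ℚ *_) (Σˡ-cong (edges G) λ { (edge u v u<v uv) → cong (λ w → approx (w i) l) (sym (pairs-edge u v u<v (G⊆K u v uv))) }) ⟩
    2ℚ * S ≡⟨ double S ⟩
    S + S ≡⟨ edgeSum-double G (λ u v → value l u v i) (λ u v → value-sym l u v i) ⟩
    adjacencies G (λ u v → value l u v i) ∎
    where
    S : ℚ
    S = edgeSum G (λ u v → value l u v i)
    double : ∀ x → 2ℚ * x ≡ x + x
    double = solve-∀ ℚ-ring

  module _ (G : Graph (Fin n)) (G⊆K : G ⊆ K n) (l : ℕ) where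

    -- Twice the vector whose norm is the discrepancy: sums over ordered pairs count every edge in
    -- both directions, and the ratio of the edge numbers stays the same.
    deviation : Fin k → ℚ
    deviation i = adjacencies G (λ u v → value l u v i) - (e G ÷ e (K n)) * adjacencies (K n) (λ u v → value l u v i)

    private
      tG tK : Fin k → ℚ
      tG i = approx (total (K n) G h G⊆K i) l
      tK i = approx (total (K n) (K n) h (λ _ _ uv → uv) i) l
      ratio : ℚ
      ratio = e G ÷ e (K n)
      half : Fin k → ℚ
      half i = tG i + - 1ℚ * (ratio * tK i)
      discrepancy≡ : approx (discrepancy (K n) G h G⊆K) l ≡ ‖ half ‖
      discrepancy≡ = approx-‖‖ (λ i → total (K n) G h G⊆K i -ℝ (e G ÷ e (K n)) · total (K n) (K n) h (λ _ _ uv → uv) i) l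
      expand : ∀ x q y → 2ℚ * (x + - 1ℚ * (q * y)) ≡ 2ℚ * x - q * (2ℚ * y)
      expand = solve-∀ ℚ-ring
      2half : ∀ i → 2ℚ * half i ≡ deviation i
      2half i = trans (expand (tG i) ratio (tK i))
        (cong₂ (λ x y → x - ratio * y) {2ℚ * tG i} {adjacencies G (λ u v → value l u v i)} {2ℚ * tK i} {adjacencies (K n) (λ u v → value l u v i)}
          (total-double G G⊆K i l) (total-double (K n) (λ _ _ uv → uv) i l))

    discrepancy-deviation : 2ℚ * approx (discrepancy (K n) G h G⊆K) l ≡ ‖ deviation ‖
    discrepancy-deviation = trans (cong (2ℚ *_) {approx (discrepancy (K n) G h G⊆K) l} {‖ half ‖} discrepancy≡)
      (trans (sym (‖‖-* (0≤p+q 0≤1 0≤1) half)) (‖‖-cong 2half))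

-- Subtracting the mean

one : ∀ {n} → Fin n → Fin n → ℚ
one _ _ = 1ℚ

module _ {n} (G : Graph (Fin n)) where

  adjacencies-- : ∀ x y → adjacencies G (λ u v → x u v - y u v) ≡ adjacencies G x - adjacencies G y
  adjacencies-- x y = trans (∑-cong λ u → trans (∑-cong λ v → dist (𝟙 (adj G u v)) (x u v) (y u v))
      (∑-- (λ v → 𝟙 (adj G u v) * x u v) (λ v → 𝟙 (adj G u v) * y u v)))
    (∑-- (λ u → ∑[ v ∈ Fin n ] (𝟙 (adj G u v) * x u v)) (λ u → ∑[ v ∈ Fin n ] (𝟙 (adj G u v) * y u v)))
    where
    dist : ∀ b x y → b * (x - y) ≡ b * x - b * y
    dist = solve-∀ ℚ-ring

  adjacencies-* : ∀ q x → adjacencies G (λ u v → x u v * q) ≡ adjacencies G x * q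
  adjacencies-* q x = trans (∑-cong λ u → trans (∑-cong λ v → sym (*-assoc (𝟙 (adj G u v)) (x u v) q))
      (∑-*ʳ q (λ v → 𝟙 (adj G u v) * x u v)))
    (∑-*ʳ q (λ u → ∑[ v ∈ Fin n ] (𝟙 (adj G u v) * x u v)))

  adjacencies-const : ∀ q → adjacencies G (λ _ _ → q) ≡ adjacencies G one * q
  adjacencies-const q = trans (∑-cong λ u → ∑-cong λ v → cong (𝟙 (adj G u v) *_) (sym (*-identityˡ q))) (adjacencies-* q one)

  0≤adjacencies : 0ℚ ≤ adjacencies G one
  0≤adjacencies = ∑-nonneg λ u → ∑-nonneg λ v → 0≤p*q (0≤𝟙 (adj G u v)) 0≤1

  adjacencies-bound : ∀ {k} (x : Fin n → Fin n → Fin k → ℚ) {η} → (∀ u v → ‖ x u v ‖ ≤ η) →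
    ‖ (λ i → adjacencies G (λ u v → x u v i)) ‖ ≤ adjacencies G one * η
  adjacencies-bound x {η} x≤η = ≤-trans (≤-trans (‖‖-∑ (λ u i → ∑[ v ∈ Fin n ] (𝟙 (adj G u v) * x u v i)))
      (∑-mono λ u → ≤-trans (‖‖-∑ (λ v i → 𝟙 (adj G u v) * x u v i)) (∑-mono λ v →
        ≤-trans (≤-reflexive (‖‖-* (0≤𝟙 (adj G u v)) (x u v))) (*-monoˡ (𝟙 (adj G u v)) (0≤𝟙 (adj G u v)) (x≤η u v)))))
    (≤-reflexive (adjacencies-const η))

K-count : ∀ n → adjacencies (K (suc n)) one ≡ ι (suc n) * ι n
K-count n = begin-equality
  adjacencies (K (suc n)) one ≡⟨ ∑-cong (λ u → ∑-cong λ v → entry u v) ⟩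
  ∑[ u ∈ _ ] ∑[ v ∈ _ ] (1ℚ - δ u v) ≡⟨ ∑-cong row-count ⟩
  ∑[ u ∈ Fin (suc n) ] ι n ≡⟨ ∑-Fin-const (suc n) (ι n) ⟩
  ι (suc n) * ι n ∎
  where
  entry : ∀ (u v : Fin (suc n)) → 𝟙 (adj (K (suc n)) u v) * 1ℚ ≡ 1ℚ - δ u v
  entry u v with u Fin.≟ v
  ... | yes _ = refl
  ... | no _  = refl
  row-count : ∀ (u : Fin (suc n)) → ∑[ v ∈ _ ] (1ℚ - δ u v) ≡ ι n
  row-count u = begin-equality
    ∑[ v ∈ Fin (suc n) ] (1ℚ - δ u v) ≡⟨ ∑-- (λ _ → 1ℚ) (δ u) ⟩
    ∑[ v ∈ Fin (suc n) ] 1ℚ - ∑ (δ u) ≡⟨ cong₂ _-_ {∑[ v ∈ Fin (suc n) ] 1ℚ} {ι (suc n) * 1ℚ} {∑ (δ u)} {1ℚ}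
                                                         (∑-Fin-const (suc n) 1ℚ) (trans (∑-cong λ v → sym (*-identityʳ (δ u v))) (∑-δˡ u (λ _ → 1ℚ))) ⟩
    (1ℚ + ι n) * 1ℚ - 1ℚ ≡⟨ lemma (ι n) ⟩
    ι n ∎
    where
    lemma : ∀ x → (1ℚ + x) * 1ℚ - 1ℚ ≡ x
    lemma = solve-∀ ℚ-ring

÷-double : ∀ a b {x y ν} → ι a + ι a ≡ x → ι b + ι b ≡ y → y * ν ≡ 1ℚ → a ÷ b ≡ x * ν
-- The default value of `÷` at zero is excluded here, since an empty edge set would make `y` zero.
÷-double a zero    {ν = ν} _ refl yν≡1 = contradiction (trans (sym yν≡1) (*-zeroˡ ν)) 1≢0
÷-double a (suc b) {ν = ν} refl refl yν≡1 = begin-equality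
  a ÷ suc b ≡⟨ *-identityʳ (a ÷ suc b) ⟨
  (a ÷ suc b) * 1ℚ ≡⟨ cong ((a ÷ suc b) *_) yν≡1 ⟨
  (a ÷ suc b) * ((ι (suc b) + ι (suc b)) * ν) ≡⟨ lemma (a ÷ suc b) (ι (suc b)) ν ⟩
  ((a ÷ suc b) * ι (suc b) + (a ÷ suc b) * ι (suc b)) * ν ≡⟨ cong (λ t → (t + t) * ν) (÷-cancel a b) ⟩
  (ι a + ι a) * ν ∎
  where
  lemma : ∀ q i ν → q * ((i + i) * ν) ≡ (q * i + q * i) * ν
  lemma = solve-∀ ℚ-ring

module _ {n″ : ℕ} where
  private
    n : ℕ
    n = suc (suc n″)

  -- The reciprocal of the number `n (n - 1)` of ordered pairs of distinct vertices.
  ν : ℚ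
  ν = ρ (suc n″) * ρ n″

  0≤ν : 0ℚ ≤ ν
  0≤ν = 0≤p*q (0≤ρ (suc n″)) (0≤ρ n″)

  K-one : adjacencies (K n) one * ν ≡ 1ℚ
  K-one = begin-equality
    adjacencies (K n) one * ν ≡⟨ cong (_* ν) (K-count (suc n″)) ⟩
    ι n * ι (suc n″) * (ρ (suc n″) * ρ n″) ≡⟨ lemma (ι n) (ι (suc n″)) (ρ (suc n″)) (ρ n″) ⟩
    (ι n * ρ (suc n″)) * (ι (suc n″) * ρ n″) ≡⟨ cong₂ _*_ {ι n * ρ (suc n″)} {1ℚ} {ι (suc n″) * ρ n″} {1ℚ} (ι*ρ (suc n″)) (ι*ρ n″) ⟩
    1ℚ ∎
    where
    lemma : ∀ a b c d → a * b * (c * d) ≡ (a * c) * (b * d)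
    lemma = solve-∀ ℚ-ring

  ratio-ν : ∀ (G : Graph (Fin n)) → e G ÷ e (K n) ≡ adjacencies G one * ν
  ratio-ν G = ÷-double (e G) (e (K n)) (edge-count G) (edge-count (K n)) K-one

  -- `deviation` as a linear function of the array of weights, so that a later approximation can be
  -- compared with a fixed one through their difference.
  dev : ∀ {k} → Graph (Fin n) → (Fin n → Fin n → Fin k → ℚ) → Fin k → ℚ
  dev G x i = adjacencies G (λ u v → x u v i) - adjacencies G one * ν * adjacencies (K n) (λ u v → x u v i)

  dev-- : ∀ {k} G (x y : Fin n → Fin n → Fin k → ℚ) i → dev G x i ≡ dev G (λ u v i → x u v i - y u v i) i + dev G y i
  dev-- G x y i = sym (trans (cong (_+ dev G y i) (cong₂ (λ s t → s - adjacencies G one * ν * t)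
      {adjacencies G (λ u v → x u v i - y u v i)} {adjacencies G x′ - adjacencies G y′}
      {adjacencies (K n) (λ u v → x u v i - y u v i)} {adjacencies (K n) x′ - adjacencies (K n) y′}
      (adjacencies-- G x′ y′) (adjacencies-- (K n) x′ y′)))
    (lemma (adjacencies G x′) (adjacencies G y′) (adjacencies G one * ν) (adjacencies (K n) x′) (adjacencies (K n) y′)))
    where
    x′ y′ : Fin n → Fin n → ℚ
    x′ u v = x u v i
    y′ u v = y u v i
    lemma : ∀ a b q c d → a - b - q * (c - d) + (b - q * d) ≡ a - q * c
    lemma = solve-∀ ℚ-ring

  dev-bound : ∀ {k} G (x : Fin n → Fin n → Fin k → ℚ) {η} → (∀ u v → ‖ x u v ‖ ≤ η) → ‖ dev G x ‖ ≤ 2ℚ * (adjacencies G one * η)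
  dev-bound G x {η} x≤η = begin
    ‖ dev G x ‖ ≤⟨ ‖‖-- (λ i → adjacencies G (λ u v → x u v i)) (λ i → q * A i) ⟩
    _ ≤⟨ +-mono-≤ (adjacencies-bound G x x≤η) (≤-trans (≤-reflexive (‖‖-* 0≤q A)) (*-monoˡ q 0≤q (adjacencies-bound (K n) x x≤η))) ⟩
    N * η + N * ν * (adjacencies (K n) one * η) ≡⟨ collect N η ν (adjacencies (K n) one) ⟩
    N * η + N * η * (adjacencies (K n) one * ν) ≡⟨ cong (λ t → N * η + N * η * t) K-one ⟩
    N * η + N * η * 1ℚ ≡⟨ double (N * η) ⟩
    2ℚ * (N * η) ∎
    where
    N q : ℚ
    N = adjacencies G one
    q = N * ν
    0≤q : 0ℚ ≤ q
    0≤q = 0≤p*q (0≤adjacencies G) 0≤ν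
    A : _ → ℚ
    A i = adjacencies (K n) (λ u v → x u v i)
    collect : ∀ N η ν a → N * η + N * ν * (a * η) ≡ N * η + N * η * (a * ν)
    collect = solve-∀ ℚ-ring
    double : ∀ t → t + t * 1ℚ ≡ 2ℚ * t
    double = solve-∀ ℚ-ring

  -- The entries of h minus its mean have norm at most 4, hence the factor ρ 3 = 1/4.
  module Centre {k} (x : Fin n → Fin n → Fin k → ℚ) (x-sym : ∀ u v i → x u v i ≡ x v u i) (x≤2 : ∀ u v → ‖ x u v ‖ ≤ 2ℚ) where

    A μ : Fin k → ℚ
    A i = adjacencies (K n) (λ u v → x u v i)
    μ i = ν * A i

    μ≤2 : ‖ μ ‖ ≤ 2ℚ
    μ≤2 = begin
      ‖ μ ‖ ≡⟨ ‖‖-* 0≤ν A ⟩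
      ν * ‖ A ‖ ≤⟨ *-monoˡ ν 0≤ν (adjacencies-bound (K n) x x≤2) ⟩
      ν * (adjacencies (K n) one * 2ℚ) ≡⟨ collect ν (adjacencies (K n) one) ⟩
      adjacencies (K n) one * ν * 2ℚ ≡⟨ cong (_* 2ℚ) K-one ⟩
      1ℚ * 2ℚ ≡⟨⟩
      2ℚ ∎
      where
      collect : ∀ ν a → ν * (a * 2ℚ) ≡ a * ν * 2ℚ
      collect = solve-∀ ℚ-ring

    -- The indicator restores the zero diagonal, which the subtraction of `μ` would destroy.
    entry : Fin n → Fin n → Fin k → ℚ
    entry u v i = ρ 3 * (𝟙 (adj (K n) u v) * (x u v i - μ i))

    entry-bound : ∀ u v → ‖ entry u v ‖ ≤ 1ℚ
    entry-bound u v = begin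
      ‖ entry u v ‖ ≡⟨ ‖‖-* (0≤ρ 3) (λ i → 𝟙 (adj (K n) u v) * (x u v i - μ i)) ⟩
      ρ 3 * ‖ (λ i → 𝟙 (adj (K n) u v) * (x u v i - μ i)) ‖ ≡⟨ cong (ρ 3 *_) (‖‖-* (0≤𝟙 (adj (K n) u v)) (λ i → x u v i - μ i)) ⟩
      ρ 3 * (𝟙 (adj (K n) u v) * ‖ (λ i → x u v i - μ i) ‖)
        ≤⟨ *-monoˡ (ρ 3) (0≤ρ 3) (*-mono 0≤1 (0≤‖‖ (λ i → x u v i - μ i)) (𝟙≤1 (adj (K n) u v)) (≤-trans (‖‖-- (x u v) μ) (+-mono-≤ (x≤2 u v) μ≤2))) ⟩
      ρ 3 * (1ℚ * (2ℚ + 2ℚ)) ≡⟨ ρ*ι 3 ⟩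
      1ℚ ∎
      where
      𝟙≤1 : ∀ b → 𝟙 b ≤ 1ℚ
      𝟙≤1 true  = ≤-refl
      𝟙≤1 false = 0≤1

    kernel : Kernel (Fin n) k
    kernel = record
      { at       = entry
      ; at-sym   = λ u v i → cong₂ (λ b t → ρ 3 * (𝟙 b * (t - μ i))) (symmetric (K n) u v) (x-sym u v i)
      ; at-diag  = λ u i → trans (cong (λ b → ρ 3 * (𝟙 b * (x u u i - μ i))) (loopless (K n) u)) (vanish (ρ 3) (x u u i - μ i))
      ; at-bound = entry-bound }
      where
      vanish : ∀ p q → p * (0ℚ * q) ≡ 0ℚ
      vanish = solve-∀ ℚ-ring

    kernel-mass : ∀ i → mass kernel i ≡ 0ℚ
    kernel-mass i = begin-equality
      mass kernel i
        ≡⟨ trans (∑-cong λ u → ∑-* (ρ 3) (λ v → 𝟙 (adj (K n) u v) * (x u v i - μ i))) (∑-* (ρ 3) (λ u → ∑[ v ∈ Fin n ] (𝟙 (adj (K n) u v) * (x u v i - μ i)))) ⟩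
      ρ 3 * adjacencies (K n) (λ u v → x u v i - μ i)
        ≡⟨ cong (ρ 3 *_) (trans (adjacencies-- (K n) (λ u v → x u v i) (λ _ _ → μ i)) (cong (λ t → A i - t) (adjacencies-const (K n) (μ i)))) ⟩
      ρ 3 * (A i - adjacencies (K n) one * (ν * A i))
        ≡⟨ collect (ρ 3) (A i) (adjacencies (K n) one) ν ⟩
      ρ 3 * (A i - adjacencies (K n) one * ν * A i)
        ≡⟨ cong (λ t → ρ 3 * (A i - t * A i)) K-one ⟩
      ρ 3 * (A i - 1ℚ * A i)
        ≡⟨ vanish (ρ 3) (A i) ⟩
      0ℚ ∎
      where
      collect : ∀ p a c ν → p * (a - c * (ν * a)) ≡ p * (a - c * ν * a)
      collect = solve-∀ ℚ-ring
      vanish : ∀ p a → p * (a - 1ℚ * a) ≡ 0ℚ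
      vanish = solve-∀ ℚ-ring

    module _ {m r} (F : Graph (Fin r)) (φ : Fin n ↔ (Fin m × Fin r)) (π : (Fin m × Fin r) ↔ (Fin m × Fin r)) where

      -- `π` tells which point is taken to a position, whereas `factor` asks for the position of a
      -- vertex; hence the inverse.
      ψ : Fin n ↔ (Fin m × Fin r)
      ψ = ↔-sym π ↔-∘ φ

      -- Subtracting `μ` at each adjacency of the copy subtracts exactly the expected share of the
      -- total that occurs in `dev`. The factor 4 undoes the scaling of the kernel.
      dev-weighted : ∀ i → dev (factor F ψ) x i ≡ ι 4 * weighted (λ a b → 𝟙 (adj F a b)) (rename π (rename (↔-sym φ) kernel)) i
      dev-weighted i = sym (begin-equality
        ι 4 * weighted (λ a b → 𝟙 (adj F a b)) (rename π (rename (↔-sym φ) kernel)) i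
          ≡⟨ cong (λ t → ι 4 * t) {weighted (λ a b → 𝟙 (adj F a b)) (rename π (rename (↔-sym φ) kernel)) i} {copySum F ψ (λ u v → entry u v i)} unfold ⟩
        ι 4 * copySum F ψ (λ u v → entry u v i)
          ≡⟨ cong (λ t → ι 4 * t) {copySum F ψ (λ u v → entry u v i)} {copySum F ψ (λ u v → (x u v i - μ i) * ρ 3)} simplify ⟩
        ι 4 * copySum F ψ (λ u v → (x u v i - μ i) * ρ 3)
          ≡⟨ cong (λ t → ι 4 * t) {copySum F ψ (λ u v → (x u v i - μ i) * ρ 3)} {(S - N * μ i) * ρ 3} distribute ⟩
        ι 4 * ((S - N * (ν * A i)) * ρ 3)
          ≡⟨ collect (ι 4) S N ν (A i) (ρ 3) ⟩
        (ι 4 * ρ 3) * (S - N * ν * A i)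
          ≡⟨ cong (_* (S - N * ν * A i)) (ι*ρ 3) ⟩
        1ℚ * (S - N * ν * A i)
          ≡⟨ *-identityˡ (S - N * ν * A i) ⟩
        dev (factor F ψ) x i ∎)
        where
        f = Inverse.from ψ
        S N : ℚ
        S = adjacencies (factor F ψ) (λ u v → x u v i)
        N = adjacencies (factor F ψ) one
        unfold : weighted (λ a b → 𝟙 (adj F a b)) (rename π (rename (↔-sym φ) kernel)) i ≡ copySum F ψ (λ u v → entry u v i)
        unfold = trans (cong (λ y → weighted (λ a b → 𝟙 (adj F a b)) y i) (rename-pull π (rename (↔-sym φ) kernel)))
          (cong (λ y → weighted (λ a b → 𝟙 (adj F a b)) (pull (Inverse.to π) y) i) (rename-pull (↔-sym φ) kernel))
        edge-entry : ∀ j a b → 𝟙 (adj F a b) * entry (f (j , a)) (f (j , b)) i ≡ 𝟙 (adj F a b) * ((x (f (j , a)) (f (j , b)) i - μ i) * ρ 3)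
        edge-entry j a b with f (j , a) Fin.≟ f (j , b)
        ... | no _ = cong (𝟙 (adj F a b) *_) (lemma (ρ 3) (x (f (j , a)) (f (j , b)) i - μ i))
          where
          lemma : ∀ p t → p * (1ℚ * t) ≡ t * p
          lemma = solve-∀ ℚ-ring
        -- The clearing of the diagonal in `entry` is invisible here: equal images force `a ≡ b`,
        -- and `F` has no loops.
        ... | yes eq = nonadjacent (ρ 3 * (0ℚ * (x (f (j , a)) (f (j , b)) i - μ i))) ((x (f (j , a)) (f (j , b)) i - μ i) * ρ 3) a≁b
          where
          nonadjacent : ∀ p q {c} → c ≡ false → 𝟙 c * p ≡ 𝟙 c * q
          nonadjacent p q refl = trans (*-zeroˡ p) (sym (*-zeroˡ q))
          a≡b : a ≡ b
          a≡b = cong proj₂ (trans (sym (Inverse.strictlyInverseˡ ψ (j , a))) (trans (cong (Inverse.to ψ) eq) (Inverse.strictlyInverseˡ ψ (j , b))))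
          a≁b : adj F a b ≡ false
          a≁b = subst (λ c → adj F a c ≡ false) a≡b (loopless F a)
        simplify : copySum F ψ (λ u v → entry u v i) ≡ copySum F ψ (λ u v → (x u v i - μ i) * ρ 3)
        simplify = ∑-cong λ j → ∑-cong λ a → ∑-cong λ b → edge-entry j a b
        distribute : copySum F ψ (λ u v → (x u v i - μ i) * ρ 3) ≡ (S - N * μ i) * ρ 3
        distribute = trans (sym (adjacencies-factor F ψ (λ u v → (x u v i - μ i) * ρ 3)))
          (trans (adjacencies-* (factor F ψ) (ρ 3) (λ u v → x u v i - μ i))
          (cong (_* ρ 3) (trans (adjacencies-- (factor F ψ) (λ u v → x u v i) (λ _ _ → μ i)) (cong (λ t → S - t) (adjacencies-const (factor F ψ) (μ i))))))
        collect : ∀ c s q ν a p → c * ((s - q * (ν * a)) * p) ≡ (c * p) * (s - q * ν * a)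
        collect = solve-∀ ℚ-ring

-- Passing to a single index of the Cauchy sequences

Eventually : (ℕ → Set) → Set
Eventually P = ∃[ N ] (∀ l → N ℕ.≤ l → P l)

eventually-all : ∀ {n} {P : Fin n → ℕ → Set} → (∀ i → Eventually (P i)) → Eventually (λ l → ∀ i → P i l)
eventually-all {zero}  ev = 0 , λ _ _ ()
eventually-all {suc n} ev =
  let M , p = ev zero
      N , q = eventually-all (ev ∘ suc)
  in M ℕ.⊔ N , λ l ≤l → λ { zero → p l (ℕ.m⊔n≤o⇒m≤o M N ≤l) ; (suc i) → q l (ℕ.m⊔n≤o⇒n≤o M N ≤l) i }

module _ {n k} (h : Edge (K n) → Vector ℝ k) (h≤1 : ∀ a → ‖ h a ‖₁ ≤ℝ 1ℝ) {ε : ℚ} (0<ε : 0ℚ < ε) where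

  Stable : ℕ → Set
  Stable N = ∀ l → N ℕ.≤ l → ∀ u v → ‖ (λ i → value h l u v i - value h N u v i) ‖ ≤ ι k * ε

  Bounded : ℕ → Set
  Bounded N = ∀ u v → ‖ value h N u v ‖ ≤ 2ℚ

  -- There are finitely many pairs and coordinates, so one index serves all of them. Beyond it each
  -- coordinate moves by at most `ε`, hence the norm by at most `ι k * ε`.
  settled : ∃[ N ] Stable N × Bounded N
  settled = N , stable , bounded
    where
    Close : Fin n → Fin n → Fin k → ℕ → Set
    Close u v i M = ∀ l → M ℕ.≤ l → ∣ value h l u v i - value h M u v i ∣ ≤ ε
    close : Eventually (λ M → ∀ u v i → Close u v i M)
    close = eventually-all λ u → eventually-all λ v → eventually-all λ i →
      let N , p = cauchy (pairs h u v i) ε 0<ε in N , λ M N≤M l M≤l → p l M (ℕ.≤-trans N≤M M≤l) N≤M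
    small : Eventually Bounded
    small = eventually-all λ u → eventually-all λ v → pairs-norm h h≤1 u v
    N : ℕ
    N = proj₁ close ℕ.⊔ proj₁ small
    stable : Stable N
    stable l N≤l u v = ‖‖≤ (λ i → value h l u v i - value h N u v i)
      λ i → proj₂ close N (ℕ.m≤m⊔n (proj₁ close) (proj₁ small)) u v i l N≤l
    bounded : Bounded N
    bounded = proj₂ small N (ℕ.m≤n⊔m (proj₁ close) (proj₁ small))

total-adjacency : ∀ {r} → Graph (Fin r) → ℚ
total-adjacency {r} F = ∑[ a ∈ Fin r ] ∑[ b ∈ Fin r ] 𝟙 (adj F a b)

total-adjacency≤ : ∀ {r} (F : Graph (Fin r)) → total-adjacency F ≤ ι r * ι (maxDegree F)
total-adjacency≤ F = ∑≤ _ (degree-sum F)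

factor-count : ∀ {m r n} (F : Graph (Fin r)) (ψ : Fin n ↔ (Fin m × Fin r)) → adjacencies (factor F ψ) one ≡ ι m * total-adjacency F
factor-count {m} F ψ = trans (adjacencies-factor F ψ one)
  (trans (∑-cong λ _ → ∑-cong λ a → ∑-cong λ b → *-identityʳ (𝟙 (adj F a b))) (∑-Fin-const m (total-adjacency F)))

opaque
  -- `4 * 260` bounds the deviation at the fixed index, and 2 its change at later indices. As the
  -- deviation is twice the discrepancy, a factor 2 is given away in `halve-≤`.
  constant : ℚ
  constant = ι 4 * ι 260 + 2ℚ

  constant-def : constant ≡ ι 4 * ι 260 + 2ℚ
  constant-def = refl

0≤constant : 0ℚ ≤ constant
0≤constant = subst (0ℚ ≤_) (sym constant-def) (0≤p+q (0≤p*q (0≤ι 4) (0≤ι 260)) (0≤p+q 0≤1 0≤1))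

halve-≤ : ∀ {p q} → 0ℚ ≤ p → 2ℚ * p ≤ q → p ≤ q
halve-≤ {p} 0≤p 2p≤q = ≤-trans (≤-by p 0≤p (double p)) 2p≤q
  where
  double : ∀ x → 2ℚ * x ≡ x + x
  double = solve-∀ ℚ-ring

0≤discrepancy : ∀ {n k} (h : Edge (K n) → Vector ℝ k) G (G⊆K : G ⊆ K n) l → 0ℚ ≤ approx (discrepancy (K n) G h G⊆K) l
0≤discrepancy {n} h G G⊆K l = subst (0ℚ ≤_)
  (sym (approx-‖‖ (λ i → total (K n) G h G⊆K i -ℝ (e G ÷ e (K n)) · total (K n) (K n) h (λ _ _ uv → uv) i) l)) (0≤‖‖ _)

opaque
  BalancedCopy : ∀ {n k} → Graph (Fin n) → (Edge (K n) → Vector ℝ k) → ℚ → Set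
  BalancedCopy {n} H h q = ∃[ H′ ] H′ ≅ H × ∃[ H′⊆K ] discrepancy (K n) H′ h H′⊆K ≤ℝ q · fromℚ constant

  balancedCopy : ∀ {n k} {H : Graph (Fin n)} {h : Edge (K n) → Vector ℝ k} {q} G → G ≅ H → (G⊆K : G ⊆ K n) →
    discrepancy (K n) G h G⊆K ≤ℝ q · fromℚ constant → BalancedCopy H h q
  balancedCopy G G≅H G⊆K bound = G , G≅H , G⊆K , bound

  unpack : ∀ {n k} {H : Graph (Fin n)} {h : Edge (K n) → Vector ℝ k} {q} → BalancedCopy H h q →
    ∃[ H′ ] H′ ≅ H × ∃[ H′⊆K ] discrepancy (K n) H′ h H′⊆K ≤ℝ q · fromℚ constant
  unpack balanced = balanced

numeral : ∀ d r k → ι d * ι r * (ι k * ι k) ≡ ℤ.+ (d ℕ.* r ℕ.* k ℕ.^ 2) / 1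
numeral d r k = trans (sym product) (ι≡/1 (d ℕ.* r ℕ.* k ℕ.^ 2))
  where
  product : ι (d ℕ.* r ℕ.* k ℕ.^ 2) ≡ ι d * ι r * (ι k * ι k)
  product = trans (ι-* (d ℕ.* r) (k ℕ.^ 2)) (cong₂ _*_ {ι (d ℕ.* r)} {ι d * ι r} {ι (k ℕ.^ 2)} {ι k * ι k}
    (ι-* d r) (trans (cong ι (cong (k ℕ.*_) (ℕ.*-identityʳ k))) (ι-* k k)))

weaken : ∀ {p q ε} → 0ℚ < ε → p ≤ q → p ≤ q + ε
weaken {p} {q} {ε} 0<ε p≤q = ≤-trans p≤q (≤-by ε (<⇒≤ 0<ε) refl)

conclude : ∀ {n k} (h : Edge (K n) → Vector ℝ k) (G : Graph (Fin n)) (G⊆K : G ⊆ K n) q (N : ℕ) →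
  (∀ l → N ℕ.≤ l → ‖ deviation h G G⊆K l ‖ ≤ q * constant) → discrepancy (K n) G h G⊆K ≤ℝ q · fromℚ constant
conclude h G G⊆K q N bound ε 0<ε = N , λ l N≤l → weaken 0<ε
  (halve-≤ (0≤discrepancy h G G⊆K l) (≤-trans (≤-reflexive (discrepancy-deviation h G G⊆K l)) (bound l N≤l)))

-- The case of blobs with at least two points

module Large {n″ r″ k′ : ℕ} (r∣n : suc (suc r″) ∣ suc (suc n″)) (F : Graph (Fin (suc (suc r″))))
  (φ : Fin (suc (suc n″)) ↔ (Fin (suc (suc n″) ℕ./ suc (suc r″)) × Fin (suc (suc r″))))
  (h : Edge (K (suc (suc n″))) → Vector ℝ (suc k′)) where

  n r k m : ℕ
  n = suc (suc n″)
  r = suc (suc r″)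
  k = suc k′
  m = n ℕ./ r

  f : ℚ
  f = total-adjacency F

  module _ (N : ℕ) (stable : ∀ l → N ℕ.≤ l → ∀ u v → ‖ (λ i → value h l u v i - value h N u v i) ‖ ≤ ι k * ρ (suc n″))
    (bounded : ∀ u v → ‖ value h N u v ‖ ≤ 2ℚ) where

    module C = Centre (value h N) (value-sym h N) bounded

    z : Kernel (Fin m × Fin r) k
    z = rename (↔-sym φ) C.kernel

    Balanced : (Fin m × Fin r) ↔ (Fin m × Fin r) → Set
    Balanced π = ‖ weighted (λ a b → 𝟙 (adj F a b)) (rename π z) ‖ ≤ ι 260 * (ι k * ι k) * f

    placement : Σ[ π ∈ (Fin m × Fin r) ↔ (Fin m × Fin r) ] Balanced π
    placement = balanced-placement z (λ c → trans (mass-rename (↔-sym φ) C.kernel c) (C.kernel-mass c))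
      (λ a b → 𝟙 (adj F a b)) (λ a b → 0≤𝟙 (adj F a b)) (λ a → cong 𝟙 (loopless F a))

    module _ (π : (Fin m × Fin r) ↔ (Fin m × Fin r)) (balanced : Balanced π) where

      H′ : Graph (Fin n)
      H′ = factor F (C.ψ F φ π)

      dev-N : ‖ dev H′ (value h N) ‖ ≤ ι 4 * (ι 260 * (ι k * ι k) * (ι r * ι (maxDegree F)))
      dev-N = begin
        ‖ dev H′ (value h N) ‖ ≡⟨ ‖‖-cong (C.dev-weighted F φ π) ⟩
        ‖ (λ i → ι 4 * weighted (λ a b → 𝟙 (adj F a b)) (rename π z) i) ‖ ≡⟨ ‖‖-* (0≤ι 4) (weighted (λ a b → 𝟙 (adj F a b)) (rename π z)) ⟩
        ι 4 * ‖ weighted (λ a b → 𝟙 (adj F a b)) (rename π z) ‖ ≤⟨ *-monoˡ (ι 4) (0≤ι 4) balanced ⟩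
        ι 4 * (ι 260 * (ι k * ι k) * f)
          ≤⟨ *-monoˡ (ι 4) (0≤ι 4) (*-monoˡ (ι 260 * (ι k * ι k)) (0≤p*q (0≤ι 260) (0≤p*q (0≤ι k) (0≤ι k))) (total-adjacency≤ F)) ⟩
        ι 4 * (ι 260 * (ι k * ι k) * (ι r * ι (maxDegree F))) ∎

      count≤ : adjacencies H′ one ≤ ι n * ι (maxDegree F)
      count≤ = begin
        adjacencies H′ one ≡⟨ factor-count F (C.ψ F φ π) ⟩
        ι m * f ≤⟨ *-monoˡ (ι m) (0≤ι m) (total-adjacency≤ F) ⟩
        ι m * (ι r * ι (maxDegree F)) ≡⟨ *-assoc (ι m) (ι r) (ι (maxDegree F)) ⟨
        ι m * ι r * ι (maxDegree F) ≡⟨ cong (_* ι (maxDegree F)) (trans (sym (ι-* m r)) (cong ι (m/n*n≡m r∣n))) ⟩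
        ι n * ι (maxDegree F) ∎

      -- The precision `1 / n` is chosen for this: the copy has at most `n` times the maximum degree
      -- ordered adjacencies, so the errors add up to a bound without `n`.
      dev-change : ∀ l → N ℕ.≤ l → ‖ dev H′ (λ u v i → value h l u v i - value h N u v i) ‖ ≤ 2ℚ * (ι (maxDegree F) * ι k)
      dev-change l N≤l = begin
        ‖ dev H′ (λ u v i → value h l u v i - value h N u v i) ‖ ≤⟨ dev-bound H′ (λ u v i → value h l u v i - value h N u v i) (stable l N≤l) ⟩
        2ℚ * (adjacencies H′ one * (ι k * ρ (suc n″))) ≤⟨ *-monoˡ 2ℚ (0≤p+q 0≤1 0≤1) (*-monoʳ (ι k * ρ (suc n″)) (0≤p*q (0≤ι k) (0≤ρ (suc n″))) count≤) ⟩
        2ℚ * (ι n * ι (maxDegree F) * (ι k * ρ (suc n″))) ≡⟨ cong (2ℚ *_) (collect (ι n) (ι (maxDegree F)) (ι k) (ρ (suc n″))) ⟩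
        2ℚ * (ι n * ρ (suc n″) * (ι (maxDegree F) * ι k)) ≡⟨ cong (λ t → 2ℚ * (t * (ι (maxDegree F) * ι k))) (ι*ρ (suc n″)) ⟩
        2ℚ * (1ℚ * (ι (maxDegree F) * ι k)) ≡⟨ cong (2ℚ *_) (*-identityˡ (ι (maxDegree F) * ι k)) ⟩
        2ℚ * (ι (maxDegree F) * ι k) ∎
        where
        collect : ∀ n d k p → n * d * (k * p) ≡ n * p * (d * k)
        collect = solve-∀ ℚ-ring

      deviation≤ : ∀ l → N ℕ.≤ l → ‖ deviation h H′ (⊆-K H′) l ‖ ≤ (ι (maxDegree F) * ι r * (ι k * ι k)) * constant
      deviation≤ l N≤l = begin
        ‖ deviation h H′ (⊆-K H′) l ‖ ≡⟨ ‖‖-cong (λ i → cong (λ q → adjacencies H′ (λ u v → value h l u v i) - q * adjacencies (K n) (λ u v → value h l u v i)) (ratio-ν H′)) ⟩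
        ‖ dev H′ (value h l) ‖ ≡⟨ ‖‖-cong (dev-- H′ (value h l) (value h N)) ⟩
        ‖ (λ i → dev H′ (λ u v i → value h l u v i - value h N u v i) i + dev H′ (value h N) i) ‖
          ≤⟨ ‖‖-+ (dev H′ (λ u v i → value h l u v i - value h N u v i)) (dev H′ (value h N)) ⟩
        _ ≤⟨ +-mono-≤ (dev-change l N≤l) dev-N ⟩
        2ℚ * (ι (maxDegree F) * ι k) + ι 4 * (ι 260 * (ι k * ι k) * (ι r * ι (maxDegree F)))
          ≤⟨ ≤-by (2ℚ * (ι (maxDegree F) * (ι k * (ι r * (ι k - 1ℚ) + (ι r - 1ℚ)))))
               (0≤p*q (0≤p+q 0≤1 0≤1) (0≤p*q (0≤ι (maxDegree F)) (0≤p*q (0≤ι k)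
                 (0≤p+q (0≤p*q (0≤ι r) (0≤q-p (1≤ι k′))) (0≤q-p (1≤ι (suc r″)))))))
               (finish (ι (maxDegree F)) (ι r) (ι k)) ⟩
        (ι (maxDegree F) * ι r * (ι k * ι k)) * (ι 4 * ι 260 + 2ℚ) ≡⟨ cong ((ι (maxDegree F) * ι r * (ι k * ι k)) *_) constant-def ⟨
        (ι (maxDegree F) * ι r * (ι k * ι k)) * constant ∎
        where
        finish : ∀ d r k → (d * r * (k * k)) * (ι 4 * ι 260 + 2ℚ) ≡ 2ℚ * (d * k) + ι 4 * (ι 260 * (k * k) * (r * d)) + 2ℚ * (d * (k * (r * (k - 1ℚ) + (r - 1ℚ))))
        finish = solve-∀ ℚ-ring

  Settled : Set
  Settled = ∃[ N ] (∀ l → N ℕ.≤ l → ∀ u v → ‖ (λ i → value h l u v i - value h N u v i) ‖ ≤ ι k * ρ (suc n″)) × (∀ u v → ‖ value h N u v ‖ ≤ 2ℚ)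

  result : Settled → (H : Graph (Fin n)) → H ≅ copies m F → ∀ {q} → ι (maxDegree F) * ι r * (ι k * ι k) ≡ q → BalancedCopy H h q
  result (N , stable , bounded) H H≅ {q} q≡ = by (placement N stable bounded)
    where
    by : Σ[ π ∈ (Fin m × Fin r) ↔ (Fin m × Fin r) ] Balanced N stable bounded π → BalancedCopy H h q
    by (π , balanced) = balancedCopy {n} {k} {H} {h} {q} G (factor-≅ (C.ψ N stable bounded F φ π) H≅) (⊆-K G) (conclude {n} {k} h G (⊆-K G) q N bound)
      where
      G : Graph (Fin n)
      G = H′ N stable bounded π balanced
      bound : ∀ l → N ℕ.≤ l → ‖ deviation h G (⊆-K G) l ‖ ≤ q * constant
      bound l N≤l = subst (λ t → ‖ deviation h G (⊆-K G) l ‖ ≤ t * constant) q≡ (deviation≤ N stable bounded π balanced l N≤l)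

  result-settled : (∀ a → ‖ h a ‖₁ ≤ℝ 1ℝ) → (H : Graph (Fin n)) → H ≅ copies m F →
    ∀ {x y q} → ι r ≡ x → ι k ≡ y → ι (maxDegree F) * x * (y * y) ≡ q → BalancedCopy H h q
  result-settled h≤1 H H≅ {q = q} refl refl q≡ =
    result (settled {n} {k} h h≤1 {ρ (suc n″)} (positive⁻¹ (ρ (suc n″)) {{ρ-positive (suc n″)}})) H H≅ {q} q≡

-- For r = 1 there are no edges.
module _ {n m k} (F : Graph (Fin 1)) (φ : Fin n ↔ (Fin m × Fin 1)) (h : Edge (K n) → Vector ℝ k) where

  trivial : ∀ y → adjacencies (factor F φ) y ≡ 0ℚ
  trivial y = trans (adjacencies-factor F φ y) (∑-zero λ i → ∑-zero λ a → ∑-zero λ b → empty i a b)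
    where
    empty : ∀ i a b → 𝟙 (adj F a b) * y (Inverse.from φ (i , a)) (Inverse.from φ (i , b)) ≡ 0ℚ
    empty i zero zero = trans (cong (λ c → 𝟙 c * y (Inverse.from φ (i , zero)) (Inverse.from φ (i , zero))) (loopless F zero)) (*-zeroˡ (y (Inverse.from φ (i , zero)) (Inverse.from φ (i , zero))))

  no-edges : e (factor F φ) ≡ 0
  no-edges = ι-zero (e (factor F φ)) (≤-antisym
    (≤-trans (≤-by (ι (e (factor F φ))) (0≤ι (e (factor F φ))) refl) (≤-reflexive (trans (edge-count (factor F φ)) (trivial one))))
    (0≤ι (e (factor F φ))))

  trivial-deviation : ∀ l → ‖ deviation h (factor F φ) (⊆-K (factor F φ)) l ‖ ≡ 0ℚ
  trivial-deviation l = ‖‖-zero λ i → trans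
    (cong₂ (λ s q → s - q * A i) {adjacencies (factor F φ) (λ u v → value h l u v i)} {0ℚ} {e (factor F φ) ÷ e (K n)} {0ℚ}
      (trivial (λ u v → value h l u v i)) (trans (cong (_÷ e (K n)) no-edges) (0÷ (e (K n)))))
    (lemma (A i))
    where
    A : Fin k → ℚ
    A i = adjacencies (K n) (λ u v → value h l u v i)
    lemma : ∀ a → 0ℚ - 0ℚ * a ≡ 0ℚ
    lemma = solve-∀ ℚ-ring

no-discrepancy : ∀ {n m k} (F : Graph (Fin 1)) (H : Graph (Fin n)) (h : Edge (K n) → Vector ℝ k) → H ≅ copies m F → ∀ {q} → 0ℚ ≤ q → BalancedCopy H h q
no-discrepancy {n} {k = k} F H h H≅ {q} 0≤q = balancedCopy {n} {k} {H} {h} {q} (factor F φ) (factor-≅ φ H≅) (⊆-K (factor F φ))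
  (conclude {n} {k} h (factor F φ) (⊆-K (factor F φ)) q 0 λ l _ → ≤-trans (≤-reflexive (trivial-deviation F φ h l)) (0≤p*q 0≤q 0≤constant))
  where
  φ = _≅_.bijection H≅

solution : ∀ n r k .{{_ : ℕ.NonZero n}} .{{_ : ℕ.NonZero r}} .{{_ : ℕ.NonZero k}} → r ∣ n →
  (F : Graph (Fin r)) (H : Graph (Fin n)) → IsFactor F H →
  (h : Edge (K n) → Vector ℝ k) → (∀ a → ‖ h a ‖₁ ≤ℝ 1ℝ) → ∀ {q} → ι (maxDegree F) * ι r * (ι k * ι k) ≡ q → BalancedCopy H h q
solution zero    _ _ = contradiction refl (ℕ.≢-nonZero⁻¹ 0)
solution (suc _) zero _ = contradiction refl (ℕ.≢-nonZero⁻¹ 0)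
solution (suc _) (suc _) zero = contradiction refl (ℕ.≢-nonZero⁻¹ 0)
solution n@(suc _) (suc zero) k@(suc _) r∣n F H H≅ h h≤1 {q} q≡ =
  no-discrepancy {n} {n ℕ./ 1} {k} F H h H≅ {q} (subst (0ℚ ≤_) q≡ (0≤p*q (0≤p*q (0≤ι (maxDegree F)) (0≤ι 1)) (0≤p*q (0≤ι k) (0≤ι k))))
-- By divisibility `r ≥ 2` forces `n ≥ 2`, so `K n` has an edge in the remaining case.
solution (suc zero) (suc (suc r″)) (suc _) r∣n = contradiction (∣⇒≤ r∣n) λ { (ℕ.s≤s ()) }
solution (suc (suc n″)) (suc (suc r″)) (suc k′) r∣n F H H≅ h h≤1 {q} q≡ =
  Large.result-settled {n″} {r″} {k′} r∣n F (_≅_.bijection H≅) h h≤1 H H≅ {ι (suc (suc r″))} {ι (suc k′)} {q} refl refl q≡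

theorem3p8 : ∃[ C ] 0ℝ <ℝ C ×
    ((n r k : ℕ) .{{_ : ℕ.NonZero n}} .{{_ : ℕ.NonZero r}} .{{_ : ℕ.NonZero k}} →
    r ∣ n →
    (F : Graph (Fin r)) (H : Graph (Fin n)) → IsFactor F H →
    (h : Edge (K n) → Vector ℝ k) → (∀ a → ‖ h a ‖₁ ≤ℝ 1ℝ) →
    ∃[ H′ ] H′ ≅ H ×
    ∃[ H′⊆K ] discrepancy (K n) H′ h H′⊆K
    ≤ℝ (ℤ.+ (maxDegree F ℕ.* r ℕ.* k ℕ.^ 2) / 1) · C)
theorem3p8 = fromℚ constant , (1ℚ , positive⁻¹ 1ℚ , 0 , λ _ _ → positive-constant) ,
  λ n r k r∣n F H H≅ h h≤1 →
    unpack {n} {k} {H} {h} {ℤ.+ (maxDegree F ℕ.* r ℕ.* k ℕ.^ 2) / 1} (solution n r k r∣n F H H≅ h h≤1 (numeral (maxDegree F) r k))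
  where
  positive-constant : 0ℚ + 1ℚ ≤ constant
  positive-constant = ≤-by (ι 4 * ι 260 + 1ℚ) (0≤p+q (0≤p*q (0≤ι 4) (0≤ι 260)) 0≤1) (trans constant-def (lemma (ι 4 * ι 260)))
    where
    lemma : ∀ x → x + 2ℚ ≡ 0ℚ + 1ℚ + (x + 1ℚ)
    lemma = solve-∀ ℚ-ring
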